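{- Let $a\ge 2$ be an integer and let $\rho=2^{a+1}$. Let \[ N(\rho)=\left\{2\rho^2,\,6\rho^2,\,10\rho^2,\,14\rho^2,\,30\rho^2,\,46\rho^2,\,6\left(\tfrac{\rho}{2}\right)^2,\,14\left(\tfrac{\rho}{2}\right)^2,\,22\left(\tfrac{\rho}{2}\right)^2,\,30\left(\tfrac{\rho}{2}\right)^2\right\}. \] Then every positive integer $n\notin N(\rho)$ is a sum of $4$ squares of integers in $S_\rho$. Furthermore, every integer in $N(\rho)$ is a sum of $5$ squares of integers in $S_\rho$, and hence $M(\rho)=5$.
   Context: For a positive integer $\rho$, let $S_\rho=\{n\in\mathbb{Z} : n\ge 0,\ n\neq\rho\}$ (note $0\in S_\rho$). For a positive integer $n$, let $k_\rho(n)$ be the least positive integer $m$ such that $n=x_1^2+\cdots+x_m^2$ for some $x_1,\dots,x_m\in S_\rho$, and $k_\rho(n)=\infty$ if no such $m$ exists. Let $I(\rho)=\{n\ge1 : k_\rho(n)=\infty\}$ and $M(\rho)=\max\{k_\rho(n) : n\ge 1,\ n\notin I(\rho)\}$. -}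

module Defs where

open import Data.Nat using (ℕ; zero; suc; _+_; _*_; _^_; _≤_; _<_)
open import Data.Vec using (Vec; foldr; map)
open import Data.Vec.Relation.Unary.All using (All)
open import Data.List using (List; _∷_; [])
open import Data.Product using (Σ; _×_)
open import Relation.Nullary using (¬_)
open import Relation.Binary.PropositionalEquality using (_≡_; _≢_)

sumSq : {m : ℕ} → Vec ℕ m → ℕ
sumSq v = foldr _ _+_ 0 (map (λ x → x * x) v)

-- Rep ρ m n : n = x₁² + ⋯ + xₘ² with every xᵢ ∈ S_ρ = {x ≥ 0 , x ≠ ρ}
Rep : ℕ → ℕ → ℕ → Set
Rep ρ m n = Σ (Vec ℕ m) (λ xs → All (λ x → x ≢ ρ) xs × sumSq xs ≡ n)

KIs : ℕ → ℕ → ℕ → Set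
KIs ρ n m = (1 ≤ m) × Rep ρ m n × (∀ m' → 1 ≤ m' → m' < m → ¬ Rep ρ m' n)

-- MIs ρ M : M(ρ) = M, the maximum of the finite values k_ρ(n), n ≥ 1
MIs : ℕ → ℕ → Set
MIs ρ M = Σ ℕ (λ n → (1 ≤ n) × KIs ρ n M)
        × (∀ n k → 1 ≤ n → KIs ρ n k → k ≤ M)

Nset : ℕ → List ℕ
Nset a = 2 * r2 ∷ 6 * r2 ∷ 10 * r2 ∷ 14 * r2 ∷ 30 * r2 ∷ 46 * r2
       ∷ 6 * h2 ∷ 14 * h2 ∷ 22 * h2 ∷ 30 * h2 ∷ []
  where
  r2 = 2 ^ suc a * 2 ^ suc a
  h2 = 2 ^ a * 2 ^ a

{-# OPTIONS --safe #-}
module Submission where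

-- By Lagrange n = x² + y² + z² + w². Besides sign changes the proof uses two moves: (x, y, z) may be replaced
-- by (x − 2t, y − 2t, z − 2t) when x + y + z = 3t, and m = p² + q² + r² + s² gives
-- 2m = (p + q)² + (p − q)² + (r + s)² + (r − s)².
--
-- If 8 ∣ n and n is a sum of four squares, all four are even, so (n, ρ) may be replaced by (n / 4, ρ / 2);
-- if n / 4 is odd, a representation of n by odd squares avoids any even ρ.
--
-- Suppose 4 ∤ n, 4 ∣ ρ, and 8 ∣ ρ if n is odd, and let n = ρ² + y² + z² + w² with y odd. One may assume that
-- not all of y, z, w are divisible by 3, since reflecting the triple removes common factors 3. Then signs can be
-- chosen such that ρ + y + z is divisible by 3, possibly after permuting y, z, w, and the first move eliminates ρ
-- unless ρ ∣ y + z, 2ρ ∣ z − 2y − ρ or 2ρ ∣ y − 2z − ρ. If this fails for all admissible signs and pairs,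
-- then ρ ∣ 2y, or ρ ∣ 4y and n is odd: absurd.
--
-- For ρ = 1 and ρ = 2 only n = 2m with m odd remains. If every pairing in the second move fails, then n lies in
-- one of four one-parameter families. There the first move, applied according to the parameter modulo 3, gives
-- polynomial representations avoiding ρ except at finitely many parameters; these yield the exceptions.

open import Defs
open import Data.Nat using (ℕ; suc; zero; _^_; _≤_; z≤n; s≤s)
import Data.Nat as ℕ
import Data.Nat.Properties as ℕ
import Data.Nat.Divisibility as ℕ
open import Data.Nat.Induction using (<-wellFounded)
open import Data.Nat.ListAction using (product)
open import Data.Nat.Primality using (Prime; prime⇒irreducible; prime⇒nonZero; prime⇒nonTrivial; euclidsLemma)
open import Data.Nat.Primality.Factorisation using (factorise; module PrimeFactorisation)
import Data.Nat.Tactic.RingSolver as ℕSolver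
open import Data.Integer using (ℤ; +_; -[1+_]; _+_; _*_; _-_; -_) renaming (∣_∣ to abs)
import Data.Integer as ℤ
import Data.Integer.Properties as ℤ
open import Data.Integer.Divisibility.Signed
open import Data.Integer.DivMod using (_%ℕ_; _/ℕ_; n%ℕd<d; a≡a%ℕn+[a/ℕn]*n)
open import Data.Integer.Tactic.RingSolver using (solve-∀)
open import Data.Fin using (Fin; toℕ; fromℕ<)
open import Data.Fin.Properties using (pigeonhole; toℕ<n; fromℕ<-injective)
open import Data.List using (List; []; _∷_; map)
open import Data.List.Membership.Propositional using (_∈_; find)
import Data.List.Membership.DecPropositional ℕ._≟_ as DecMembership
import Data.List.Relation.Unary.All as List
open import Data.List.Relation.Unary.All using ([]; _∷_)
import Data.List.Relation.Unary.Any as Any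
import Data.List.Relation.Unary.Any.Properties as Any
open import Data.Vec using (Vec; []; _∷_)
import Data.Vec as Vec
import Data.Vec.Relation.Unary.All as VecAll
open import Data.Vec.Relation.Unary.All using ([]; _∷_)
open import Data.Product using (∃; ∃₂; _×_; _,_; proj₁; proj₂)
open import Data.Sum using (_⊎_; inj₁; inj₂; [_,_]′)
open import Data.Empty using (⊥; ⊥-elim)
open import Function using (_∘_)
open import Induction.WellFounded using (Acc; acc)
open import Relation.Binary.Definitions using (tri<; tri≈; tri>)
open import Relation.Binary.PropositionalEquality
open import Relation.Nullary using (¬_; Dec; yes; no; contradiction)
open import Relation.Nullary.Decidable using (True; toWitness; from-no; ¬?; _⊎-dec_)

-- Lagrange's four square theorem

-- The first move is integral only on triples with sum divisible by 3. As a power of two is prime to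
-- 3, no triple containing ρ qualifies when y, z and w are all multiples of 3; this is why common
-- factors 3 have to be removed beforehand. That ρ ∣ 2y and ρ ∣ 4y are absurd for odd y rests on 4 ∣
-- ρ and 8 ∣ ρ. Odd n is safe, because it does not descend and a ≥ 2 gives 8 ∣ ρ. Even n may descend
-- until ρ is 2 or 1, where nothing is absurd any more. The exceptions arise there: 2, 6, 10, 14,
-- 30, 46 at ρ = 1 and 6, 14, 22, 30 at ρ = 2. Going back up multiplies n and ρ² by 4 alike, which
-- turns these numbers into the coefficients of ρ² and of (ρ/2)².

sumOf4 : ℤ → ℤ → ℤ → ℤ → ℤ
sumOf4 x y z w = x * x + y * y + z * z + w * w

FourSquares : ℤ → Set
FourSquares n = ∃ λ x → ∃ λ y → ∃ λ z → ∃ λ w → n ≡ sumOf4 x y z w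

-- Multiplicativity of the quaternion norm: the right side lists the components of v times the
-- conjugate of u, for u = a + bi + cj + dk and v = x + yi + zj + wk. Thanks to the conjugate, u ≡ v
-- modulo m makes the imaginary parts vanish modulo m and the real part congruent to the norm, as
-- the descent requires.
euler : ∀ a b c d x y z w →
  (a * a + b * b + c * c + d * d) * (x * x + y * y + z * z + w * w) ≡
    (a * x + b * y + c * z + d * w) * (a * x + b * y + c * z + d * w)
  + (a * y - b * x + c * w - d * z) * (a * y - b * x + c * w - d * z)
  + (a * z - c * x + d * y - b * w) * (a * z - c * x + d * y - b * w)
  + (a * w - d * x + b * z - c * y) * (a * w - d * x + b * z - c * y)
euler = solve-∀

fourSquares-* : ∀ {m n} → FourSquares m → FourSquares n → FourSquares (m * n)
fourSquares-* (a , b , c , d , refl) (x , y , z , w , refl) =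
  a * x + b * y + c * z + d * w , a * y - b * x + c * w - d * z ,
  a * z - c * x + d * y - b * w , a * w - d * x + b * z - c * y , euler a b c d x y z w

+∣x∣*∣x∣ : ∀ x → + (abs x ℕ.* abs x) ≡ x * x
+∣x∣*∣x∣ x = trans (ℤ.pos-* (abs x) (abs x)) (lemma x)
  where
  lemma : ∀ x → + abs x * + abs x ≡ x * x
  lemma (+ n) = refl
  lemma -[1+ n ] = refl

-- The bound is not strict, because for even m the residue m / 2 has no smaller representative;
-- `top-case` deals with equality.
centredResidue : ∀ (x : ℤ) (m : ℕ) .{{_ : ℕ.NonZero m}} →
  ∃₂ λ y q → x ≡ y + q * + m × 2 ℕ.* abs y ≤ m
centredResidue x m with 2 ℕ.* (x %ℕ m) ℕ.≤? m
... | yes 2r≤m = + (x %ℕ m) , x /ℕ m , a≡a%ℕn+[a/ℕn]*n x m , 2r≤m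
... | no 2r≰m = - (+ (m ℕ.∸ r)) , ℤ.suc (x /ℕ m) , eq , bound
  where
  r = x %ℕ m
  r≤m : r ≤ m
  r≤m = ℕ.<⇒≤ (n%ℕd<d x m)
  shift : ∀ r q k → r + q * (r + k) ≡ - k + (+ 1 + q) * (r + k)
  shift = solve-∀
  m≡ : + m ≡ + r + + (m ℕ.∸ r)
  m≡ = trans (cong +_ (sym (ℕ.m+[n∸m]≡n r≤m))) (ℤ.pos-+ r (m ℕ.∸ r))
  eq : x ≡ - (+ (m ℕ.∸ r)) + ℤ.suc (x /ℕ m) * + m
  eq = trans (a≡a%ℕn+[a/ℕn]*n x m)
    (subst (λ k → + r + x /ℕ m * k ≡ - (+ (m ℕ.∸ r)) + (+ 1 + x /ℕ m) * k) (sym m≡)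
      (shift (+ r) (x /ℕ m) (+ (m ℕ.∸ r))))
  double : ∀ k → 2 ℕ.* k ≡ k ℕ.+ k
  double = ℕSolver.solve-∀
  m∸r≤r : m ℕ.∸ r ≤ r
  m∸r≤r = ℕ.m≤n+o⇒m∸n≤o m r (ℕ.≤-trans (ℕ.<⇒≤ (ℕ.≰⇒> 2r≰m)) (ℕ.≤-reflexive (double r)))
  bound : 2 ℕ.* abs (- (+ (m ℕ.∸ r))) ≤ m
  bound = begin
    2 ℕ.* abs (- (+ (m ℕ.∸ r)))  ≡⟨ cong (2 ℕ.*_) (ℤ.∣-i∣≡∣i∣ (+ (m ℕ.∸ r))) ⟩
    2 ℕ.* (m ℕ.∸ r)            ≡⟨ double (m ℕ.∸ r) ⟩
    (m ℕ.∸ r) ℕ.+ (m ℕ.∸ r)    ≤⟨ ℕ.+-monoˡ-≤ (m ℕ.∸ r) m∸r≤r ⟩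
    r ℕ.+ (m ℕ.∸ r)            ≡⟨ ℕ.m+[n∸m]≡n r≤m ⟩
    m                          ∎
    where open ℕ.≤-Reasoning

+-tight : ∀ {a b m n} → a ≤ m → b ≤ n → a ℕ.+ b ≡ m ℕ.+ n → a ≡ m × b ≡ n
+-tight {a} {b} {m} {n} a≤m b≤n eq = ℕ.≤-antisym a≤m m≤a , ℕ.≤-antisym b≤n n≤b
  where
  m≤a : m ≤ a
  m≤a = ℕ.+-cancelʳ-≤ n m a (ℕ.≤-trans (ℕ.≤-reflexive (sym eq)) (ℕ.+-monoʳ-≤ a b≤n))
  n≤b : n ≤ b
  n≤b = ℕ.+-cancelˡ-≤ m n b (ℕ.≤-trans (ℕ.≤-reflexive (sym eq)) (ℕ.+-monoˡ-≤ b a≤m))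

m*m≡n*n⇒m≡n : ∀ {m n} → m ℕ.* m ≡ n ℕ.* n → m ≡ n
m*m≡n*n⇒m≡n {m} {n} eq with ℕ.<-cmp m n
... | tri< m<n _ _ = contradiction eq (ℕ.<⇒≢ (ℕ.*-mono-< m<n m<n))
... | tri≈ _ m≡n _ = m≡n
... | tri> _ _ m>n = contradiction (sym eq) (ℕ.<⇒≢ (ℕ.*-mono-< m>n m>n))

-- Infinite descent on the multiplier of a prime

module _ {p : ℕ} (isPrime : Prime p) where

  private instance
    p≢0 : ℕ.NonZero p
    p≢0 = prime⇒nonZero isPrime

  no-proper-divisor : ∀ {m} → 1 ℕ.< m → m ℕ.< p → ¬ m ℕ.∣ p
  no-proper-divisor 1<m m<p m∣p with prime⇒irreducible isPrime m∣p
  ... | inj₁ refl = ℕ.<-irrefl refl 1<m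
  ... | inj₂ refl = ℕ.<-irrefl refl m<p

  -- Reducing the entries modulo m to residues yᵢ with |yᵢ| ≤ m / 2 gives Σ yᵢ² = r m with r ≤ m.
  -- Euler's product of the two sums is m² r p with all four entries divisible by m, so r p is a sum
  -- of four squares. The extremes r = 0 and r = m would make m a proper divisor of p.
  descent : ∀ m → Acc ℕ._<_ m → 0 ℕ.< m → m ℕ.< p → FourSquares (+ m * + p) → FourSquares (+ p)
  descent 1 _ _ _ (x , y , z , w , eq) = x , y , z , w , trans (sym (ℤ.*-identityˡ (+ p))) eq
  descent m@(suc (suc m′)) (acc rec) _ m<p (x₁ , x₂ , x₃ , x₄ , mp≡)
    with y₁ , q₁ , refl , y₁≤ ← centredResidue x₁ m
    with y₂ , q₂ , refl , y₂≤ ← centredResidue x₂ m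
    with y₃ , q₃ , refl , y₃≤ ← centredResidue x₃ m
    with y₄ , q₄ , refl , y₄≤ ← centredResidue x₄ m
    = finish
    where
    -- As xᵢ = yᵢ + qᵢ m, this is (Σ xᵢ² - Σ yᵢ²) / m; hence p = r + K.
    K : ℤ
    K = + 2 * (y₁ * q₁ + y₂ * q₂ + y₃ * q₃ + y₄ * q₄) + + m * sumOf4 q₁ q₂ q₃ q₄

    expand : ∀ y₁ y₂ y₃ y₄ q₁ q₂ q₃ q₄ m →
      (y₁ + q₁ * m) * (y₁ + q₁ * m) + (y₂ + q₂ * m) * (y₂ + q₂ * m)
      + (y₃ + q₃ * m) * (y₃ + q₃ * m) + (y₄ + q₄ * m) * (y₄ + q₄ * m)
      ≡ (y₁ * y₁ + y₂ * y₂ + y₃ * y₃ + y₄ * y₄)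
        + m * (+ 2 * (y₁ * q₁ + y₂ * q₂ + y₃ * q₃ + y₄ * q₄)
               + m * (q₁ * q₁ + q₂ * q₂ + q₃ * q₃ + q₄ * q₄))
    expand = solve-∀

    Y : ℤ
    Y = sumOf4 y₁ y₂ y₃ y₄

    mp≡Y+mK : + m * + p ≡ Y + + m * K
    mp≡Y+mK = trans mp≡ (expand y₁ y₂ y₃ y₄ q₁ q₂ q₃ q₄ (+ m))

    S : ℕ
    S = abs y₁ ℕ.* abs y₁ ℕ.+ (abs y₂ ℕ.* abs y₂ ℕ.+ (abs y₃ ℕ.* abs y₃ ℕ.+ abs y₄ ℕ.* abs y₄))

    +S≡Y : + S ≡ Y
    +S≡Y = trans (cong₂ _+_ (+∣x∣*∣x∣ y₁) (cong₂ _+_ (+∣x∣*∣x∣ y₂) (cong₂ _+_ (+∣x∣*∣x∣ y₃) (+∣x∣*∣x∣ y₄))))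
      (assoc (y₁ * y₁) (y₂ * y₂) (y₃ * y₃) (y₄ * y₄))
      where
      assoc : ∀ a b c d → a + (b + (c + d)) ≡ a + b + c + d
      assoc = solve-∀

    m∣S : m ℕ.∣ S
    m∣S = ∣⇒∣ᵤ {+ m} {+ S} (divides (+ p - K) (trans +S≡Y
      (solveY (trans (sym (ℤ.*-comm (+ m) (+ p))) mp≡Y+mK))))
      where
      cancel : ∀ y m k → y ≡ (y + m * k) - k * m
      cancel = solve-∀
      distrib : ∀ p k m → p * m - k * m ≡ (p - k) * m
      distrib = solve-∀
      solveY : + p * + m ≡ Y + + m * K → Y ≡ (+ p - K) * + m
      solveY eq = trans (cancel Y (+ m) K) (trans (cong (_- K * + m) (sym eq)) (distrib (+ p) K (+ m)))

    r : ℕ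
    r = ℕ.quotient m∣S

    S≡r*m : S ≡ r ℕ.* m
    S≡r*m = ℕ._∣_.equality m∣S

    Y≡m*r : Y ≡ + m * + r
    Y≡m*r = trans (sym +S≡Y) (trans (cong +_ S≡r*m) (trans (ℤ.pos-* r m) (ℤ.*-comm (+ r) (+ m))))

    p≡r+K : + p ≡ + r + K
    p≡r+K = ℤ.*-cancelˡ-≡ (+ m) (+ p) (+ r + K)
      (trans mp≡Y+mK (trans (cong (_+ + m * K) Y≡m*r) (sym (ℤ.*-distribˡ-+ (+ m) (+ r) K))))

    scaled : 2 ℕ.* abs y₁ ℕ.* (2 ℕ.* abs y₁) ℕ.+ (2 ℕ.* abs y₂ ℕ.* (2 ℕ.* abs y₂)
      ℕ.+ (2 ℕ.* abs y₃ ℕ.* (2 ℕ.* abs y₃) ℕ.+ 2 ℕ.* abs y₄ ℕ.* (2 ℕ.* abs y₄))) ≡ 4 ℕ.* (r ℕ.* m)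
    scaled = trans (ident (abs y₁) (abs y₂) (abs y₃) (abs y₄)) (cong (4 ℕ.*_) S≡r*m)
      where
      ident : ∀ a b c d → 2 ℕ.* a ℕ.* (2 ℕ.* a) ℕ.+
        (2 ℕ.* b ℕ.* (2 ℕ.* b) ℕ.+ (2 ℕ.* c ℕ.* (2 ℕ.* c) ℕ.+ 2 ℕ.* d ℕ.* (2 ℕ.* d)))
         ≡ 4 ℕ.* (a ℕ.* a ℕ.+ (b ℕ.* b ℕ.+ (c ℕ.* c ℕ.+ d ℕ.* d)))
      ident = ℕSolver.solve-∀

    four : ∀ k → 4 ℕ.* k ≡ k ℕ.+ (k ℕ.+ (k ℕ.+ k))
    four = ℕSolver.solve-∀

    r≤m : r ≤ m
    r≤m = ℕ.*-cancelʳ-≤ r m m (ℕ.*-cancelˡ-≤ 4 (begin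
      4 ℕ.* (r ℕ.* m) ≡⟨ sym scaled ⟩
      _ ≤⟨ ℕ.+-mono-≤ (ℕ.*-mono-≤ y₁≤ y₁≤) (ℕ.+-mono-≤ (ℕ.*-mono-≤ y₂≤ y₂≤)
        (ℕ.+-mono-≤ (ℕ.*-mono-≤ y₃≤ y₃≤) (ℕ.*-mono-≤ y₄≤ y₄≤))) ⟩
      m ℕ.* m ℕ.+ (m ℕ.* m ℕ.+ (m ℕ.* m ℕ.+ m ℕ.* m)) ≡⟨ sym (four (m ℕ.* m)) ⟩
      4 ℕ.* (m ℕ.* m) ∎))
      where open ℕ.≤-Reasoning

    -- In p = r + K every term of K carries a factor 2yᵢ or m. The 2 stays with yᵢ because for r = m
    -- each residue is ± m / 2, so that only 2yᵢ is a multiple of m.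
    degenerate : m ℕ.∣ r → m ℕ.∣ 2 ℕ.* abs y₁ → m ℕ.∣ 2 ℕ.* abs y₂ → m ℕ.∣ 2 ℕ.* abs y₃ →
      m ℕ.∣ 2 ℕ.* abs y₄ → ⊥
    degenerate m∣r d₁ d₂ d₃ d₄ = no-proper-divisor (s≤s (s≤s z≤n)) m<p
      (∣⇒∣ᵤ {+ m} {+ p} (subst (+ m ∣_) (sym p≡r+K)
      (∣m∣n⇒∣m+n {+ m} {+ r} (∣ᵤ⇒∣ m∣r) (∣m∣n⇒∣m+n
        (subst (+ m ∣_) (regroup y₁ y₂ y₃ y₄ q₁ q₂ q₃ q₄)
          (∣m∣n⇒∣m+n (∣m∣n⇒∣m+n (∣m∣n⇒∣m+n (part y₁ q₁ d₁) (part y₂ q₂ d₂)) (part y₃ q₃ d₃)) (part y₄ q₄ d₄)))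
        (∣m⇒∣m*n {+ m} {+ m} (sumOf4 q₁ q₂ q₃ q₄) ∣-refl)))))
      where
      regroup : ∀ y₁ y₂ y₃ y₄ q₁ q₂ q₃ q₄ →
        + 2 * y₁ * q₁ + + 2 * y₂ * q₂ + + 2 * y₃ * q₃ + + 2 * y₄ * q₄
        ≡ + 2 * (y₁ * q₁ + y₂ * q₂ + y₃ * q₃ + y₄ * q₄)
      regroup = solve-∀
      part : ∀ y q → m ℕ.∣ 2 ℕ.* abs y → + m ∣ + 2 * y * q
      part y q d = ∣m⇒∣m*n {+ m} {+ 2 * y} q (∣ᵤ⇒∣ (subst (m ℕ.∣_) (sym (ℤ.abs-* (+ 2) y)) d))

    zero-case : r ≡ 0 → ⊥
    zero-case r≡0 = degenerate (subst (m ℕ.∣_) (sym r≡0) (m ℕ.∣0))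
      (null (abs y₁) (proj₁ z₁)) (null (abs y₂) (proj₁ z₂)) (null (abs y₃) (proj₁ z₃))
        (null (abs y₄) (proj₂ z₃))
      where
      split : ∀ a {b} → a ℕ.+ b ≡ 0 → a ≡ 0 × b ≡ 0
      split a eq = ℕ.m+n≡0⇒m≡0 a eq , ℕ.m+n≡0⇒n≡0 a eq
      z₁ = split (abs y₁ ℕ.* abs y₁) (trans S≡r*m (cong (ℕ._* m) r≡0))
      z₂ = split (abs y₂ ℕ.* abs y₂) (proj₂ z₁)
      z₃ = split (abs y₃ ℕ.* abs y₃) (proj₂ z₂)
      null : ∀ k → k ℕ.* k ≡ 0 → m ℕ.∣ 2 ℕ.* k
      null k eq = subst (λ j → m ℕ.∣ 2 ℕ.* j) (sym (m*m≡n*n⇒m≡n {k} {0} eq)) (m ℕ.∣0)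

    top-case : r ≡ m → ⊥
    top-case r≡m = degenerate (subst (m ℕ.∣_) (sym r≡m) ℕ.∣-refl)
      (half (2 ℕ.* abs y₁) (proj₁ t₁)) (half (2 ℕ.* abs y₂) (proj₁ t₂))
      (half (2 ℕ.* abs y₃) (proj₁ t₃)) (half (2 ℕ.* abs y₄) (proj₂ t₃))
      where
      t₁ = +-tight (ℕ.*-mono-≤ y₁≤ y₁≤) (ℕ.+-mono-≤ (ℕ.*-mono-≤ y₂≤ y₂≤)
        (ℕ.+-mono-≤ (ℕ.*-mono-≤ y₃≤ y₃≤) (ℕ.*-mono-≤ y₄≤ y₄≤)))
             (trans scaled (trans (cong (λ k → 4 ℕ.* (k ℕ.* m)) r≡m) (four (m ℕ.* m))))
      t₂ = +-tight (ℕ.*-mono-≤ y₂≤ y₂≤) (ℕ.+-mono-≤ (ℕ.*-mono-≤ y₃≤ y₃≤) (ℕ.*-mono-≤ y₄≤ y₄≤)) (proj₂ t₁)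
      t₃ = +-tight (ℕ.*-mono-≤ y₃≤ y₃≤) (ℕ.*-mono-≤ y₄≤ y₄≤) (proj₂ t₂)
      half : ∀ k → k ℕ.* k ≡ m ℕ.* m → m ℕ.∣ k
      half k eq = ℕ.∣-reflexive (sym (m*m≡n*n⇒m≡n {k} {m} eq))

    -- A, B, C, D are Euler's entries divided by m: after xᵢ = yᵢ + qᵢ m the products yᵢ yⱼ cancel
    -- in the last three, and the first becomes Σ yᵢ² + m Σ qᵢ yᵢ = m (r + Σ qᵢ yᵢ).
    smaller : FourSquares (+ r * + p)
    smaller = A , B , C , D , ℤ.*-cancelˡ-≡ (+ m) _ _ (ℤ.*-cancelˡ-≡ (+ m) _ _ (begin
      + m * (+ m * (+ r * + p)) ≡⟨ swap (+ m) (+ r) (+ p) ⟩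
      (+ m * + p) * (+ m * + r) ≡⟨ cong₂ _*_ mp≡ (sym Y≡m*r) ⟩
      sumOf4 x₁ x₂ x₃ x₄ * sumOf4 y₁ y₂ y₃ y₄ ≡⟨ euler x₁ x₂ x₃ x₄ y₁ y₂ y₃ y₄ ⟩
      _ ≡⟨ cong₂ _+_ (cong₂ _+_ (cong₂ _+_ (square eqA) (square (antisym y₁ y₂ y₃ y₄ q₁ q₂ q₃ q₄ (+ m))))
             (square (antisym y₁ y₃ y₄ y₂ q₁ q₃ q₄ q₂ (+ m))))
               (square (antisym y₁ y₄ y₂ y₃ q₁ q₄ q₂ q₃ (+ m))) ⟩
      sumOf4 (+ m * A) (+ m * B) (+ m * C) (+ m * D) ≡⟨ factor (+ m) A B C D ⟩
      + m * (+ m * sumOf4 A B C D) ∎))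
      where
      open ≡-Reasoning
      A = + r + (q₁ * y₁ + q₂ * y₂ + q₃ * y₃ + q₄ * y₄)
      B = q₁ * y₂ - q₂ * y₁ + q₃ * y₄ - q₄ * y₃
      C = q₁ * y₃ - q₃ * y₁ + q₄ * y₂ - q₂ * y₄
      D = q₁ * y₄ - q₄ * y₁ + q₂ * y₃ - q₃ * y₂
      swap : ∀ m r p → m * (m * (r * p)) ≡ (m * p) * (m * r)
      swap = solve-∀
      square : ∀ {a b} → a ≡ b → a * a ≡ b * b
      square refl = refl
      factor : ∀ m a b c d → (m * a) * (m * a) + (m * b) * (m * b) + (m * c) * (m * c) + (m * d) * (m * d)
        ≡ m * (m * (a * a + b * b + c * c + d * d))
      factor = solve-∀
      antisym : ∀ y₁ y₂ y₃ y₄ q₁ q₂ q₃ q₄ m →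
        (y₁ + q₁ * m) * y₂ - (y₂ + q₂ * m) * y₁ + (y₃ + q₃ * m) * y₄ - (y₄ + q₄ * m) * y₃
        ≡ m * (q₁ * y₂ - q₂ * y₁ + q₃ * y₄ - q₄ * y₃)
      antisym = solve-∀
      symm : ∀ y₁ y₂ y₃ y₄ q₁ q₂ q₃ q₄ m →
        (y₁ + q₁ * m) * y₁ + (y₂ + q₂ * m) * y₂ + (y₃ + q₃ * m) * y₃ + (y₄ + q₄ * m) * y₄
        ≡ (y₁ * y₁ + y₂ * y₂ + y₃ * y₃ + y₄ * y₄) + m * (q₁ * y₁ + q₂ * y₂ + q₃ * y₃ + q₄ * y₄)
      symm = solve-∀
      eqA : x₁ * y₁ + x₂ * y₂ + x₃ * y₃ + x₄ * y₄ ≡ + m * A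
      eqA = trans (symm y₁ y₂ y₃ y₄ q₁ q₂ q₃ q₄ (+ m))
        (trans (cong (_+ + m * (q₁ * y₁ + q₂ * y₂ + q₃ * y₃ + q₄ * y₄)) Y≡m*r)
          (sym (ℤ.*-distribˡ-+ (+ m) (+ r) _)))

    finish : FourSquares (+ p)
    finish with r ℕ.≟ 0 | r ℕ.≟ m
    ... | yes r≡0 | _ = ⊥-elim (zero-case r≡0)
    ... | no _ | yes r≡m = ⊥-elim (top-case r≡m)
    ... | no r≢0 | no r≢m = descent r (rec r<m) (ℕ.n≢0⇒n>0 r≢0) (ℕ.<-trans r<m m<p) smaller
      where
      r<m = ℕ.≤∧≢⇒< r≤m r≢m

-- Solving x² + y² + 1 ≡ 0 modulo an odd prime

%ℕ-≡⇒∣- : ∀ a b d .{{_ : ℕ.NonZero d}} → a %ℕ d ≡ b %ℕ d → + d ∣ a - b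
%ℕ-≡⇒∣- a b d eq = divides (a /ℕ d - b /ℕ d) (begin
  a - b ≡⟨ cong₂ _-_ (a≡a%ℕn+[a/ℕn]*n a d) (trans (a≡a%ℕn+[a/ℕn]*n b d)
    (cong (λ k → + k + b /ℕ d * + d) (sym eq))) ⟩
  (+ (a %ℕ d) + a /ℕ d * + d) - (+ (a %ℕ d) + b /ℕ d * + d) ≡⟨ cancel (+ (a %ℕ d)) (a /ℕ d) (b /ℕ d) (+ d) ⟩
  (a /ℕ d - b /ℕ d) * + d ∎)
  where
  open ≡-Reasoning
  cancel : ∀ r s t d → (r + s * d) - (r + t * d) ≡ (s - t) * d
  cancel = solve-∀

module _ {p h : ℕ} (p≡1+2h : p ≡ suc (h ℕ.+ h)) (isPrime : Prime p) where

  private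
    instance
      p≢0 : ℕ.NonZero p
      p≢0 = prime⇒nonZero isPrime

    square : ℕ → ℤ
    square i = + i * + i

    2h<p : h ℕ.+ h ℕ.< p
    2h<p = ℕ.≤-reflexive (sym p≡1+2h)

  -- The difference factors as d (2i + d), and both factors lie strictly between 0 and p.
  squares-distinct : ∀ i d → 0 ℕ.< d → i ℕ.+ d ≤ h → ¬ + p ∣ square (i ℕ.+ d) - square i
  squares-distinct i d d>0 i+d≤h p∣ =
    [ ℕ.>⇒∤ {{ℕ.>-nonZero d>0}} (ℕ.≤-<-trans (ℕ.≤-trans (ℕ.m≤n+m d i) (ℕ.≤-trans i+d≤h (ℕ.m≤m+n h h))) 2h<p)
    , ℕ.>⇒∤ {{ℕ.>-nonZero (ℕ.<-≤-trans d>0 (ℕ.m≤n+m d (i ℕ.+ i)))}} i+i+d<p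
    ]′ (euclidsLemma d (i ℕ.+ i ℕ.+ d) isPrime
         (∣⇒∣ᵤ {+ p} {+ (d ℕ.* (i ℕ.+ i ℕ.+ d))} (subst (+ p ∣_) factor p∣)))
    where
    difference : ∀ i d → (i + d) * (i + d) - i * i ≡ d * (i + i + d)
    difference = solve-∀
    factor : square (i ℕ.+ d) - square i ≡ + (d ℕ.* (i ℕ.+ i ℕ.+ d))
    factor = trans (difference (+ i) (+ d)) (sym (ℤ.pos-* d (i ℕ.+ i ℕ.+ d)))
    i+i+d<p : i ℕ.+ i ℕ.+ d ℕ.< p
    i+i+d<p = ℕ.≤-<-trans (ℕ.≤-trans (ℕ.≤-reflexive (ℕ.+-assoc i i d))
      (ℕ.+-mono-≤ (ℕ.≤-trans (ℕ.m≤m+n i d) i+d≤h) i+d≤h)) 2h<p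

  private
    -- Indices 0, ..., h give squares, and h + 1, ..., 2h + 1 = p give the numbers -1 - y² with y ≤
    -- h. These p + 1 values share p residues but are distinct within each half, so a collision
    -- matches some x² with some -1 - y².
    value : ℕ → ℤ
    value k with k ℕ.≤? h
    ... | yes _ = square k
    ... | no _ = - (+ 1 + square (k ℕ.∸ suc h))

    slot : Fin (suc p) → Fin p
    slot i = fromℕ< (n%ℕd<d (value (toℕ i)) p)

    upper≤h : ∀ {k} → k ℕ.< suc p → k ℕ.∸ suc h ≤ h
    upper≤h {k} (s≤s k≤p) = ℕ.m≤n+o⇒m∸n≤o k (suc h) (ℕ.≤-trans k≤p (ℕ.≤-reflexive p≡1+2h))

    distinct : ∀ {i j} → i ℕ.< j → j ≤ h → ¬ + p ∣ square j - square i
    distinct {i} {j} i<j j≤h = subst (λ k → ¬ + p ∣ square k - square i) i+d≡j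
      (squares-distinct i (j ℕ.∸ i) (ℕ.m<n⇒0<n∸m i<j) (ℕ.≤-trans (ℕ.≤-reflexive i+d≡j) j≤h))
      where
      i+d≡j : i ℕ.+ (j ℕ.∸ i) ≡ j
      i+d≡j = ℕ.m+[n∸m]≡n (ℕ.<⇒≤ i<j)

    negate₂ : ∀ a b → - (- (+ 1 + b) - - (+ 1 + a)) ≡ b - a
    negate₂ = solve-∀

    negate₁ : ∀ a b → - (- (+ 1 + b) - a) ≡ a + b + + 1
    negate₁ = solve-∀

    pos-total : ∀ x y → square x + square y + + 1 ≡ + (x ℕ.* x ℕ.+ y ℕ.* y ℕ.+ 1)
    pos-total x y = cong (_+ + 1) (sym (cong₂ _+_ (ℤ.pos-* x x) (ℤ.pos-* y y)))

    resolve : ∀ {i j} → i ℕ.< j → j ℕ.< suc p → + p ∣ value j - value i →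
      ∃₂ λ x y → x ≤ h × y ≤ h × p ℕ.∣ x ℕ.* x ℕ.+ y ℕ.* y ℕ.+ 1
    resolve {i} {j} i<j j<1+p p∣ with i ℕ.≤? h | j ℕ.≤? h
    ... | yes _ | yes j≤h = ⊥-elim (distinct i<j j≤h p∣)
    ... | no i≰h | yes j≤h = contradiction (ℕ.≤-trans (ℕ.<⇒≤ i<j) j≤h) i≰h
    ... | no i≰h | no j≰h = ⊥-elim (distinct (ℕ.∸-monoˡ-< i<j (ℕ.≰⇒> i≰h)) (upper≤h j<1+p)
            (subst (+ p ∣_) (negate₂ (square (i ℕ.∸ suc h)) (square (j ℕ.∸ suc h)))
              (∣m⇒∣-m {+ p} {m = - (+ 1 + square (j ℕ.∸ suc h)) - - (+ 1 + square (i ℕ.∸ suc h))} p∣)))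
    ... | yes i≤h | no j≰h = i , y , i≤h , upper≤h j<1+p ,
            ∣⇒∣ᵤ {+ p} {+ (i ℕ.* i ℕ.+ y ℕ.* y ℕ.+ 1)}
              (subst (+ p ∣_) (trans (negate₁ (square i) (square y)) (pos-total i y))
                (∣m⇒∣-m {+ p} {m = - (+ 1 + square y) - square i} p∣))
      where
      y = j ℕ.∸ suc h

  -1-sumOfTwoSquares-mod : ∃₂ λ x y → x ≤ h × y ≤ h × p ℕ.∣ x ℕ.* x ℕ.+ y ℕ.* y ℕ.+ 1
  -1-sumOfTwoSquares-mod with i , j , i<j , eq ← pigeonhole (ℕ.n<1+n p) slot =
    resolve {toℕ i} {toℕ j} i<j (toℕ<n j)
      (%ℕ-≡⇒∣- (value (toℕ j)) (value (toℕ i)) p (sym (fromℕ<-injective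
        (value (toℕ i) %ℕ p) (value (toℕ j) %ℕ p) (n%ℕd<d (value (toℕ i)) p) (n%ℕd<d (value (toℕ j)) p) eq)))

halve : ∀ n → ∃ λ h → n ≡ h ℕ.+ h ⊎ n ≡ suc (h ℕ.+ h)
halve zero = 0 , inj₁ refl
halve (suc n) with halve n
... | h , inj₁ refl = h , inj₂ refl
... | h , inj₂ refl = suc h , inj₁ (cong suc (sym (ℕ.+-suc h h)))

module _ {p h : ℕ} (p≡1+2h : p ≡ suc (h ℕ.+ h)) (isPrime : Prime p) where

  fourSquares-oddPrime : (∃₂ λ x y → x ≤ h × y ≤ h × p ℕ.∣ x ℕ.* x ℕ.+ y ℕ.* y ℕ.+ 1) → FourSquares (+ p)
  fourSquares-oddPrime (x , y , x≤h , y≤h , ℕ.divides m eq) =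
    descent isPrime m (<-wellFounded m) m>0 m<p (+ x , + y , + 1 , + 0 , mp≡)
    where
    m>0 : 0 ℕ.< m
    m>0 = ℕ.n≢0⇒n>0 λ { refl → contradiction (trans (ℕ.+-comm 1 (x ℕ.* x ℕ.+ y ℕ.* y)) eq) λ () }
    -- m p = x² + y² + 1 ≤ 2h² + 1, which falls short of p² = (2h + 1)² by 2h² + 4h.
    expand : ∀ h → h ℕ.* h ℕ.+ h ℕ.* h ℕ.+ 1 ℕ.+ (h ℕ.* h ℕ.+ h ℕ.* h ℕ.+ 4 ℕ.* h)
      ≡ (1 ℕ.+ (h ℕ.+ h)) ℕ.* (1 ℕ.+ (h ℕ.+ h))
    expand = ℕSolver.solve-∀
    h>0 : 0 ℕ.< h
    h>0 = ℕ.n≢0⇒n>0 λ { refl → ℕ.nonTrivial⇒≢1 {{prime⇒nonTrivial isPrime}} p≡1+2h }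
    m<p : m ℕ.< p
    m<p = ℕ.*-cancelʳ-< p m p (begin-strict
      m ℕ.* p                        ≡⟨ eq ⟨
      x ℕ.* x ℕ.+ y ℕ.* y ℕ.+ 1      ≤⟨ ℕ.+-monoˡ-≤ 1 (ℕ.+-mono-≤ (ℕ.*-mono-≤ x≤h x≤h) (ℕ.*-mono-≤ y≤h y≤h)) ⟩
      h ℕ.* h ℕ.+ h ℕ.* h ℕ.+ 1      <⟨ ℕ.m<m+n (h ℕ.* h ℕ.+ h ℕ.* h ℕ.+ 1)
        (ℕ.<-≤-trans (ℕ.<-≤-trans h>0 (ℕ.m≤m+n h _)) (ℕ.m≤n+m (4 ℕ.* h) (h ℕ.* h ℕ.+ h ℕ.* h))) ⟩
      h ℕ.* h ℕ.+ h ℕ.* h ℕ.+ 1 ℕ.+ (h ℕ.* h ℕ.+ h ℕ.* h ℕ.+ 4 ℕ.* h) ≡⟨ expand h ⟩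
      suc (h ℕ.+ h) ℕ.* suc (h ℕ.+ h) ≡⟨ cong₂ ℕ._*_ p≡1+2h p≡1+2h ⟨
      p ℕ.* p                        ∎)
      where open ℕ.≤-Reasoning
    mp≡ : + m * + p ≡ sumOf4 (+ x) (+ y) (+ 1) (+ 0)
    mp≡ = begin
      + m * + p                            ≡⟨ ℤ.pos-* m p ⟨
      + (m ℕ.* p)                          ≡⟨ cong +_ eq ⟨
      + (x ℕ.* x) + + (y ℕ.* y) + + 1      ≡⟨ cong (_+ + 1) (cong₂ _+_ (ℤ.pos-* x x) (ℤ.pos-* y y)) ⟩
      + x * + x + + y * + y + + 1          ≡⟨ ℤ.+-identityʳ _ ⟨
      sumOf4 (+ x) (+ y) (+ 1) (+ 0)       ∎
      where open ≡-Reasoning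

fourSquares-prime : ∀ {p} → Prime p → FourSquares (+ p)
fourSquares-prime {p} isPrime = [ even , odd ]′ (proj₂ (halve p))
  where
  h = proj₁ (halve p)
  double : ∀ h → h ℕ.+ h ≡ h ℕ.* 2
  double = ℕSolver.solve-∀
  odd : p ≡ suc (h ℕ.+ h) → FourSquares (+ p)
  odd p≡1+2h = fourSquares-oddPrime {h = h} p≡1+2h isPrime (-1-sumOfTwoSquares-mod {h = h} p≡1+2h isPrime)
  even : p ≡ h ℕ.+ h → FourSquares (+ p)
  even p≡2h with prime⇒irreducible isPrime {2} (ℕ.divides h (trans p≡2h (double h)))
  ... | inj₂ 2≡p = subst (λ k → FourSquares (+ k)) 2≡p (+ 1 , + 1 , + 0 , + 0 , refl)

fourSquares : ∀ n → FourSquares (+ n)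
fourSquares zero = + 0 , + 0 , + 0 , + 0 , refl
fourSquares n@(suc _) = subst (λ k → FourSquares (+ k)) (sym isFactorisation) (go factorsPrime)
  where
  open PrimeFactorisation (factorise n)
  go : ∀ {ps} → List.All Prime ps → FourSquares (+ product ps)
  go [] = + 1 , + 0 , + 0 , + 0 , refl
  go {p ∷ ps} (isPrime ∷ primes) = subst FourSquares (sym (ℤ.pos-* p (product ps)))
    (fourSquares-* (fourSquares-prime isPrime) (go primes))

-- Parity, residues modulo 3, equality up to sign

-- The linear relation is a separate argument, so that the divisibilities below reduce to identities
-- for the ring solver.
∣-comb₁ : ∀ {d a x} s → d ∣ a → x ≡ s * a → d ∣ x
∣-comb₁ {d} s (divides p refl) refl = divides (s * p) (lemma s p d)
  where
  lemma : ∀ s p d → s * (p * d) ≡ s * p * d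
  lemma = solve-∀

∣-comb₂ : ∀ {d a b x} s t → d ∣ a → d ∣ b → x ≡ s * a + t * b → d ∣ x
∣-comb₂ {d} s t (divides p refl) (divides q refl) refl = divides (s * p + t * q) (lemma s t p q d)
  where
  lemma : ∀ s t p q d → s * (p * d) + t * (q * d) ≡ (s * p + t * q) * d
  lemma = solve-∀

∣-comb₃ : ∀ {d a b c x} s t u → d ∣ a → d ∣ b → d ∣ c → x ≡ s * a + t * b + u * c → d ∣ x
∣-comb₃ {d} s t u (divides p refl) (divides q refl) (divides r refl) refl =
  divides (s * p + t * q + u * r) (lemma s t u p q r d)
  where
  lemma : ∀ s t u p q r d → s * (p * d) + t * (q * d) + u * (r * d) ≡ (s * p + t * q + u * r) * d
  lemma = solve-∀

Even Odd : ℤ → Set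
Even x = + 2 ∣ x
Odd x = + 2 ∣ x + + 1

parity : ∀ x → Even x ⊎ Odd x
parity x with x %ℕ 2 | x /ℕ 2 | n%ℕd<d x 2 | a≡a%ℕn+[a/ℕn]*n x 2
... | 0 | q | _ | refl = inj₁ (divides q (ℤ.+-identityˡ _))
... | 1 | q | _ | refl = inj₂ (divides (q + + 1) (lemma q))
  where
  lemma : ∀ q → + 1 + q * + 2 + + 1 ≡ (q + + 1) * + 2
  lemma = solve-∀
... | suc (suc _) | _ | s≤s (s≤s ()) | _

odd⇒¬even : ∀ {x} → Odd x → ¬ Even x
odd⇒¬even {x} o e = from-no (+ 2 ∣? + 1) (∣-comb₂ (+ 1) (- (+ 1)) o e (lemma x))
  where
  lemma : ∀ x → + 1 ≡ + 1 * (x + + 1) + - (+ 1) * x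
  lemma = solve-∀

residue₃ : ∀ x → + 3 ∣ x ⊎ + 3 ∣ x - + 1 ⊎ + 3 ∣ x + + 1
residue₃ x with x %ℕ 3 | x /ℕ 3 | n%ℕd<d x 3 | a≡a%ℕn+[a/ℕn]*n x 3
... | 0 | q | _ | refl = inj₁ (divides q (ℤ.+-identityˡ _))
... | 1 | q | _ | refl = inj₂ (inj₁ (divides q (lemma q)))
  where
  lemma : ∀ q → + 1 + q * + 3 - + 1 ≡ q * + 3
  lemma = solve-∀
... | 2 | q | _ | refl = inj₂ (inj₂ (divides (q + + 1) (lemma q)))
  where
  lemma : ∀ q → + 2 + q * + 3 + + 1 ≡ (q + + 1) * + 3
  lemma = solve-∀
... | suc (suc (suc _)) | _ | s≤s (s≤s (s≤s ())) | _

infix 4 _≡±_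
_≡±_ : ℤ → ℤ → Set
x ≡± y = x ≡ y ⊎ x ≡ - y

±-refl : ∀ x → x ≡± x
±-refl x = inj₁ refl

±-square : ∀ {x y} → x ≡± y → x * x ≡ y * y
±-square (inj₁ refl) = refl
±-square {y = y} (inj₂ refl) = neg-square y
  where
  neg-square : ∀ y → - y * - y ≡ y * y
  neg-square = solve-∀

±-∣ : ∀ {d x y} → d ∣ y → x ≡± y → d ∣ x
±-∣ d∣y (inj₁ refl) = d∣y
±-∣ {x = x} {y} d∣y (inj₂ refl) = ∣m⇒∣-m {m = y} d∣y

±-odd : ∀ {x y} → Odd y → x ≡± y → Odd x
±-odd o (inj₁ refl) = o
±-odd {x} {y} o (inj₂ refl) = ∣-comb₂ (- (+ 1)) (+ 1) o (∣-refl {+ 2}) (lemma y)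
  where
  lemma : ∀ y → - y + + 1 ≡ - (+ 1) * (y + + 1) + + 1 * + 2
  lemma = solve-∀

±-sym : ∀ {x y} → x ≡± y → y ≡± x
±-sym (inj₁ refl) = inj₁ refl
±-sym {y = y} (inj₂ refl) = inj₂ (sym (ℤ.neg-involutive y))

±-neg : ∀ {x y} → x ≡± y → - x ≡± y
±-neg (inj₁ refl) = inj₂ refl
±-neg {y = y} (inj₂ refl) = inj₁ (ℤ.neg-involutive y)

sumOf4-swap₁₂ : ∀ x y z w → sumOf4 x y z w ≡ sumOf4 y x z w
sumOf4-swap₁₂ = λ x y z w → lemma (x * x) (y * y) (z * z) (w * w)
  where
  lemma : ∀ x y z w → x + y + z + w ≡ y + x + z + w
  lemma = solve-∀

sumOf4-swap₂₃ : ∀ x y z w → sumOf4 x y z w ≡ sumOf4 x z y w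
sumOf4-swap₂₃ = λ x y z w → lemma (x * x) (y * y) (z * z) (w * w)
  where
  lemma : ∀ x y z w → x + y + z + w ≡ x + z + y + w
  lemma = solve-∀

sumOf4-swap₃₄ : ∀ x y z w → sumOf4 x y z w ≡ sumOf4 x y w z
sumOf4-swap₃₄ = λ x y z w → lemma (x * x) (y * y) (z * z) (w * w)
  where
  lemma : ∀ x y z w → x + y + z + w ≡ x + y + w + z
  lemma = solve-∀

sumOf4-± : ∀ {x x′ y y′ z z′ w w′} → x ≡± x′ → y ≡± y′ → z ≡± z′ → w ≡± w′ →
  sumOf4 x y z w ≡ sumOf4 x′ y′ z′ w′
sumOf4-± p q r s = cong₂ _+_ (cong₂ _+_ (cong₂ _+_ (±-square p) (±-square q)) (±-square r)) (±-square s)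

-- An isometry: the reflection in the plane orthogonal to u = (1, 1, 1) subtracts 2 (v · u) / (u ·
-- u) = 2t times u from v = (x, y, z). As the solver takes no hypotheses, z is replaced by 3t - x -
-- y.
sumOf4-turn : ∀ x y z w t → x + y + z ≡ t * + 3 →
  sumOf4 x y z w ≡ sumOf4 (x - + 2 * t) (y - + 2 * t) (z - + 2 * t) w
sumOf4-turn x y z w t eq = subst (λ z → sumOf4 x y z w ≡ sumOf4 (x - + 2 * t) (y - + 2 * t) (z - + 2 * t) w)
  (trans (cong (λ s → s - x - y) (sym eq)) (cancel x y z)) (identity x y w t)
  where
  cancel : ∀ x y z → x + y + z - x - y ≡ z
  cancel = solve-∀
  identity : ∀ x y w t → x * x + y * y + (t * + 3 - x - y) * (t * + 3 - x - y) + w * w ≡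
    (x - + 2 * t) * (x - + 2 * t) + (y - + 2 * t) * (y - + 2 * t)
    + (t * + 3 - x - y - + 2 * t) * (t * + 3 - x - y - + 2 * t) + w * w
  identity = solve-∀

-- The moves need signs, so representations are kept over ℤ. An integer x stands for |x|, hence both
-- signs of ρ are excluded.
Avoids : ℤ → ℤ → Set
Avoids ρ x = ¬ x ≡± ρ

avoids? : ∀ ρ x → x ≡± ρ ⊎ Avoids ρ x
avoids? ρ x with x ℤ.≟ ρ | x ℤ.≟ - ρ
... | yes p | _ = inj₁ (inj₁ p)
... | no _ | yes q = inj₁ (inj₂ q)
... | no ¬p | no ¬q = inj₂ [ ¬p , ¬q ]′

Good : ℤ → ℤ → Set
Good ρ n = ∃ λ x → ∃ λ y → ∃ λ z → ∃ λ w →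
  (Avoids ρ x × Avoids ρ y × Avoids ρ z × Avoids ρ w) × n ≡ sumOf4 x y z w

*2-cancel : ∀ {x y} → + 2 * x ≡ + 2 * y → x ≡ y
*2-cancel = ℤ.*-cancelˡ-≡ (+ 2) _ _

double-odd : ∀ {x} → Odd x → ¬ + 4 ∣ + 2 * x
double-odd {x} o d = odd⇒¬even o (*-cancelˡ-∣ (+ 2) {+ 2} {x} d)

-- Removing common factors 3 from a triple

All3∣ : ℤ → ℤ → ℤ → Set
All3∣ y z w = + 3 ∣ y × + 3 ∣ z × + 3 ∣ w

all3∣? : ∀ y z w → Dec (All3∣ y z w)
all3∣? y z w with + 3 ∣? y | + 3 ∣? z | + 3 ∣? w
... | yes p | yes q | yes r = yes (p , q , r)
... | no ¬p | _ | _ = no (¬p ∘ proj₁)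
... | _ | no ¬q | _ = no (¬q ∘ proj₁ ∘ proj₂)
... | _ | _ | no ¬r = no (¬r ∘ proj₂ ∘ proj₂)

sumOf3 : ℤ → ℤ → ℤ → ℤ
sumOf3 y z w = y * y + z * z + w * w

sumOf4-sumOf3 : ∀ x y z w → sumOf4 x y z w ≡ x * x + sumOf3 y z w
sumOf4-sumOf3 = λ x y z w → lemma (x * x) (y * y) (z * z) (w * w)
  where
  lemma : ∀ x y z w → x + y + z + w ≡ x + (y + z + w)
  lemma = solve-∀

-- Three times the reflection in (1,1,1).
reflect-triple : ∀ y z w → ¬ + 3 ∣ y + z + w →
  ∃ λ y′ → ∃ λ z′ → ∃ λ w′ → + 9 * sumOf3 y z w ≡ sumOf3 y′ z′ w′ × ¬ All3∣ y′ z′ w′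
reflect-triple y z w 3∤s = + 3 * y - + 2 * s , + 3 * z - + 2 * s , + 3 * w - + 2 * s , identity y z w ,
  λ (3∣y′ , _) → 3∤s (∣-comb₂ (+ 1) (z + w) 3∣y′ (∣-refl {+ 3}) (recover y z w))
  where
  s = y + z + w
  recover : ∀ y z w → y + z + w ≡ + 1 * (+ 3 * y - + 2 * (y + z + w)) + (z + w) * + 3
  recover = solve-∀
  identity : ∀ y z w → + 9 * (y * y + z * z + w * w) ≡
    (+ 3 * y - + 2 * (y + z + w)) * (+ 3 * y - + 2 * (y + z + w))
    + (+ 3 * z - + 2 * (y + z + w)) * (+ 3 * z - + 2 * (y + z + w))
    + (+ 3 * w - + 2 * (y + z + w)) * (+ 3 * w - + 2 * (y + z + w))
  identity = solve-∀

all3∣-signed-sums : ∀ y z w → + 3 ∣ y + z + w → + 3 ∣ y + z + - w → + 3 ∣ y + - z + w → All3∣ y z w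
all3∣-signed-sums y z w a b c =
    ∣-comb₃ (- (+ 1)) (- (+ 1)) y b c (∣-refl {+ 3}) (lemma₁ y z w)
  , ∣-comb₃ (+ 1) (- (+ 1)) z c a (∣-refl {+ 3}) (lemma₂ y z w)
  , ∣-comb₃ (+ 1) (- (+ 1)) w b a (∣-refl {+ 3}) (lemma₃ y z w)
  where
  lemma₁ : ∀ y z w → y ≡ - (+ 1) * (y + z + - w) + - (+ 1) * (y + - z + w) + y * + 3
  lemma₁ = solve-∀
  lemma₂ : ∀ y z w → z ≡ + 1 * (y + - z + w) + - (+ 1) * (y + z + w) + z * + 3
  lemma₂ = solve-∀
  lemma₃ : ∀ y z w → w ≡ + 1 * (y + z + - w) + - (+ 1) * (y + z + w) + w * + 3
  lemma₃ = solve-∀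

-- Some choice of signs makes the sum s prime to 3, since the signed sums determine the entries
-- modulo 3. The entries 3y - 2s, 3z - 2s, 3w - 2s of the tripled reflection are then prime to 3 as
-- well.
lift-triple : ∀ y z w → ¬ All3∣ y z w →
  ∃ λ y′ → ∃ λ z′ → ∃ λ w′ → + 9 * sumOf3 y z w ≡ sumOf3 y′ z′ w′ × ¬ All3∣ y′ z′ w′
lift-triple y z w 3∤ = by-sums (+ 3 ∣? y + z + w) (+ 3 ∣? y + z + - w) (+ 3 ∣? y + - z + w)
  where
  Lifted : ℤ → Set
  Lifted n = ∃ λ y′ → ∃ λ z′ → ∃ λ w′ → n ≡ sumOf3 y′ z′ w′ × ¬ All3∣ y′ z′ w′
  by-sums : Dec (+ 3 ∣ y + z + w) → Dec (+ 3 ∣ y + z + - w) → Dec (+ 3 ∣ y + - z + w) →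
    Lifted (+ 9 * sumOf3 y z w)
  by-sums (no 3∤s) _ _ = reflect-triple y z w 3∤s
  by-sums _ (no 3∤s) _ = subst (λ k → Lifted (+ 9 * (y * y + z * z + k)))
    (±-square {x = - w} (inj₂ refl)) (reflect-triple y z (- w) 3∤s)
  by-sums _ _ (no 3∤s) = subst (λ k → Lifted (+ 9 * (y * y + k + w * w)))
    (±-square {x = - z} (inj₂ refl)) (reflect-triple y (- z) w 3∤s)
  by-sums (yes a) (yes b) (yes c) = ⊥-elim (3∤ (all3∣-signed-sums y z w a b c))

∣a∣<∣3a∣ : ∀ a → a * + 3 ≢ + 0 → abs a ℕ.< abs (a * + 3)
∣a∣<∣3a∣ a 3a≢0 = subst (abs a ℕ.<_) (sym (ℤ.abs-* a (+ 3)))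
  (ℕ.m<m*n (abs a) 3 {{ℕ.≢-nonZero λ ∣a∣≡0 → 3a≢0 (cong (_* + 3) (ℤ.∣i∣≡0⇒i≡0 {a} ∣a∣≡0))}} (s≤s (s≤s z≤n)))

-- Each round strips a factor 3 from all entries and restores the lost factor 9 by `lift-triple`.
-- With y ≢ 0 the absolute value |y| decreases, and the zero triple, for which the conclusion fails,
-- is excluded.
normalise-triple : ∀ y z w → Acc ℕ._<_ (abs y) → y ≢ + 0 →
  ∃ λ y′ → ∃ λ z′ → ∃ λ w′ → sumOf3 y z w ≡ sumOf3 y′ z′ w′ × ¬ All3∣ y′ z′ w′
normalise-triple y z w (acc rec) y≢0 with all3∣? y z w
... | no 3∤ = y , z , w , refl , 3∤
... | yes (divides a refl , divides b refl , divides c refl)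
  with a′ , b′ , c′ , eq , 3∤ ← normalise-triple a b c (rec (∣a∣<∣3a∣ a y≢0)) (λ { refl → y≢0 refl })
  with y′ , z′ , w′ , eq′ , 3∤′ ← lift-triple a′ b′ c′ 3∤ =
  y′ , z′ , w′ , trans (expand a b c) (trans (cong (+ 9 *_) eq) eq′) , 3∤′
  where
  expand : ∀ a b c → a * + 3 * (a * + 3) + b * + 3 * (b * + 3) + c * + 3 * (c * + 3)
    ≡ + 9 * (a * a + b * b + c * c)
  expand = solve-∀

-- The reflection (x, y, z) ↦ (x, y, z) − 2t (1, 1, 1) with 3t = x + y + z

sumOf4-via3 : ∀ x {y z w y′ z′ w′} → sumOf3 y z w ≡ sumOf3 y′ z′ w′ → sumOf4 x y z w ≡ sumOf4 x y′ z′ w′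
sumOf4-via3 x {y} {z} {w} {y′} {z′} {w′} eq =
  trans (sumOf4-sumOf3 x y z w) (trans (cong (λ k → x * x + k) eq) (sym (sumOf4-sumOf3 x y′ z′ w′)))

-- Multiplying by 3 removes t: 3 (x - 2t) = x - 2 (y + z). If x - 2t = ± ρ this is ± 3ρ, and modulo
-- 2ρ the sign disappears.
turned-≡± : ∀ {ρ x y z t} → x + y + z ≡ t * + 3 → x - + 2 * t ≡± ρ → + 2 * ρ ∣ x - + 2 * (y + z) - + 3 * ρ
turned-≡± {ρ} {x} {y} {z} {t} s≡3t e = go e
  where
  base : x - + 2 * (y + z) - + 3 * ρ ≡ + 3 * (x - + 2 * t) - + 3 * ρ
  base = trans (rearrange x y z ρ) (trans (cong (λ s → + 3 * x - + 2 * s - + 3 * ρ) s≡3t) (rearrange′ x t ρ))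
    where
    rearrange : ∀ x y z ρ → x - + 2 * (y + z) - + 3 * ρ ≡ + 3 * x - + 2 * (x + y + z) - + 3 * ρ
    rearrange = solve-∀
    rearrange′ : ∀ x t ρ → + 3 * x - + 2 * (t * + 3) - + 3 * ρ ≡ + 3 * (x - + 2 * t) - + 3 * ρ
    rearrange′ = solve-∀
  go : x - + 2 * t ≡± ρ → + 2 * ρ ∣ x - + 2 * (y + z) - + 3 * ρ
  go (inj₁ p) = divides (+ 0) (trans base (trans (cong (λ k → + 3 * k - + 3 * ρ) p) (lemma ρ)))
    where
    lemma : ∀ ρ → + 3 * ρ - + 3 * ρ ≡ + 0 * (+ 2 * ρ)
    lemma = solve-∀
  go (inj₂ p) = divides (- (+ 3)) (trans base (trans (cong (λ k → + 3 * k - + 3 * ρ) p) (lemma ρ)))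
    where
    lemma : ∀ ρ → + 3 * - ρ - + 3 * ρ ≡ - (+ 3) * (+ 2 * ρ)
    lemma = solve-∀

-- The three divisibilities are what remains when the first, second or third new entry is ± ρ. The
-- entry w is not moved and has to avoid ρ from the outset.
turn : ∀ ρ {n} y z w → Avoids ρ w → + 3 ∣ ρ + y + z → n ≡ sumOf4 ρ y z w →
  Good ρ n ⊎ ρ ∣ y + z ⊎ + 2 * ρ ∣ y - + 2 * z - ρ ⊎ + 2 * ρ ∣ z - + 2 * y - ρ
turn ρ {n} y z w w-ok (divides t s≡3t) n≡ =
  by-cases (avoids? ρ (ρ - + 2 * t)) (avoids? ρ (y - + 2 * t)) (avoids? ρ (z - + 2 * t))
  where
  halve-ρ∣ : + 2 * ρ ∣ ρ - + 2 * (y + z) - + 3 * ρ → ρ ∣ y + z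
  halve-ρ∣ (divides q eq) = divides (- (q + + 1)) (*2-cancel
    (trans (lemma₁ ρ (y + z)) (trans (cong (λ k → - k - + 2 * ρ) eq) (lemma₂ q ρ))))
    where
    lemma₁ : ∀ ρ s → + 2 * s ≡ - (ρ - + 2 * s - + 3 * ρ) - + 2 * ρ
    lemma₁ = solve-∀
    lemma₂ : ∀ q ρ → - (q * (+ 2 * ρ)) - + 2 * ρ ≡ + 2 * (- (q + + 1) * ρ)
    lemma₂ = solve-∀
  y-first : ∀ ρ y z → ρ + y + z ≡ y + ρ + z
  y-first = solve-∀
  z-first : ∀ ρ y z → ρ + y + z ≡ z + ρ + y
  z-first = solve-∀
  shift : ∀ ρ y z → y - + 2 * z - ρ ≡ + 1 * (y - + 2 * (ρ + z) - + 3 * ρ) + + 2 * (+ 2 * ρ)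
  shift = solve-∀
  by-cases : ρ - + 2 * t ≡± ρ ⊎ Avoids ρ (ρ - + 2 * t) → y - + 2 * t ≡± ρ ⊎ Avoids ρ (y - + 2 * t) →
    z - + 2 * t ≡± ρ ⊎ Avoids ρ (z - + 2 * t) →
    Good ρ n ⊎ ρ ∣ y + z ⊎ + 2 * ρ ∣ y - + 2 * z - ρ ⊎ + 2 * ρ ∣ z - + 2 * y - ρ
  by-cases (inj₂ a) (inj₂ b) (inj₂ c) =
    inj₁ (_ , _ , _ , _ , (a , b , c , w-ok) , trans n≡ (sumOf4-turn ρ y z w t s≡3t))
  by-cases (inj₁ a) _ _ = inj₂ (inj₁ (halve-ρ∣ (turned-≡± {ρ} {ρ} {y} {z} {t} s≡3t a)))
  by-cases _ (inj₁ b) _ = inj₂ (inj₂ (inj₁ (∣-comb₂ (+ 1) (+ 2)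
    (turned-≡± {ρ} {y} {ρ} {z} {t} (trans (sym (y-first ρ y z)) s≡3t) b) ∣-refl (shift ρ y z))))
  by-cases _ _ (inj₁ c) = inj₂ (inj₂ (inj₂ (∣-comb₂ (+ 1) (+ 2)
    (turned-≡± {ρ} {z} {ρ} {y} {t} (trans (sym (z-first ρ y z)) s≡3t) c) ∣-refl (shift ρ z y))))

-- ρ divisible by 4

module Reflections {ρ : ℤ} (4∣ρ : + 4 ∣ ρ) (3∤ρ : ¬ + 3 ∣ ρ) where

  2∣ρ : + 2 ∣ ρ
  2∣ρ = ∣-trans (divides (+ 2) refl) 4∣ρ

  ρ∤2*odd : ∀ {x} → Odd x → ¬ ρ ∣ + 2 * x
  ρ∤2*odd {x} o d = double-odd {x} o (∣-trans 4∣ρ d)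

  2ρ∤4*odd : ∀ {x} → Odd x → ¬ + 2 * ρ ∣ + 2 * (+ 2 * x)
  2ρ∤4*odd {x} o d = double-odd {x} o (*-cancelˡ-∣ (+ 2) (∣-trans (*-monoʳ-∣ (+ 2) 4∣ρ) d))

  4∤⇒avoids : ∀ {x} → ¬ + 4 ∣ x → Avoids ρ x
  4∤⇒avoids {x} 4∤x x≡±ρ = 4∤x (±-∣ {+ 4} {x} {ρ} 4∣ρ x≡±ρ)

  odd⇒avoids : ∀ {x} → Odd x → Avoids ρ x
  odd⇒avoids {x} o = 4∤⇒avoids {x} (λ d → odd⇒¬even o (∣-trans (divides (+ 2) refl) d))

  sign-mod-3 : ∀ x → + 3 ∣ x ⊎ ∃ λ x′ → x ≡± x′ × + 3 ∣ ρ + x′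
  sign-mod-3 x = by-residues (residue₃ ρ) (residue₃ x)
    where
    lemma₁ : ∀ ρ x → ρ + - x ≡ + 1 * (ρ - + 1) + - (+ 1) * (x - + 1)
    lemma₁ = solve-∀
    lemma₂ : ∀ ρ x → ρ + x ≡ + 1 * (ρ - + 1) + + 1 * (x + + 1)
    lemma₂ = solve-∀
    lemma₃ : ∀ ρ x → ρ + x ≡ + 1 * (ρ + + 1) + + 1 * (x - + 1)
    lemma₃ = solve-∀
    lemma₄ : ∀ ρ x → ρ + - x ≡ + 1 * (ρ + + 1) + - (+ 1) * (x + + 1)
    lemma₄ = solve-∀
    double-neg : x ≡± - x
    double-neg = inj₂ (sym (ℤ.neg-involutive x))
    by-residues : + 3 ∣ ρ ⊎ + 3 ∣ ρ - + 1 ⊎ + 3 ∣ ρ + + 1 → + 3 ∣ x ⊎ + 3 ∣ x - + 1 ⊎ + 3 ∣ x + + 1 →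
      + 3 ∣ x ⊎ ∃ λ x′ → x ≡± x′ × + 3 ∣ ρ + x′
    by-residues (inj₁ d) _ = ⊥-elim (3∤ρ d)
    by-residues _ (inj₁ d) = inj₁ d
    by-residues (inj₂ (inj₁ r)) (inj₂ (inj₁ s)) = inj₂
      (- x , double-neg , ∣-comb₂ (+ 1) (- (+ 1)) r s (lemma₁ ρ x))
    by-residues (inj₂ (inj₁ r)) (inj₂ (inj₂ s)) = inj₂ (x , inj₁ refl , ∣-comb₂ (+ 1) (+ 1) r s (lemma₂ ρ x))
    by-residues (inj₂ (inj₂ r)) (inj₂ (inj₁ s)) = inj₂ (x , inj₁ refl , ∣-comb₂ (+ 1) (+ 1) r s (lemma₃ ρ x))
    by-residues (inj₂ (inj₂ r)) (inj₂ (inj₂ s)) = inj₂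
      (- x , double-neg , ∣-comb₂ (+ 1) (- (+ 1)) r s (lemma₄ ρ x))

  -- Both y - 2z - ρ and z - 2y - ρ are odd while 2ρ is even, so two of the three failures are
  -- impossible.
  turn-odd : ∀ {n} y z w → Odd y → Odd z → Avoids ρ w → + 3 ∣ ρ + y + z → n ≡ sumOf4 ρ y z w →
    Good ρ n ⊎ ρ ∣ y + z
  turn-odd {n} y z w y-odd z-odd w-ok 3∣ n≡ = go (turn ρ y z w w-ok 3∣ n≡)
    where
    lemma : ∀ y z ρ → y ≡ + 1 * (y - + 2 * z - ρ) + + 1 * ρ + z * + 2
    lemma = solve-∀
    impossible : ∀ y z → Odd y → ¬ + 2 * ρ ∣ y - + 2 * z - ρ
    impossible y z y-odd d = odd⇒¬even y-odd (∣-comb₃ (+ 1) (+ 1) z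
      (∣-trans (divides ρ (ℤ.*-comm (+ 2) ρ)) d) 2∣ρ (∣-refl {+ 2}) (lemma y z ρ))
    go : Good ρ n ⊎ ρ ∣ y + z ⊎ + 2 * ρ ∣ y - + 2 * z - ρ ⊎ + 2 * ρ ∣ z - + 2 * y - ρ → Good ρ n ⊎ ρ ∣ y + z
    go (inj₁ good) = inj₁ good
    go (inj₂ (inj₁ d)) = inj₂ d
    go (inj₂ (inj₂ (inj₁ d))) = ⊥-elim (impossible y z y-odd d)
    go (inj₂ (inj₂ (inj₂ d))) = ⊥-elim (impossible z y z-odd d)

  -- Since y + z and y - 2z - ρ are odd, only the even entry z can fail.
  turn-mixed : ∀ {n} y z w → Odd y → Even z → Avoids ρ w → + 3 ∣ ρ + y + z → n ≡ sumOf4 ρ y z w →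
    Good ρ n ⊎ + 2 * ρ ∣ z - + 2 * y - ρ
  turn-mixed {n} y z w y-odd z-even w-ok 3∣ n≡ = go (turn ρ y z w w-ok 3∣ n≡)
    where
    lemma : ∀ y z ρ → y ≡ + 1 * (y - + 2 * z - ρ) + + 1 * ρ + z * + 2
    lemma = solve-∀
    lemma′ : ∀ y z → y ≡ + 1 * (y + z) + - (+ 1) * z
    lemma′ = solve-∀
    go : Good ρ n ⊎ ρ ∣ y + z ⊎ + 2 * ρ ∣ y - + 2 * z - ρ ⊎ + 2 * ρ ∣ z - + 2 * y - ρ →
      Good ρ n ⊎ + 2 * ρ ∣ z - + 2 * y - ρ
    go (inj₁ good) = inj₁ good
    go (inj₂ (inj₁ d)) = ⊥-elim (odd⇒¬even y-odd (∣-comb₂ (+ 1) (- (+ 1)) (∣-trans 2∣ρ d) z-even (lemma′ y z)))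
    go (inj₂ (inj₂ (inj₁ d))) = ⊥-elim (odd⇒¬even y-odd
      (∣-comb₃ (+ 1) (+ 1) z (∣-trans (divides ρ (ℤ.*-comm (+ 2) ρ)) d) 2∣ρ (∣-refl {+ 2}) (lemma y z ρ)))
    go (inj₂ (inj₂ (inj₂ d))) = inj₂ d

  resolve₂ : ∀ {n} {A B : Set} → Good ρ n ⊎ A → Good ρ n ⊎ B → ¬ (A × B) → Good ρ n
  resolve₂ (inj₁ good) _ _ = good
  resolve₂ (inj₂ _) (inj₁ good) _ = good
  resolve₂ (inj₂ a) (inj₂ b) ¬ab = ⊥-elim (¬ab (a , b))

  flip₂ : ∀ {y} x z w → sumOf4 x y z w ≡ sumOf4 x (- y) z w
  flip₂ {y} x z w = cong (λ k → x * x + k + z * z + w * w) (sym (±-square {x = - y} (inj₂ refl)))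

  flip₃ : ∀ {z} x y w → sumOf4 x y z w ≡ sumOf4 x y (- z) w
  flip₃ {z} x y w = cong (λ k → x * x + y * y + k + w * w) (sym (±-square {x = - z} (inj₂ refl)))

  odd-neg : ∀ {x} → Odd x → Odd (- x)
  odd-neg {x} o = ±-odd {x = - x} o (inj₂ refl)

  -- As 3 ∣ y, both signs of y are admissible. Two failures subtract to ρ ∣ 2y if z is odd and to 2ρ
  -- ∣ 4y if z is even, impossible with y odd and 4 ∣ ρ.
  single-A : ∀ {n} y z w → Odd y → + 3 ∣ y → + 3 ∣ ρ + z → Avoids ρ w → n ≡ sumOf4 ρ y z w → Good ρ n
  single-A {n} y z w y-odd 3∣y 3∣ρ+z w-ok n≡ = by-parity (parity z)
    where
    lemma₁ : ∀ ρ y z → ρ + y + z ≡ + 1 * y + + 1 * (ρ + z)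
    lemma₁ = solve-∀
    lemma₂ : ∀ ρ y z → ρ + - y + z ≡ - (+ 1) * y + + 1 * (ρ + z)
    lemma₂ = solve-∀
    3∣₁ : + 3 ∣ ρ + y + z
    3∣₁ = ∣-comb₂ (+ 1) (+ 1) 3∣y 3∣ρ+z (lemma₁ ρ y z)
    3∣₂ : + 3 ∣ ρ + - y + z
    3∣₂ = ∣-comb₂ (- (+ 1)) (+ 1) 3∣y 3∣ρ+z (lemma₂ ρ y z)
    n≡₂ : n ≡ sumOf4 ρ (- y) z w
    n≡₂ = trans n≡ (flip₂ {y} ρ z w)
    clash₁ : ∀ y z → + 2 * y ≡ + 1 * (y + z) + - (+ 1) * (- y + z)
    clash₁ = solve-∀
    clash₂ : ∀ ρ y z → + 2 * (+ 2 * y) ≡ - (+ 1) * (z - + 2 * y - ρ) + + 1 * (z - + 2 * - y - ρ)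
    clash₂ = solve-∀
    by-parity : Even z ⊎ Odd z → Good ρ n
    by-parity (inj₂ z-odd) = resolve₂
      (turn-odd y z w y-odd z-odd w-ok 3∣₁ n≡) (turn-odd (- y) z w (odd-neg {y} y-odd) z-odd w-ok 3∣₂ n≡₂)
      (λ (p , q) → ρ∤2*odd {y} y-odd (∣-comb₂ (+ 1) (- (+ 1)) p q (clash₁ y z)))
    by-parity (inj₁ z-even) = resolve₂
      (turn-mixed y z w y-odd z-even w-ok 3∣₁ n≡) (turn-mixed (- y) z w (odd-neg {y} y-odd) z-even w-ok 3∣₂ n≡₂)
      (λ (p , q) → 2ρ∤4*odd {y} y-odd (∣-comb₂ (- (+ 1)) (+ 1) p q (clash₂ ρ y z)))

  -- Here the sign of z is free. Two failures give 2ρ ∣ 2z, hence ρ ∣ z, and then ρ ∣ 2y. An odd z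
  -- divisible by 3 is left to `single-A` with y and z exchanged.
  single-B : ∀ {n} y z w → Odd y → + 3 ∣ ρ + y → Even z → + 3 ∣ z → Avoids ρ w → n ≡ sumOf4 ρ y z w → Good ρ n
  single-B {n} y z w y-odd 3∣ρ+y z-even 3∣z w-ok n≡ = resolve₂
    (turn-mixed y z w y-odd z-even w-ok (∣-comb₂ (+ 1) (+ 1) 3∣ρ+y 3∣z (lemma₁ ρ y z)) n≡)
    (turn-mixed y (- z) w y-odd (∣m⇒∣-m {m = z} z-even) w-ok (∣-comb₂ (+ 1) (- (+ 1)) 3∣ρ+y 3∣z (lemma₂ ρ y z))
      (trans n≡ (flip₃ {z} ρ y w)))
    clash
    where
    lemma₁ : ∀ ρ y z → ρ + y + z ≡ + 1 * (ρ + y) + + 1 * z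
    lemma₁ = solve-∀
    lemma₂ : ∀ ρ y z → ρ + y + - z ≡ + 1 * (ρ + y) + - (+ 1) * z
    lemma₂ = solve-∀
    difference : ∀ ρ y z → + 2 * z ≡ + 1 * (z - + 2 * y - ρ) + - (+ 1) * (- z - + 2 * y - ρ)
    difference = solve-∀
    recover : ∀ ρ y z → + 2 * y ≡ + 1 * z + - (+ 1) * ρ + - (+ 1) * (z - + 2 * y - ρ)
    recover = solve-∀
    clash : ¬ (+ 2 * ρ ∣ z - + 2 * y - ρ × + 2 * ρ ∣ - z - + 2 * y - ρ)
    clash (p , q) = ρ∤2*odd {y} y-odd (∣-comb₃ (+ 1) (- (+ 1)) (- (+ 1)) ρ∣z ∣-refl
        (∣-trans (divides (+ 2) refl) p) (recover ρ y z))
      where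
      2ρ∣2z : + 2 * ρ ∣ + 2 * z
      2ρ∣2z = ∣-comb₂ (+ 1) (- (+ 1)) p q (difference ρ y z)
      ρ∣z : ρ ∣ z
      ρ∣z = *-cancelˡ-∣ (+ 2) {ρ} {z} 2ρ∣2z

  resolve₃ : ∀ {n} {A B C : Set} → Good ρ n ⊎ A → Good ρ n ⊎ B → Good ρ n ⊎ C → ¬ (A × B × C) → Good ρ n
  resolve₃ (inj₁ good) _ _ _ = good
  resolve₃ (inj₂ a) q r ¬abc = resolve₂ q r (λ (b , c) → ¬abc (a , b , c))

  3∣ρ+y+z : ∀ y z → + 3 ∣ y - ρ → + 3 ∣ z - ρ → + 3 ∣ ρ + y + z
  3∣ρ+y+z y z p q = ∣-comb₃ (+ 1) (+ 1) ρ p q (∣-refl {+ 3}) (lemma ρ y z)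
    where
    lemma : ∀ ρ y z → ρ + y + z ≡ + 1 * (y - ρ) + + 1 * (z - ρ) + ρ * + 3
    lemma = solve-∀

  ρ∤4*odd : ∀ {x} → + 8 ∣ ρ → Odd x → ¬ ρ ∣ + 4 * x
  ρ∤4*odd {x} 8∣ρ o d = odd⇒¬even o (*-cancelˡ-∣ (+ 4) {+ 2} {x} (∣-trans 8∣ρ d))

  -- With y ≡ z ≡ w ≡ ρ modulo 3 every pair can be turned together with ρ, which gives three
  -- attempts but no free sign. Three failures combine to ρ ∣ 2y, except that for even z and w the
  -- failure ρ ∣ z + w yields only ρ ∣ 4y; 8 ∣ ρ is asked for in that case.
  single-C : ∀ {n} y z w → Odd y → + 3 ∣ y - ρ → + 3 ∣ z - ρ → + 3 ∣ w - ρ → Avoids ρ z → Avoids ρ w →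
    (Even z → Even w → + 8 ∣ ρ) → n ≡ sumOf4 ρ y z w → Good ρ n
  single-C {n} y z w y-odd p q r z-ok w-ok 8∣ρ n≡ = by-parities (parity z) (parity w)
    where
    y-ok : Avoids ρ y
    y-ok = odd⇒avoids {y} y-odd
    n≡yw : n ≡ sumOf4 ρ y w z
    n≡yw = trans n≡ (sumOf4-swap₃₄ ρ y z w)
    n≡zw : n ≡ sumOf4 ρ z w y
    n≡zw = trans n≡ (trans (sumOf4-swap₂₃ ρ y z w) (sumOf4-swap₃₄ ρ z y w))
    3∣yz = 3∣ρ+y+z y z p q
    3∣yw = 3∣ρ+y+z y w p r
    3∣zw = 3∣ρ+y+z z w q r

    odds : ∀ y z w → + 2 * y ≡ + 1 * (y + z) + + 1 * (y + w) + - (+ 1) * (z + w)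
    odds = solve-∀
    ρ∣ : ∀ {x} → + 2 * ρ ∣ x → ρ ∣ x
    ρ∣ d = ∣-trans (divides (+ 2) refl) d

    mixed : ∀ y z w → Odd y → ρ ∣ y + z → + 2 * ρ ∣ w - + 2 * y - ρ → + 2 * ρ ∣ w - + 2 * z - ρ → ⊥
    mixed y z w y-odd a b c = ρ∤2*odd {y} y-odd (∣-comb₂ (+ 1) (+ 1) a
      (*-cancelˡ-∣ (+ 2) {ρ} {y - z} (∣-comb₂ (- (+ 1)) (+ 1) b c (lemma₁ ρ y z w))) (lemma₂ y z))
      where
      lemma₁ : ∀ ρ y z w → + 2 * (y - z) ≡ - (+ 1) * (w - + 2 * y - ρ) + + 1 * (w - + 2 * z - ρ)
      lemma₁ = solve-∀
      lemma₂ : ∀ y z → + 2 * y ≡ + 1 * (y + z) + + 1 * (y - z)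
      lemma₂ = solve-∀

    evens : + 8 ∣ ρ → + 2 * ρ ∣ z - + 2 * y - ρ → + 2 * ρ ∣ w - + 2 * y - ρ →
      ρ ∣ z + w ⊎ + 2 * ρ ∣ z - + 2 * w - ρ ⊎ + 2 * ρ ∣ w - + 2 * z - ρ → ⊥
    evens 8∣ρ a b (inj₁ c) = ρ∤4*odd {y} 8∣ρ y-odd (∣-comb₂ (+ 1) (+ 1)
        (∣-comb₃ (- (+ 1)) (- (+ 1)) (+ 1) (ρ∣ a) (ρ∣ b) c refl) (∣m⇒∣m*n (- (+ 2)) (∣-refl {ρ}))
          (lemma ρ y z w))
      where
      lemma : ∀ ρ y z w → + 4 * y ≡
        + 1 * (- (+ 1) * (z - + 2 * y - ρ) + - (+ 1) * (w - + 2 * y - ρ) + + 1 * (z + w)) + + 1 * (ρ * - (+ 2))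
      lemma = solve-∀
    evens _ a b (inj₂ (inj₁ c)) = ρ∤2*odd {y} y-odd (∣-comb₂ (+ 1) (+ 1)
        (∣-comb₃ (+ 1) (- (+ 2)) (- (+ 1)) (ρ∣ a) (ρ∣ b) (ρ∣ c) refl) (∣m⇒∣m*n (- (+ 2)) (∣-refl {ρ}))
          (lemma ρ y z w))
      where
      lemma : ∀ ρ y z w → + 2 * y ≡
        + 1 * (+ 1 * (z - + 2 * y - ρ) + - (+ 2) * (w - + 2 * y - ρ) + - (+ 1) * (z - + 2 * w - ρ)) + + 1 *
          (ρ * - (+ 2))
      lemma = solve-∀
    evens _ a b (inj₂ (inj₂ c)) = ρ∤2*odd {y} y-odd (∣-comb₂ (+ 1) (+ 1)
        (∣-comb₃ (+ 1) (- (+ 2)) (- (+ 1)) (ρ∣ b) (ρ∣ a) (ρ∣ c) refl) (∣m⇒∣m*n (- (+ 2)) (∣-refl {ρ}))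
          (lemma ρ y z w))
      where
      lemma : ∀ ρ y z w → + 2 * y ≡
        + 1 * (+ 1 * (w - + 2 * y - ρ) + - (+ 2) * (z - + 2 * y - ρ) + - (+ 1) * (w - + 2 * z - ρ)) + + 1 *
          (ρ * - (+ 2))
      lemma = solve-∀

    by-parities : Even z ⊎ Odd z → Even w ⊎ Odd w → Good ρ n
    by-parities (inj₂ z-odd) (inj₂ w-odd) = resolve₃
      (turn-odd y z w y-odd z-odd w-ok 3∣yz n≡) (turn-odd y w z y-odd w-odd z-ok 3∣yw n≡yw)
      (turn-odd z w y z-odd w-odd y-ok 3∣zw n≡zw)
      (λ (a , b , c) → ρ∤2*odd {y} y-odd (∣-comb₃ (+ 1) (+ 1) (- (+ 1)) a b c (odds y z w)))
    by-parities (inj₂ z-odd) (inj₁ w-even) = resolve₃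
      (turn-odd y z w y-odd z-odd w-ok 3∣yz n≡) (turn-mixed y w z y-odd w-even z-ok 3∣yw n≡yw)
      (turn-mixed z w y z-odd w-even y-ok 3∣zw n≡zw)
      (λ (a , b , c) → mixed y z w y-odd a b c)
    by-parities (inj₁ z-even) (inj₂ w-odd) = resolve₃
      (turn-odd y w z y-odd w-odd z-ok 3∣yw n≡yw) (turn-mixed y z w y-odd z-even w-ok 3∣yz n≡)
      (turn-mixed w z y w-odd z-even y-ok (3∣ρ+y+z w z r q)
        (trans n≡ (trans (sumOf4-swap₃₄ ρ y z w) (trans (sumOf4-swap₂₃ ρ y w z) (sumOf4-swap₃₄ ρ w y z)))))
      (λ (a , b , c) → mixed y w z y-odd a b c)
    by-parities (inj₁ z-even) (inj₁ w-even) = resolve₃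
      (turn-mixed y z w y-odd z-even w-ok 3∣yz n≡) (turn-mixed y w z y-odd w-even z-ok 3∣yw n≡yw)
      (turn ρ z w y y-ok 3∣zw n≡zw)
      (λ (a , b , c) → evens (8∣ρ z-even w-even) a b c)

  neg-rep : ∀ {x x′} → x ≡± x′ → + 3 ∣ ρ + x′ → ∃ λ x″ → x ≡± x″ × + 3 ∣ x″ - ρ
  neg-rep {x} {x′} p d = - x′ , ±-trans p , ∣-comb₁ (- (+ 1)) d (lemma ρ x′)
    where
    lemma : ∀ ρ x → - x - ρ ≡ - (+ 1) * (ρ + x)
    lemma = solve-∀
    ±-trans : x ≡± x′ → x ≡± - x′
    ±-trans (inj₁ refl) = inj₂ (sym (ℤ.neg-involutive x))
    ±-trans (inj₂ refl) = inj₁ refl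

  ±-avoids : ∀ {x x′} → x ≡± x′ → Avoids ρ x → Avoids ρ x′
  ±-avoids (inj₁ refl) ok = ok
  ±-avoids {x′ = x′} (inj₂ refl) ok p = ok (±-neg {x′} {ρ} p)

  -- This is the case of a single entry ρ: z and w avoid it, and so does y, being odd. Whichever
  -- entry a turn leaves alone is therefore harmless.
  single : ∀ {n} y z w → Odd y → ¬ All3∣ y z w → Avoids ρ z → Avoids ρ w →
    (Even z → Even w → + 8 ∣ ρ) → n ≡ sumOf4 ρ y z w → Good ρ n
  single {n} y z w y-odd ¬3∣ z-ok w-ok 8∣ρ n≡ = by-signs (sign-mod-3 y) (sign-mod-3 z) (sign-mod-3 w)
    where
    Signed : ℤ → Set
    Signed x = + 3 ∣ x ⊎ ∃ λ x′ → x ≡± x′ × + 3 ∣ ρ + x′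
    n≡yw : n ≡ sumOf4 ρ y w z
    n≡yw = trans n≡ (sumOf4-swap₃₄ ρ y z w)
    y-ok : Avoids ρ y
    y-ok = odd⇒avoids {y} y-odd

    one-divisible : ∀ y z w → Odd y → Avoids ρ w → ∀ {y′} → y ≡± y′ → + 3 ∣ ρ + y′ → + 3 ∣ z →
      n ≡ sumOf4 ρ y z w → Even z ⊎ Odd z → Good ρ n
    one-divisible y z w y-odd w-ok {y′} p d 3∣z n≡ (inj₁ z-even) =
      single-B y′ z w (±-odd y-odd (±-sym p)) d z-even 3∣z w-ok
        (trans n≡ (sumOf4-± (±-refl ρ) p (±-refl z) (±-refl w)))
    one-divisible y z w y-odd w-ok {y′} p d 3∣z n≡ (inj₂ z-odd) =
      single-A z y′ w z-odd 3∣z d w-ok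
        (trans n≡ (trans (sumOf4-± (±-refl ρ) p (±-refl z) (±-refl w)) (sumOf4-swap₂₃ ρ y′ z w)))

    by-signs : Signed y → Signed z → Signed w → Good ρ n
    by-signs (inj₁ a) (inj₁ b) (inj₁ c) = ⊥-elim (¬3∣ (a , b , c))
    by-signs (inj₁ a) (inj₂ (z′ , p , d)) _ =
      single-A y z′ w y-odd a d w-ok (trans n≡ (sumOf4-± (±-refl ρ) (±-refl y) p (±-refl w)))
    by-signs (inj₁ a) (inj₁ b) (inj₂ (w′ , p , d)) =
      single-A y w′ z y-odd a d z-ok (trans n≡yw (sumOf4-± (±-refl ρ) (±-refl y) p (±-refl z)))
    by-signs (inj₂ (y′ , p , d)) (inj₁ b) _ = one-divisible y z w y-odd w-ok p d b n≡ (parity z)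
    by-signs (inj₂ (y′ , p , d)) (inj₂ _) (inj₁ c) = one-divisible y w z y-odd z-ok p d c n≡yw (parity w)
    by-signs (inj₂ (_ , p , d)) (inj₂ (_ , q , e)) (inj₂ (_ , r , f))
      with y′ , p′ , d′ ← neg-rep p d | z′ , q′ , e′ ← neg-rep q e | w′ , r′ , f′ ← neg-rep r f =
      single-C y′ z′ w′ (±-odd y-odd (±-sym p′)) d′ e′ f′ (±-avoids q′ z-ok) (±-avoids r′ w-ok)
        (λ e₁ e₂ → 8∣ρ (±-∣ e₁ q′) (±-∣ e₂ r′)) (trans n≡ (sumOf4-± (±-refl ρ) p′ q′ r′))

  -- Several entries equal to ρ

  4∤even−2*odd : ∀ {x t} → + 4 ∣ x → Odd t → ¬ + 4 ∣ x - + 2 * t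
  4∤even−2*odd {x} {t} 4∣x t-odd d = double-odd {t} t-odd (∣-comb₂ (+ 1) (- (+ 1)) 4∣x d (lemma x t))
    where
    lemma : ∀ x t → + 2 * t ≡ + 1 * x + - (+ 1) * (x - + 2 * t)
    lemma = solve-∀

  odd−2* : ∀ {x} t → Odd x → Odd (x - + 2 * t)
  odd−2* {x} t x-odd = ∣-comb₂ (+ 1) (- t) x-odd (∣-refl {+ 2}) (lemma x t)
    where
    lemma : ∀ x t → x - + 2 * t + + 1 ≡ + 1 * (x + + 1) + - t * + 2
    lemma = solve-∀

  turn-odd-third : ∀ {x y t} → + 4 ∣ x → Odd y → ρ + x + y ≡ t * + 3 → Odd t
  turn-odd-third {x} {y} {t} 4∣x y-odd eq = ∣-comb₂ (+ 1) (- t)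
    (∣-comb₃ (+ 1) (+ 1) (+ 1) 2∣ρ (∣-trans (divides (+ 2) refl) 4∣x) y-odd refl) (∣-refl {+ 2})
    (trans (lemma₁ t) (trans (cong (λ s → s + + 1 + - t * + 2) (sym eq)) (lemma₂ ρ x y t)))
    where
    lemma₁ : ∀ t → t + + 1 ≡ t * + 3 + + 1 + - t * + 2
    lemma₁ = solve-∀
    lemma₂ : ∀ ρ x y t → ρ + x + y + + 1 + - t * + 2 ≡ + 1 * (+ 1 * ρ + + 1 * x + + 1 * (y + + 1)) + - t * + 2
    lemma₂ = solve-∀

  -- One turn of both entries ρ with y removes them together: the sum 3t is odd, so t is odd, and ρ
  -- - 2t ≡ 2 modulo 4 differs from ± ρ. The triple is (ρ, -ρ, y) if 3 ∣ y, and otherwise (ρ, ρ, ±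
  -- y) with ± y ≡ ρ modulo 3.
  double : ∀ {n} y w → Odd y → Avoids ρ w → n ≡ sumOf4 ρ ρ y w → Good ρ n
  double {n} y w y-odd w-ok n≡ = by-sign (sign-mod-3 y)
    where
    turn-pair : ∀ x y′ → + 4 ∣ x → Odd y′ → + 3 ∣ ρ + x + y′ → n ≡ sumOf4 ρ x y′ w → Good ρ n
    turn-pair x y′ 4∣x y′-odd (divides t eq) n≡ = _ , _ , _ , _ ,
      ( 4∤⇒avoids {ρ - + 2 * t} (4∤even−2*odd 4∣ρ t-odd) , 4∤⇒avoids {x - + 2 * t} (4∤even−2*odd 4∣x t-odd)
      , odd⇒avoids {y′ - + 2 * t} (odd−2* {y′} t y′-odd) , w-ok) , trans n≡ (sumOf4-turn ρ x y′ w t eq)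
      where
      t-odd : Odd t
      t-odd = turn-odd-third {x} {y′} {t} 4∣x y′-odd eq
    cancel : ∀ ρ y → y ≡ ρ + - ρ + y
    cancel = solve-∀
    by-sign : + 3 ∣ y ⊎ ∃ (λ y′ → y ≡± y′ × + 3 ∣ ρ + y′) → Good ρ n
    by-sign (inj₁ 3∣y) = turn-pair (- ρ) y (∣m⇒∣-m {m = ρ} 4∣ρ) y-odd (subst (+ 3 ∣_) (cancel ρ y) 3∣y)
      (trans n≡ (flip₂ {ρ} ρ y w))
    by-sign (inj₂ (_ , p , d)) with y′ , p′ , d′ ← neg-rep p d =
      turn-pair ρ y′ 4∣ρ (±-odd y-odd (±-sym p′)) (3∣ρ+y+z ρ y′ (divides (+ 0) (ℤ.+-inverseʳ ρ)) d′)
        (trans n≡ (sumOf4-± (±-refl ρ) (±-refl ρ) p′ (±-refl w)))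

  -- A turn replaces two of the three entries ρ and leaves one to `single`. For this the new triple
  -- must not be divisible by 3 and its even entries must avoid ρ.
  triple : ∀ {n} y → Odd y → + 8 ∣ ρ → n ≡ sumOf4 ρ ρ ρ y → Good ρ n
  triple {n} y y-odd 8∣ρ n≡ = by-sign (sign-mod-3 y)
    where
    finish : ∀ y z w → Odd y → ¬ All3∣ y z w → Avoids ρ z → Avoids ρ w → n ≡ sumOf4 ρ y z w → Good ρ n
    finish y z w y-odd ¬3∣ z-ok w-ok n≡ = single y z w y-odd ¬3∣ z-ok w-ok (λ _ _ → 8∣ρ) n≡
    n≡ρρyρ : n ≡ sumOf4 ρ ρ y ρ
    n≡ρρyρ = trans n≡ (sumOf4-swap₃₄ ρ ρ ρ y)
    rotate : ∀ x y z w → sumOf4 x y z w ≡ sumOf4 w z x y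
    rotate = λ x y z w → lemma (x * x) (y * y) (z * z) (w * w)
      where
      lemma : ∀ x y z w → x + y + z + w ≡ w + z + x + y
      lemma = solve-∀

    ρ+k*4b-avoids : ∀ k b → Odd b → Avoids ρ (k * ρ + + 4 * b)
    ρ+k*4b-avoids k b b-odd p = ρ∤4*odd {b} 8∣ρ b-odd
      (∣-comb₂ (+ 1) (- k) (±-∣ {ρ} {_} {ρ} ∣-refl p) (∣-refl {ρ}) (lemma k ρ b))
      where
      lemma : ∀ k ρ b → + 4 * b ≡ + 1 * (k * ρ + + 4 * b) + - k * ρ
      lemma = solve-∀

    3ρ+8b-avoids : ∀ b → Odd b → Avoids ρ (+ 3 * ρ + + 8 * b)
    3ρ+8b-avoids b b-odd p = ρ∤4*odd {b} 8∣ρ b-odd (*-cancelˡ-∣ (+ 2) {ρ} {+ 4 * b}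
      (∣-comb₂ (+ 1) (- (+ 1)) (2ρ∣x-ρ p) (∣-refl {+ 2 * ρ}) (lemma ρ b)))
      where
      lemma : ∀ ρ b → + 2 * (+ 4 * b) ≡ + 1 * (+ 3 * ρ + + 8 * b - ρ) + - (+ 1) * (+ 2 * ρ)
      lemma = solve-∀
      lemma′ : ∀ ρ → - ρ - ρ ≡ - (+ 1) * (+ 2 * ρ)
      lemma′ = solve-∀
      2ρ∣x-ρ : ∀ {x} → x ≡± ρ → + 2 * ρ ∣ x - ρ
      2ρ∣x-ρ (inj₁ refl) = divides (+ 0) (ℤ.+-inverseʳ ρ)
      2ρ∣x-ρ (inj₂ refl) = divides (- (+ 1)) (lemma′ ρ)

    -- The triple is 3 (b, ρ + 2b, ρ + 2b). Its replacement is, up to signs, the tripled reflection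
    -- of (b, ρ + 2b, ρ + 2b) or, if 3 ∣ ρ + b, that of (b, ρ + 2b, -ρ - 2b). `normalise-triple`
    -- would hide the explicit entries, which are needed to see that they avoid ρ.
    deep : ∀ b → Odd b → n ≡ sumOf4 ρ (+ 3 * b) (+ 3 * (ρ + + 2 * b)) (+ 3 * (ρ + + 2 * b)) →
      Dec (+ 3 ∣ ρ + b) → Good ρ n
    deep b b-odd n≡ (no 3∤ρ+b) = finish (- (+ 4 * ρ) - + 7 * b) (+ 1 * ρ + + 4 * b) (+ 1 * ρ + + 4 * b)
      (∣-comb₂ (+ 1) (- (+ 2 * ρ) - + 4 * b) b-odd (∣-refl {+ 2}) (lemma₁ ρ b))
      (λ (_ , d , _) → 3∤ρ+b (∣-comb₂ (+ 1) (- b) d (∣-refl {+ 3}) (lemma₂ ρ b)))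
      (ρ+k*4b-avoids (+ 1) b b-odd) (ρ+k*4b-avoids (+ 1) b b-odd) (trans n≡ (identity ρ b))
      where
      lemma₁ : ∀ ρ b → - (+ 4 * ρ) - + 7 * b + + 1 ≡ + 1 * (b + + 1) + (- (+ 2 * ρ) - + 4 * b) * + 2
      lemma₁ = solve-∀
      lemma₂ : ∀ ρ b → ρ + b ≡ + 1 * (+ 1 * ρ + + 4 * b) + - b * + 3
      lemma₂ = solve-∀
      identity : ∀ ρ b → ρ * ρ + + 3 * b * (+ 3 * b) + + 3 * (ρ + + 2 * b) * (+ 3 * (ρ + + 2 * b))
          + + 3 * (ρ + + 2 * b) * (+ 3 * (ρ + + 2 * b))
        ≡ ρ * ρ + (- (+ 4 * ρ) - + 7 * b) * (- (+ 4 * ρ) - + 7 * b)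
          + (+ 1 * ρ + + 4 * b) * (+ 1 * ρ + + 4 * b) + (+ 1 * ρ + + 4 * b) * (+ 1 * ρ + + 4 * b)
      identity = solve-∀
    deep b b-odd n≡ (yes 3∣ρ+b) = finish b (+ 3 * ρ + + 4 * b) (+ 3 * ρ + + 8 * b) b-odd
      (λ (d , _) → 3∤ρ (∣-comb₂ (+ 1) (- (+ 1)) 3∣ρ+b d (lemma ρ b)))
      (ρ+k*4b-avoids (+ 3) b b-odd) (3ρ+8b-avoids b b-odd) (trans n≡ (identity ρ b))
      where
      lemma : ∀ ρ b → ρ ≡ + 1 * (ρ + b) + - (+ 1) * b
      lemma = solve-∀
      identity : ∀ ρ b → ρ * ρ + + 3 * b * (+ 3 * b) + + 3 * (ρ + + 2 * b) * (+ 3 * (ρ + + 2 * b))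
          + + 3 * (ρ + + 2 * b) * (+ 3 * (ρ + + 2 * b))
        ≡ ρ * ρ + b * b + (+ 3 * ρ + + 4 * b) * (+ 3 * ρ + + 4 * b) + (+ 3 * ρ + + 8 * b) * (+ 3 * ρ + + 8 * b)
      identity = solve-∀

    -- The new entries ρ - 2u and -ρ - 2u differ by 2ρ, so 3 cannot divide both.
    divisible : + 3 ∣ y → Good ρ n
    divisible (divides u y≡3u) = finish (y - + 2 * u) (ρ - + 2 * u) (- ρ - + 2 * u) (odd−2* {y} u y-odd)
      (λ (_ , d , e) → 3∤ρ (∣-comb₃ (- (+ 1)) (+ 1) ρ d e (∣-refl {+ 3}) (lemma ρ u)))
      (4∤⇒avoids {ρ - + 2 * u} (4∤even−2*odd 4∣ρ u-odd))
      (4∤⇒avoids { - ρ - + 2 * u} (4∤even−2*odd (∣m⇒∣-m {m = ρ} 4∣ρ) u-odd))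
      (trans n≡ρρyρ (trans (flip₂ {ρ} ρ y ρ) (trans (sumOf4-turn ρ (- ρ) y ρ u eq)
        (rotate (ρ - + 2 * u) (- ρ - + 2 * u) (y - + 2 * u) ρ))))
      where
      lemma : ∀ ρ u → ρ ≡ - (+ 1) * (ρ - + 2 * u) + + 1 * (- ρ - + 2 * u) + ρ * + 3
      lemma = solve-∀
      cancel : ∀ ρ y → ρ + - ρ + y ≡ y
      cancel = solve-∀
      eq : ρ + - ρ + y ≡ u * + 3
      eq = trans (cancel ρ y) y≡3u
      u-odd : Odd u
      u-odd = turn-odd-third { - ρ} {y} {u} (∣m⇒∣-m {m = ρ} 4∣ρ) y-odd eq

    nondivisible : ∀ y → Odd y → + 3 ∣ ρ + ρ + y → n ≡ sumOf4 ρ ρ y ρ → Good ρ n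
    nondivisible y y-odd (divides t eq) n≡ = by-division (+ 3 ∣? ρ - + 2 * t)
      where
      t-odd : Odd t
      t-odd = turn-odd-third {ρ} {y} {t} 4∣ρ y-odd eq
      ok : Avoids ρ (ρ - + 2 * t)
      ok = 4∤⇒avoids {ρ - + 2 * t} (4∤even−2*odd 4∣ρ t-odd)
      turned : n ≡ sumOf4 ρ (y - + 2 * t) (ρ - + 2 * t) (ρ - + 2 * t)
      turned = trans n≡ (trans (sumOf4-turn ρ ρ y ρ t eq) (rotate (ρ - + 2 * t) (ρ - + 2 * t) (y - + 2 * t) ρ))
      by-division : Dec (+ 3 ∣ ρ - + 2 * t) → Good ρ n
      by-division (no 3∤) = finish (y - + 2 * t) (ρ - + 2 * t) (ρ - + 2 * t) (odd−2* {y} t y-odd)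
        (λ (_ , d , _) → 3∤ d) ok ok turned
      by-division (yes (divides c ρ-2t≡3c)) = deep b b-odd
        (trans turned (sumOf4-± (±-refl ρ) (inj₁ y-2t≡3b) (inj₂ ρ-2t≡) (inj₂ ρ-2t≡))) (+ 3 ∣? ρ + b)
        where
        b : ℤ
        b = t + c - ρ
        lemma₁ : ∀ ρ y t → y - + 2 * t ≡ (ρ + ρ + y) - + 2 * ρ - + 2 * t
        lemma₁ = solve-∀
        lemma₂ : ∀ ρ t → t * + 3 - + 2 * ρ - + 2 * t ≡ + 3 * t + (ρ - + 2 * t) - + 3 * ρ
        lemma₂ = solve-∀
        lemma₃ : ∀ ρ t c → + 3 * t + c * + 3 - + 3 * ρ ≡ + 3 * (t + c - ρ)
        lemma₃ = solve-∀
        y-2t≡3b : y - + 2 * t ≡ + 3 * b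
        y-2t≡3b = trans (lemma₁ ρ y t) (trans (cong (λ k → k - + 2 * ρ - + 2 * t) eq)
          (trans (lemma₂ ρ t) (trans (cong (λ k → + 3 * t + k - + 3 * ρ) ρ-2t≡3c) (lemma₃ ρ t c))))
        lemma₄ : ∀ ρ t → ρ - + 2 * t ≡ + 3 * (ρ - + 2 * t) - + 2 * (ρ - + 2 * t)
        lemma₄ = solve-∀
        lemma₅ : ∀ ρ t c → + 3 * (ρ - + 2 * t) - + 2 * (c * + 3) ≡ - (+ 3 * (ρ + + 2 * (t + c - ρ)))
        lemma₅ = solve-∀
        ρ-2t≡ : ρ - + 2 * t ≡ - (+ 3 * (ρ + + 2 * b))
        ρ-2t≡ = trans (lemma₄ ρ t) (trans (cong (λ k → + 3 * (ρ - + 2 * t) - + 2 * k) ρ-2t≡3c) (lemma₅ ρ t c))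
        lemma₆ : ∀ b → b + + 1 ≡ + 1 * (+ 3 * b + + 1) + - b * + 2
        lemma₆ = solve-∀
        b-odd : Odd b
        b-odd = ∣-comb₂ (+ 1) (- b) (subst Odd y-2t≡3b (odd−2* {y} t y-odd)) (∣-refl {+ 2}) (lemma₆ b)

    by-sign : + 3 ∣ y ⊎ ∃ (λ y′ → y ≡± y′ × + 3 ∣ ρ + y′) → Good ρ n
    by-sign (inj₁ 3∣y) = divisible 3∣y
    by-sign (inj₂ (_ , p , d)) with y′ , p′ , d′ ← neg-rep p d =
      nondivisible y′ (±-odd y-odd (±-sym p′)) (3∣ρ+y+z ρ y′ (divides (+ 0) (ℤ.+-inverseʳ ρ)) d′)
        (trans n≡ρρyρ (sumOf4-± (±-refl ρ) (±-refl ρ) p′ (±-refl ρ)))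

  dispatch : ∀ {n} y z w → Odd y → ¬ All3∣ y z w → (Odd n → + 8 ∣ ρ) → n ≡ sumOf4 ρ y z w → Good ρ n
  dispatch {n} y z w y-odd ¬3∣ 8∣ρ n≡ = by-values (avoids? ρ z) (avoids? ρ w)
    where
    even² : ∀ {x} → Even x → Even (x * x)
    even² {x} e = ∣n⇒∣m*n x e
    -- The critical case of `single-C` thus has n odd, where the hypothesis supplies 8 ∣ ρ.
    odd-sum : Even z → Even w → Odd n
    odd-sum z-even w-even = subst Odd (sym n≡) (∣-comb₂ (+ 1) (+ 1)
      (∣-comb₃ (+ 1) (+ 1) (+ 1) (even² 2∣ρ) (even² z-even) (even² w-even) refl)
      (∣-comb₂ (y - + 1) (+ 1) y-odd (∣-refl {+ 2}) refl) (lemma ρ y z w))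
      where
      lemma : ∀ ρ y z w → ρ * ρ + y * y + z * z + w * w + + 1 ≡
        + 1 * (+ 1 * (ρ * ρ) + + 1 * (z * z) + + 1 * (w * w)) + + 1 * ((y - + 1) * (y + + 1) + + 1 * + 2)
      lemma = solve-∀
    by-values : z ≡± ρ ⊎ Avoids ρ z → w ≡± ρ ⊎ Avoids ρ w → Good ρ n
    by-values (inj₂ z-ok) (inj₂ w-ok) = single y z w y-odd ¬3∣ z-ok w-ok (λ a b → 8∣ρ (odd-sum a b)) n≡
    by-values (inj₁ p) (inj₂ w-ok) = double y w y-odd w-ok
      (trans n≡ (trans (sumOf4-± (±-refl ρ) (±-refl y) p (±-refl w)) (sumOf4-swap₂₃ ρ y ρ w)))
    by-values (inj₂ z-ok) (inj₁ q) = double y z y-odd z-ok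
      (trans n≡ (trans (sumOf4-± (±-refl ρ) (±-refl y) (±-refl z) q)
        (trans (sumOf4-swap₃₄ ρ y z ρ) (sumOf4-swap₂₃ ρ y ρ z))))
    by-values (inj₁ p) (inj₁ q) = triple y y-odd (8∣ρ (odd-sum (±-∣ 2∣ρ p) (±-∣ 2∣ρ q)))
      (trans n≡ (trans (sumOf4-± (±-refl ρ) (±-refl y) p q)
        (trans (sumOf4-swap₂₃ ρ y ρ ρ) (sumOf4-swap₃₄ ρ ρ y ρ))))

  odd-first : ∀ {n} y z w → ¬ + 4 ∣ n → n ≡ sumOf4 ρ y z w →
    ∃ λ y′ → ∃ λ z′ → ∃ λ w′ → Odd y′ × (¬ All3∣ y z w → ¬ All3∣ y′ z′ w′) × n ≡ sumOf4 ρ y′ z′ w′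
  odd-first {n} y z w 4∤n n≡ = go (parity y) (parity z) (parity w)
    where
    square : ∀ {x} → + 2 ∣ x → + 4 ∣ x * x
    square (divides q refl) = divides (q * q) (lemma q)
      where
      lemma : ∀ q → q * + 2 * (q * + 2) ≡ q * q * + 4
      lemma = solve-∀
    all-even : + 2 ∣ y → + 2 ∣ z → + 2 ∣ w → + 4 ∣ n
    all-even a b c = subst (+ 4 ∣_) (sym n≡)
      (∣m∣n⇒∣m+n (∣m∣n⇒∣m+n (∣m∣n⇒∣m+n (square 2∣ρ) (square a)) (square b)) (square c))
    go : Even y ⊎ Odd y → Even z ⊎ Odd z → Even w ⊎ Odd w →
      ∃ λ y′ → ∃ λ z′ → ∃ λ w′ → Odd y′ × (¬ All3∣ y z w → ¬ All3∣ y′ z′ w′) × n ≡ sumOf4 ρ y′ z′ w′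
    go (inj₂ o) _ _ = y , z , w , o , (λ ¬3∣ → ¬3∣) , n≡
    go _ (inj₂ o) _ = z , y , w , o , (λ ¬3∣ (a , b , c) → ¬3∣ (b , a , c)) , trans n≡ (sumOf4-swap₂₃ ρ y z w)
    go _ _ (inj₂ o) = w , y , z , o , (λ ¬3∣ (a , b , c) → ¬3∣ (b , c , a)) ,
      trans n≡ (trans (sumOf4-swap₃₄ ρ y z w) (sumOf4-swap₂₃ ρ y w z))
    go (inj₁ a) (inj₁ b) (inj₁ c) = ⊥-elim (4∤n (all-even a b c))

  -- `odd-first` is applied twice: once to make y odd, hence nonzero, for `normalise-triple`, and
  -- again because that lemma says nothing about parity.
  replace-ρ : ∀ {n} y z w → ¬ + 4 ∣ n → (Odd n → + 8 ∣ ρ) → n ≡ sumOf4 ρ y z w → Good ρ n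
  replace-ρ {n} y z w 4∤n 8∣ρ n≡
    with y₁ , z₁ , w₁ , y₁-odd , _ , n≡₁ ← odd-first y z w 4∤n n≡
    with y₂ , z₂ , w₂ , eq , ¬3∣ ← normalise-triple y₁ z₁ w₁ (<-wellFounded (abs y₁))
                                     (λ { refl → odd⇒¬even y₁-odd (divides (+ 0) refl) })
    with y₃ , z₃ , w₃ , y₃-odd , keep , n≡₃ ← odd-first y₂ z₂ w₂ 4∤n
      (trans n≡₁ (sumOf4-via3 ρ {y₁} {z₁} {w₁} {y₂} {z₂} {w₂} eq)) =
    dispatch y₃ z₃ w₃ y₃-odd (keep ¬3∣) 8∣ρ n≡₃

  fourSquares⇒good : ∀ {n} → FourSquares n → ¬ + 4 ∣ n → (Odd n → + 8 ∣ ρ) → Good ρ n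
  fourSquares⇒good {n} (x , y , z , w , n≡) 4∤n 8∣ρ =
    by-values (avoids? ρ x) (avoids? ρ y) (avoids? ρ z) (avoids? ρ w)
    where
    by-values : x ≡± ρ ⊎ Avoids ρ x → y ≡± ρ ⊎ Avoids ρ y → z ≡± ρ ⊎ Avoids ρ z → w ≡± ρ ⊎ Avoids ρ w → Good ρ n
    by-values (inj₂ a) (inj₂ b) (inj₂ c) (inj₂ d) = x , y , z , w , (a , b , c , d) , n≡
    by-values (inj₁ p) _ _ _ = replace-ρ y z w 4∤n 8∣ρ
      (trans n≡ (sumOf4-± p (±-refl y) (±-refl z) (±-refl w)))
    by-values _ (inj₁ p) _ _ = replace-ρ x z w 4∤n 8∣ρ
      (trans n≡ (trans (sumOf4-± (±-refl x) p (±-refl z) (±-refl w)) (sumOf4-swap₁₂ x ρ z w)))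
    by-values _ _ (inj₁ p) _ = replace-ρ x y w 4∤n 8∣ρ
      (trans n≡ (trans (sumOf4-± (±-refl x) (±-refl y) p (±-refl w))
        (trans (sumOf4-swap₂₃ x y ρ w) (sumOf4-swap₁₂ x ρ y w))))
    by-values _ _ _ (inj₁ p) = replace-ρ x y z 4∤n 8∣ρ
      (trans n≡ (trans (sumOf4-± (±-refl x) (±-refl y) (±-refl z) p)
        (trans (sumOf4-swap₃₄ x y z ρ) (trans (sumOf4-swap₂₃ x y ρ z) (sumOf4-swap₁₂ x ρ y z)))))

-- ρ = 1 and ρ = 2

-- In units of (ρ/2)² and in the order of `Nset`: the first six are 4 times the coefficients of ρ².
exceptions : List ℕ
exceptions = 8 ∷ 24 ∷ 40 ∷ 56 ∷ 120 ∷ 184 ∷ 6 ∷ 14 ∷ 22 ∷ 30 ∷ []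

-- The elements of N(ρ) are the c (ρ/2)²; the factor 4 keeps this meaningful for ρ = 1.
Exceptional : ℤ → ℤ → Set
Exceptional ρ n = Any.Any (λ c → + 4 * n ≡ + c * (ρ * ρ)) exceptions

-- The entries of the polynomial representations are linear in the parameter u; this and
-- `affine-no-root` isolate the parameters where such an entry is ± ρ.
affine-root : ∀ a b u {v} u₀ .{{_ : ℤ.NonZero a}} → a * u₀ + b ≡ v → u ≢ u₀ → a * u + b ≢ v
affine-root a b u u₀ eq₀ u≢u₀ eq =
  u≢u₀ (ℤ.*-cancelˡ-≡ a u u₀ (trans (lemma (a * u) b)
    (trans (cong (_- b) (trans eq (sym eq₀))) (sym (lemma (a * u₀) b)))))
  where
  lemma : ∀ x b → x ≡ x + b - b
  lemma = solve-∀

affine-no-root : ∀ a b u {v} → ¬ a ∣ v - b → a * u + b ≢ v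
affine-no-root a b u a∤ refl = a∤ (divides u (lemma a b u))
  where
  lemma : ∀ a b u → a * u + b - b ≡ u * a
  lemma = solve-∀

residue₃′ : ∀ x → (∃ λ u → x ≡ + 3 * u) ⊎ (∃ λ u → x ≡ + 3 * u + + 1) ⊎ (∃ λ u → x ≡ + 3 * u - + 1)
residue₃′ x = go (residue₃ x)
  where
  lemma₁ : ∀ x → x ≡ x - + 1 + + 1
  lemma₁ = solve-∀
  lemma₂ : ∀ x → x ≡ x + + 1 - + 1
  lemma₂ = solve-∀
  go : + 3 ∣ x ⊎ + 3 ∣ x - + 1 ⊎ + 3 ∣ x + + 1 →
    (∃ λ u → x ≡ + 3 * u) ⊎ (∃ λ u → x ≡ + 3 * u + + 1) ⊎ (∃ λ u → x ≡ + 3 * u - + 1)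
  go (inj₁ (divides u eq)) = inj₁ (u , trans eq (ℤ.*-comm u (+ 3)))
  go (inj₂ (inj₁ (divides u eq))) = inj₂ (inj₁
    (u , trans (lemma₁ x) (cong (_+ + 1) (trans eq (ℤ.*-comm u (+ 3))))))
  go (inj₂ (inj₂ (divides u eq))) = inj₂ (inj₂
    (u , trans (lemma₂ x) (cong (_- + 1) (trans eq (ℤ.*-comm u (+ 3))))))

even⇒avoids-1 : ∀ {x} → Even x → Avoids (+ 1) x
even⇒avoids-1 e (inj₁ refl) = from-no (+ 2 ∣? + 1) e
even⇒avoids-1 e (inj₂ refl) = from-no (+ 2 ∣? - (+ 1)) e

odd⇒avoids-2 : ∀ {x} → Odd x → Avoids (+ 2) x
odd⇒avoids-2 o (inj₁ refl) = from-no (+ 2 ∣? + 3) o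
odd⇒avoids-2 o (inj₂ refl) = from-no (+ 2 ∣? - (+ 1)) o

4∣⇒avoids-2 : ∀ {x} → + 4 ∣ x → Avoids (+ 2) x
4∣⇒avoids-2 d (inj₁ refl) = from-no (+ 4 ∣? + 2) d
4∣⇒avoids-2 d (inj₂ refl) = from-no (+ 4 ∣? - (+ 2)) d

even-double : ∀ x → Even (+ 2 * x)
even-double x = divides x (ℤ.*-comm (+ 2) x)

odd-double+1 : ∀ x → Odd (+ 2 * x + + 1)
odd-double+1 x = divides (x + + 1) (lemma x)
  where
  lemma : ∀ x → + 2 * x + + 1 + + 1 ≡ (x + + 1) * + 2
  lemma = solve-∀

≡±-dec : ∀ x y → Dec (x ≡± y)
≡±-dec x y = x ℤ.≟ y ⊎-dec x ℤ.≟ - y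

-- Even entries cannot be ± 1, which leaves two entries to check.
good₁ : ∀ {n} x y z w → Avoids (+ 1) x → Avoids (+ 1) y → n ≡ sumOf4 x y (+ 2 * z) (+ 2 * w) → Good (+ 1) n
good₁ x y z w x-ok y-ok n≡ = x , y , + 2 * z , + 2 * w ,
  (x-ok , y-ok , even⇒avoids-1 (even-double z) , even⇒avoids-1 (even-double w)) , n≡

-- Odd entries and multiples of 4 cannot be ± 2, which leaves one entry to check.
good₂ : ∀ {n} x y z w → Avoids (+ 2) x → + 4 ∣ y → n ≡ sumOf4 x y (+ 2 * z + + 1) (+ 2 * w + + 1) → Good (+ 2) n
good₂ x y z w x-ok 4∣y n≡ = x , y , + 2 * z + + 1 , + 2 * w + + 1 ,
  (x-ok , 4∣⇒avoids-2 4∣y , odd⇒avoids-2 (odd-double+1 z) , odd⇒avoids-2 (odd-double+1 w)) , n≡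

exceptional? : ∀ ρ n → Dec (Exceptional ρ n)
exceptional? ρ n = Any.any? (λ c → + 4 * n ℤ.≟ + c * (ρ * ρ)) exceptions

exceptional : ∀ ρ v {n} → {True (exceptional? ρ v)} → n ≡ v → Exceptional ρ n
exceptional ρ v {_} {exc} refl = toWitness exc

-- Pairing x with x + 1 gives the entries 2x + 1, -1, 2x + 2, 0. For x = 3u and x = 3u + 1 the
-- representations below come from turning ± 1 with 2x + 2 and 0, for x = 3u - 1 from turning 1 with
-- 2x + 1 and 2x + 2. The parameters set apart are those where an entry is still ± 1.
family₁ : ∀ {n} x → n ≡ + 2 * sumOf4 x (x + + 1) (x + + 1) (x + + 1) → Good (+ 1) n ⊎ Exceptional (+ 1) n
family₁ {n} x n≡ = by-residue (residue₃′ x)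
  where
  case₀ : ∀ u → n ≡ + 2 * sumOf4 (+ 3 * u) (+ 3 * u + + 1) (+ 3 * u + + 1) (+ 3 * u + + 1) →
    Dec (u ≡ + 0) → Good (+ 1) n ⊎ Exceptional (+ 1) n
  case₀ u n≡ (yes refl) = inj₂ (exceptional (+ 1) (+ 6) n≡)
  case₀ u n≡ (no u≢0) = inj₁ (good₁ (+ 6 * u + + 1) (+ 4 * u + + 1) (+ 2 * u + + 1) u
    [ affine-root (+ 6) (+ 1) u (+ 0) refl u≢0
    , affine-no-root (+ 6) (+ 1) u (from-no (+ 6 ∣? - (+ 2))) ]′
    [ affine-root (+ 4) (+ 1) u (+ 0) refl u≢0
    , affine-no-root (+ 4) (+ 1) u (from-no (+ 4 ∣? - (+ 2))) ]′
    (trans n≡ (identity u)))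
    where
    identity : ∀ u →
      + 2 * ((+ 3 * u) * (+ 3 * u) + (+ 3 * u + + 1) * (+ 3 * u + + 1)
           + (+ 3 * u + + 1) * (+ 3 * u + + 1) + (+ 3 * u + + 1) * (+ 3 * u + + 1))
      ≡ (+ 6 * u + + 1) * (+ 6 * u + + 1) + (+ 4 * u + + 1) * (+ 4 * u + + 1)
        + (+ 2 * (+ 2 * u + + 1)) * (+ 2 * (+ 2 * u + + 1)) + (+ 2 * u) * (+ 2 * u)
    identity = solve-∀
  case₁ : ∀ u → n ≡ + 2 * sumOf4 (+ 3 * u + + 1) (+ 3 * u + + 1 + + 1) (+ 3 * u + + 1 + + 1)
    (+ 3 * u + + 1 + + 1) →
    Dec (u ≡ - (+ 1)) → Good (+ 1) n ⊎ Exceptional (+ 1) n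
  case₁ u n≡ (yes refl) = inj₂ (exceptional (+ 1) (+ 14) n≡)
  case₁ u n≡ (no u≢-1) = inj₁ (good₁ (+ 6 * u + + 3) (+ 4 * u + + 3) (+ 2 * u + + 1) (u + + 1)
    [ affine-no-root (+ 6) (+ 3) u (from-no (+ 6 ∣? - (+ 2)))
    , affine-no-root (+ 6) (+ 3) u (from-no (+ 6 ∣? - (+ 4))) ]′
    [ affine-no-root (+ 4) (+ 3) u (from-no (+ 4 ∣? - (+ 2)))
    , affine-root (+ 4) (+ 3) u (- (+ 1)) refl u≢-1 ]′
    (trans n≡ (identity u)))
    where
    identity : ∀ u →
      + 2 * ((+ 3 * u + + 1) * (+ 3 * u + + 1) + (+ 3 * u + + 1 + + 1) * (+ 3 * u + + 1 + + 1)
           + (+ 3 * u + + 1 + + 1) * (+ 3 * u + + 1 + + 1) + (+ 3 * u + + 1 + + 1) * (+ 3 * u + + 1 + + 1))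
      ≡ (+ 6 * u + + 3) * (+ 6 * u + + 3) + (+ 4 * u + + 3) * (+ 4 * u + + 3)
        + (+ 2 * (+ 2 * u + + 1)) * (+ 2 * (+ 2 * u + + 1)) + (+ 2 * (u + + 1)) * (+ 2 * (u + + 1))
    identity = solve-∀
  case₂ : ∀ u → n ≡ + 2 * sumOf4 (+ 3 * u - + 1) (+ 3 * u - + 1 + + 1) (+ 3 * u - + 1 + + 1)
    (+ 3 * u - + 1 + + 1) →
    Dec (u ≡ + 0) → Dec (u ≡ - (+ 1)) → Good (+ 1) n ⊎ Exceptional (+ 1) n
  case₂ u n≡ (yes refl) _ = inj₂ (exceptional (+ 1) (+ 2) n≡)
  -- At u = -1 the entry 2u + 1 is -1, but n = 86 = 5² + 3² + 6² + 4².
  case₂ u n≡ _ (yes refl) = inj₁ (good₁ (+ 5) (+ 3) (+ 3) (+ 2) (from-no (≡±-dec (+ 5) (+ 1)))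
    (from-no (≡±-dec (+ 3) (+ 1))) n≡)
  case₂ u n≡ (no u≢0) (no u≢-1) = inj₁ (good₁ (+ 8 * u + - (+ 1)) (+ 2 * u + + 1) u (+ 0)
    [ affine-no-root (+ 8) (- (+ 1)) u (from-no (+ 8 ∣? + 2))
    , affine-root (+ 8) (- (+ 1)) u (+ 0) refl u≢0 ]′
    [ affine-root (+ 2) (+ 1) u (+ 0) refl u≢0
    , affine-root (+ 2) (+ 1) u (- (+ 1)) refl u≢-1 ]′
    (trans n≡ (identity u)))
    where
    identity : ∀ u →
      + 2 * ((+ 3 * u - + 1) * (+ 3 * u - + 1) + (+ 3 * u - + 1 + + 1) * (+ 3 * u - + 1 + + 1)
           + (+ 3 * u - + 1 + + 1) * (+ 3 * u - + 1 + + 1) + (+ 3 * u - + 1 + + 1) * (+ 3 * u - + 1 + + 1))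
      ≡ (+ 8 * u + - (+ 1)) * (+ 8 * u + - (+ 1)) + (+ 2 * u + + 1) * (+ 2 * u + + 1)
        + (+ 2 * u) * (+ 2 * u) + (+ 2 * (+ 0)) * (+ 2 * (+ 0))
    identity = solve-∀
  by-residue : (∃ λ u → x ≡ + 3 * u) ⊎ (∃ λ u → x ≡ + 3 * u + + 1) ⊎ (∃ λ u → x ≡ + 3 * u - + 1) →
    Good (+ 1) n ⊎ Exceptional (+ 1) n
  by-residue (inj₁ (u , refl)) = case₀ u n≡ (u ℤ.≟ + 0)
  by-residue (inj₂ (inj₁ (u , refl))) = case₁ u n≡ (u ℤ.≟ - (+ 1))
  by-residue (inj₂ (inj₂ (u , refl))) = case₂ u n≡ (u ℤ.≟ + 0) (u ℤ.≟ - (+ 1))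

-- Pairing x with x + 1 and x + 1 with x - 1 gives 2x + 1, -1, 2x, 2. All three cases turn 2x with ±
-- 1 and ± 2, the signs depending on x modulo 3.
family₂ : ∀ {n} x → n ≡ + 2 * sumOf4 x (x + + 1) (x + + 1) (x - + 1) → Good (+ 1) n ⊎ Exceptional (+ 1) n
family₂ {n} x n≡ = by-residue (residue₃′ x)
  where
  case₀ : ∀ u → n ≡ + 2 * sumOf4 (+ 3 * u) (+ 3 * u + + 1) (+ 3 * u + + 1) (+ 3 * u - + 1) →
    Dec (u ≡ + 0) → Good (+ 1) n ⊎ Exceptional (+ 1) n
  case₀ u n≡ (yes refl) = inj₂ (exceptional (+ 1) (+ 6) n≡)
  case₀ u n≡ (no u≢0) = inj₁ (good₁ (+ 6 * u + + 1) (+ 4 * u + + 1) (+ 2 * u) (u - + 1)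
    [ affine-root (+ 6) (+ 1) u (+ 0) refl u≢0
    , affine-no-root (+ 6) (+ 1) u (from-no (+ 6 ∣? - (+ 2))) ]′
    [ affine-root (+ 4) (+ 1) u (+ 0) refl u≢0
    , affine-no-root (+ 4) (+ 1) u (from-no (+ 4 ∣? - (+ 2))) ]′
    (trans n≡ (identity u)))
    where
    identity : ∀ u →
      + 2 * ((+ 3 * u) * (+ 3 * u) + (+ 3 * u + + 1) * (+ 3 * u + + 1)
           + (+ 3 * u + + 1) * (+ 3 * u + + 1) + (+ 3 * u - + 1) * (+ 3 * u - + 1))
      ≡ (+ 6 * u + + 1) * (+ 6 * u + + 1) + (+ 4 * u + + 1) * (+ 4 * u + + 1)
        + (+ 2 * (+ 2 * u)) * (+ 2 * (+ 2 * u)) + (+ 2 * (u - + 1)) * (+ 2 * (u - + 1))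
    identity = solve-∀
  case₁ : ∀ u → n ≡ + 2 * sumOf4 (+ 3 * u + + 1) (+ 3 * u + + 1 + + 1) (+ 3 * u + + 1 + + 1)
    (+ 3 * u + + 1 - + 1) →
    Dec (u ≡ - (+ 1)) → Good (+ 1) n ⊎ Exceptional (+ 1) n
  case₁ u n≡ (yes refl) = inj₂ (exceptional (+ 1) (+ 30) n≡)
  case₁ u n≡ (no u≢-1) = inj₁ (good₁ (+ 6 * u + + 3) (+ 4 * u + + 3) (+ 2 * u) u
    [ affine-no-root (+ 6) (+ 3) u (from-no (+ 6 ∣? - (+ 2)))
    , affine-no-root (+ 6) (+ 3) u (from-no (+ 6 ∣? - (+ 4))) ]′
    [ affine-no-root (+ 4) (+ 3) u (from-no (+ 4 ∣? - (+ 2)))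
    , affine-root (+ 4) (+ 3) u (- (+ 1)) refl u≢-1 ]′
    (trans n≡ (identity u)))
    where
    identity : ∀ u →
      + 2 * ((+ 3 * u + + 1) * (+ 3 * u + + 1) + (+ 3 * u + + 1 + + 1) * (+ 3 * u + + 1 + + 1)
           + (+ 3 * u + + 1 + + 1) * (+ 3 * u + + 1 + + 1) + (+ 3 * u + + 1 - + 1) * (+ 3 * u + + 1 - + 1))
      ≡ (+ 6 * u + + 3) * (+ 6 * u + + 3) + (+ 4 * u + + 3) * (+ 4 * u + + 3)
        + (+ 2 * (+ 2 * u)) * (+ 2 * (+ 2 * u)) + (+ 2 * u) * (+ 2 * u)
    identity = solve-∀
  case₂ : ∀ u → n ≡ + 2 * sumOf4 (+ 3 * u - + 1) (+ 3 * u - + 1 + + 1) (+ 3 * u - + 1 + + 1)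
    (+ 3 * u - + 1 - + 1) →
    Dec (u ≡ + 0) → Dec (u ≡ + 1) → Good (+ 1) n ⊎ Exceptional (+ 1) n
  case₂ u n≡ (yes refl) _ = inj₂ (exceptional (+ 1) (+ 10) n≡)
  case₂ u n≡ _ (yes refl) = inj₂ (exceptional (+ 1) (+ 46) n≡)
  case₂ u n≡ (no u≢0) (no u≢1) = inj₁ (good₁ (+ 6 * u + - (+ 1)) (+ 4 * u + - (+ 3)) (+ 2 * u) u
    [ affine-no-root (+ 6) (- (+ 1)) u (from-no (+ 6 ∣? + 2))
    , affine-root (+ 6) (- (+ 1)) u (+ 0) refl u≢0 ]′
    [ affine-root (+ 4) (- (+ 3)) u (+ 1) refl u≢1
    , affine-no-root (+ 4) (- (+ 3)) u (from-no (+ 4 ∣? + 2)) ]′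
    (trans n≡ (identity u)))
    where
    identity : ∀ u →
      + 2 * ((+ 3 * u - + 1) * (+ 3 * u - + 1) + (+ 3 * u - + 1 + + 1) * (+ 3 * u - + 1 + + 1)
           + (+ 3 * u - + 1 + + 1) * (+ 3 * u - + 1 + + 1) + (+ 3 * u - + 1 - + 1) * (+ 3 * u - + 1 - + 1))
      ≡ (+ 6 * u + - (+ 1)) * (+ 6 * u + - (+ 1)) + (+ 4 * u + - (+ 3)) * (+ 4 * u + - (+ 3))
        + (+ 2 * (+ 2 * u)) * (+ 2 * (+ 2 * u)) + (+ 2 * u) * (+ 2 * u)
    identity = solve-∀
  by-residue : (∃ λ u → x ≡ + 3 * u) ⊎ (∃ λ u → x ≡ + 3 * u + + 1) ⊎ (∃ λ u → x ≡ + 3 * u - + 1) →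
    Good (+ 1) n ⊎ Exceptional (+ 1) n
  by-residue (inj₁ (u , refl)) = case₀ u n≡ (u ℤ.≟ + 0)
  by-residue (inj₂ (inj₁ (u , refl))) = case₁ u n≡ (u ℤ.≟ - (+ 1))
  by-residue (inj₂ (inj₂ (u , refl))) = case₂ u n≡ (u ℤ.≟ + 0) (u ℤ.≟ + 1)

-- The pairing (2h, 1), (1, 1) gives 2h + 1, 2h - 1, 2, 0. For h = 3u - 1 both 2h ± 1 are turned
-- with -2, for h = 3u the entries 2h + 1, 2 and 0 are turned. The class h = 3u + 1 is reached by h
-- ↦ -h.
family₃ : ∀ {n} h → n ≡ + 2 * sumOf4 (+ 2 * h) (+ 1) (+ 1) (+ 1) → Good (+ 2) n ⊎ Exceptional (+ 2) n
family₃ {n} h n≡ = by-residue (residue₃′ h)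
  where
  case₂ : ∀ u → n ≡ + 2 * sumOf4 (+ 2 * (+ 3 * u - + 1)) (+ 1) (+ 1) (+ 1) →
    Dec (u ≡ + 0) → Good (+ 2) n ⊎ Exceptional (+ 2) n
  case₂ u n≡ (yes refl) = inj₂ (exceptional (+ 2) (+ 14) n≡)
  case₂ u n≡ (no u≢0) = inj₁ (good₂ (+ 8 * u + - (+ 2)) (+ 4 * + 0) (u - + 1) (u - + 2)
    [ affine-no-root (+ 8) (- (+ 2)) u (from-no (+ 8 ∣? + 4))
    , affine-root (+ 8) (- (+ 2)) u (+ 0) refl u≢0 ]′
    (divides (+ 0) (ℤ.*-comm (+ 4) (+ 0)))
    (trans n≡ (identity u)))
    where
    identity : ∀ u →
      + 2 * ((+ 2 * (+ 3 * u - + 1)) * (+ 2 * (+ 3 * u - + 1)) + (+ 1) * (+ 1)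
           + (+ 1) * (+ 1) + (+ 1) * (+ 1))
      ≡ (+ 8 * u + - (+ 2)) * (+ 8 * u + - (+ 2))
        + (+ 4 * + 0) * (+ 4 * + 0)
        + (+ 2 * (u - + 1) + + 1) * (+ 2 * (u - + 1) + + 1)
        + (+ 2 * (u - + 2) + + 1) * (+ 2 * (u - + 2) + + 1)
    identity = solve-∀
  case₀ : ∀ u → n ≡ + 2 * sumOf4 (+ 2 * (+ 3 * u)) (+ 1) (+ 1) (+ 1) →
    Dec (u ≡ + 0) → Dec (u ≡ - (+ 1)) → Good (+ 2) n ⊎ Exceptional (+ 2) n
  case₀ u n≡ (yes refl) _ = inj₂ (exceptional (+ 2) (+ 6) n≡)
  case₀ u n≡ _ (yes refl) = inj₁ (good₂ (+ 6) (+ 4) (+ 2) (+ 0) (from-no (≡±-dec (+ 6) (+ 2)))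
    (divides (+ 1) refl) n≡)
  case₀ u n≡ (no u≢0) (no u≢-1) = inj₁ (good₂ (+ 4 * u + + 2) (+ 4 * u) (+ 3 * u - + 1) (u - + 1)
    [ affine-root (+ 4) (+ 2) u (+ 0) refl u≢0
    , affine-root (+ 4) (+ 2) u (- (+ 1)) refl u≢-1 ]′
    (divides u (ℤ.*-comm (+ 4) u))
    (trans n≡ (identity u)))
    where
    identity : ∀ u →
      + 2 * ((+ 2 * (+ 3 * u)) * (+ 2 * (+ 3 * u)) + (+ 1) * (+ 1) + (+ 1) * (+ 1) + (+ 1) * (+ 1))
      ≡ (+ 4 * u + + 2) * (+ 4 * u + + 2)
        + (+ 4 * u) * (+ 4 * u)
        + (+ 2 * (+ 3 * u - + 1) + + 1) * (+ 2 * (+ 3 * u - + 1) + + 1)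
        + (+ 2 * (u - + 1) + + 1) * (+ 2 * (u - + 1) + + 1)
    identity = solve-∀
  mirror : ∀ u →
    (+ 2 * (+ 3 * u + + 1)) * (+ 2 * (+ 3 * u + + 1)) + (+ 1) * (+ 1) + (+ 1) * (+ 1) + (+ 1) * (+ 1)
    ≡ (+ 2 * (+ 3 * - u - + 1)) * (+ 2 * (+ 3 * - u - + 1)) + (+ 1) * (+ 1) + (+ 1) * (+ 1) + (+ 1) * (+ 1)
  mirror = solve-∀
  by-residue : (∃ λ u → h ≡ + 3 * u) ⊎ (∃ λ u → h ≡ + 3 * u + + 1) ⊎ (∃ λ u → h ≡ + 3 * u - + 1) →
    Good (+ 2) n ⊎ Exceptional (+ 2) n
  by-residue (inj₁ (u , refl)) = case₀ u n≡ (u ℤ.≟ + 0) (u ℤ.≟ - (+ 1))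
  by-residue (inj₂ (inj₁ (u , refl))) = case₂ (- u) (trans n≡ (cong (+ 2 *_) (mirror u))) (- u ℤ.≟ + 0)
  by-residue (inj₂ (inj₂ (u , refl))) = case₂ u n≡ (u ℤ.≟ + 0)

-- For h = 3u - 1 the pairing (2h, 3), (1, 1) gives 2h + 3, 2h - 3, 2, 0, and 2h ± 3 are turned with
-- -2. For h = 3u the pairing (2h, 1), (3, 1) gives 2h + 1, 2h - 1, 4, 2, and 2h + 1 is turned with
-- 4 and -2.
family₄ : ∀ {n} h → n ≡ + 2 * sumOf4 (+ 2 * h) (+ 3) (+ 1) (+ 1) → Good (+ 2) n ⊎ Exceptional (+ 2) n
family₄ {n} h n≡ = by-residue (residue₃′ h)
  where
  case₂ : ∀ u → n ≡ + 2 * sumOf4 (+ 2 * (+ 3 * u - + 1)) (+ 3) (+ 1) (+ 1) →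
    Dec (u ≡ + 0) → Good (+ 2) n ⊎ Exceptional (+ 2) n
  case₂ u n≡ (yes refl) = inj₂ (exceptional (+ 2) (+ 30) n≡)
  case₂ u n≡ (no u≢0) = inj₁ (good₂ (+ 8 * u + - (+ 2)) (+ 4 * + 0) u (u - + 3)
    [ affine-no-root (+ 8) (- (+ 2)) u (from-no (+ 8 ∣? + 4))
    , affine-root (+ 8) (- (+ 2)) u (+ 0) refl u≢0 ]′
    (divides (+ 0) (ℤ.*-comm (+ 4) (+ 0)))
    (trans n≡ (identity u)))
    where
    identity : ∀ u →
      + 2 * ((+ 2 * (+ 3 * u - + 1)) * (+ 2 * (+ 3 * u - + 1)) + (+ 3) * (+ 3)
           + (+ 1) * (+ 1) + (+ 1) * (+ 1))
      ≡ (+ 8 * u + - (+ 2)) * (+ 8 * u + - (+ 2)) + (+ 4 * + 0) * (+ 4 * + 0)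
        + (+ 2 * u + + 1) * (+ 2 * u + + 1) + (+ 2 * (u - + 3) + + 1) * (+ 2 * (u - + 3) + + 1)
    identity = solve-∀
  case₀ : ∀ u → n ≡ + 2 * sumOf4 (+ 2 * (+ 3 * u)) (+ 3) (+ 1) (+ 1) →
    Dec (u ≡ + 0) → Dec (u ≡ + 1) → Good (+ 2) n ⊎ Exceptional (+ 2) n
  case₀ u n≡ (yes refl) _ = inj₂ (exceptional (+ 2) (+ 22) n≡)
  case₀ u n≡ _ (yes refl) = inj₁ (good₂ (+ 6) (+ 0) (+ 3) (+ 1) (from-no (≡±-dec (+ 6) (+ 2)))
    (divides (+ 0) refl) n≡)
  case₀ u n≡ (no u≢0) (no u≢1) = inj₁ (good₂ (+ 4 * u + - (+ 2)) (+ 4 * (u + + 1)) (+ 3 * u - + 1) (u - + 1)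
    [ affine-root (+ 4) (- (+ 2)) u (+ 1) refl u≢1
    , affine-root (+ 4) (- (+ 2)) u (+ 0) refl u≢0 ]′
    (divides (u + + 1) (ℤ.*-comm (+ 4) (u + + 1)))
    (trans n≡ (identity u)))
    where
    identity : ∀ u →
      + 2 * ((+ 2 * (+ 3 * u)) * (+ 2 * (+ 3 * u)) + (+ 3) * (+ 3) + (+ 1) * (+ 1) + (+ 1) * (+ 1))
      ≡ (+ 4 * u + - (+ 2)) * (+ 4 * u + - (+ 2))
        + (+ 4 * (u + + 1)) * (+ 4 * (u + + 1))
        + (+ 2 * (+ 3 * u - + 1) + + 1) * (+ 2 * (+ 3 * u - + 1) + + 1)
        + (+ 2 * (u - + 1) + + 1) * (+ 2 * (u - + 1) + + 1)
    identity = solve-∀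
  mirror : ∀ u →
    (+ 2 * (+ 3 * u + + 1)) * (+ 2 * (+ 3 * u + + 1)) + (+ 3) * (+ 3) + (+ 1) * (+ 1) + (+ 1) * (+ 1)
    ≡ (+ 2 * (+ 3 * - u - + 1)) * (+ 2 * (+ 3 * - u - + 1)) + (+ 3) * (+ 3) + (+ 1) * (+ 1) + (+ 1) * (+ 1)
  mirror = solve-∀
  by-residue : (∃ λ u → h ≡ + 3 * u) ⊎ (∃ λ u → h ≡ + 3 * u + + 1) ⊎ (∃ λ u → h ≡ + 3 * u - + 1) →
    Good (+ 2) n ⊎ Exceptional (+ 2) n
  by-residue (inj₁ (u , refl)) = case₀ u n≡ (u ℤ.≟ + 0) (u ℤ.≟ + 1)
  by-residue (inj₂ (inj₁ (u , refl))) = case₂ (- u) (trans n≡ (cong (+ 2 *_) (mirror u))) (- u ℤ.≟ + 0)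
  by-residue (inj₂ (inj₂ (u , refl))) = case₂ u n≡ (u ℤ.≟ + 0)

-- Sums and differences of pairs, and where they fail

pair-sums : ∀ {m} x y z w → m ≡ sumOf4 x y z w → + 2 * m ≡ sumOf4 (x + y) (x - y) (z + w) (z - w)
pair-sums x y z w refl = identity x y z w
  where
  identity : ∀ x y z w → + 2 * (x * x + y * y + z * z + w * w) ≡
    (x + y) * (x + y) + (x - y) * (x - y) + (z + w) * (z + w) + (z - w) * (z - w)
  identity = solve-∀

pronic : ∀ x → Even (x * (x - + 1))
pronic x = [ ∣m⇒∣m*n {m = x} (x - + 1)
           , (λ o → ∣n⇒∣m*n x (∣-comb₂ (+ 1) (- (+ 1)) o (∣-refl {+ 2}) (shift x))) ]′ (parity x)
  where
  shift : ∀ x → x - + 1 ≡ + 1 * (x + + 1) + - (+ 1) * + 2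
  shift = solve-∀

sumOf4-parity : ∀ x y z w → Even (sumOf4 x y z w - (x + y + z + w))
sumOf4-parity x y z w = ∣-comb₂ (+ 1) (+ 1) (∣m∣n⇒∣m+n (pronic x) (pronic y))
  (∣m∣n⇒∣m+n (pronic z) (pronic w)) (lemma x y z w)
  where
  lemma : ∀ x y z w → x * x + y * y + z * z + w * w - (x + y + z + w) ≡
    + 1 * (x * (x - + 1) + y * (y - + 1)) + + 1 * (z * (z - + 1) + w * (w - + 1))
  lemma = solve-∀

-- Here p is the entry whose parity differs from that of the other three. It may be even or odd: a
-- sum of four squares is odd when one or three of the entries are.
OddOneOut : ℤ → Set
OddOneOut m = ∃ λ p → ∃ λ q → ∃ λ r → ∃ λ s → Odd (p + q) × Odd (p + r) × Odd (p + s) × m ≡ sumOf4 p q r s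

odd-one-out : ∀ {m} → Odd m → FourSquares m → OddOneOut m
odd-one-out {m} m-odd (p , q , r , s , refl) = go (parity (p + q)) (parity (p + r)) (parity (p + s))
  where
  total : ∀ p q r s M → p + q + (p + r) + (p + s) + + 1
    ≡ + 1 * (M + + 1) + - (+ 1) * (M - (p + q + r + s)) + p * + 2
  total = solve-∀
  -- Modulo 2 this is p + q + r + s ≡ m. Hence one or all three of p + q, p + r, p + s are odd.
  sums-odd : Odd (p + q + (p + r) + (p + s))
  sums-odd = ∣-comb₃ (+ 1) (- (+ 1)) p m-odd (sumOf4-parity p q r s) (∣-refl {+ 2})
    (total p q r s (sumOf4 p q r s))
  e+e+e : ∀ a b c → Even a → Even b → Even c → ¬ Odd (a + b + c)
  e+e+e a b c x y z o = odd⇒¬even o (∣m∣n⇒∣m+n (∣m∣n⇒∣m+n x y) z)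
  two-odd : ∀ a b c → Odd a → Odd b → Even c → Odd (a + b + c) → ⊥
  two-odd a b c x y z o = odd⇒¬even o (∣-comb₃ (+ 1) (+ 1) (+ 1) (∣-comb₂ (+ 1) (+ 1) x y refl) z
    (∣m⇒∣-m {m = + 2} ∣-refl) (lemma a b c))
    where
    lemma : ∀ a b c → a + b + c ≡ + 1 * (+ 1 * (a + + 1) + + 1 * (b + + 1)) + + 1 * c + + 1 * - (+ 2)
    lemma = solve-∀
  swap-first : ∀ p q → Odd (p + q) → Odd (q + p)
  swap-first p q = subst Odd (ℤ.+-comm p q)
  differ : ∀ p q r → Odd (p + q) → Even (p + r) → Odd (q + r)
  differ p q r o e = ∣-comb₃ (+ 1) (+ 1) (- p) o e (∣-refl {+ 2}) (lemma p q r)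
    where
    lemma : ∀ p q r → q + r + + 1 ≡ + 1 * (p + q + + 1) + + 1 * (p + r) + - p * + 2
    lemma = solve-∀
  rotate : ∀ a b c → a + b + c ≡ b + c + a
  rotate = solve-∀
  swap₂₃ : ∀ a b c → a + b + c ≡ a + c + b
  swap₂₃ = solve-∀
  go : Even (p + q) ⊎ Odd (p + q) → Even (p + r) ⊎ Odd (p + r) → Even (p + s) ⊎ Odd (p + s) →
    OddOneOut (sumOf4 p q r s)
  go (inj₂ a) (inj₂ b) (inj₂ c) = p , q , r , s , a , b , c , refl
  go (inj₂ a) (inj₁ b) (inj₁ c) = q , p , r , s , swap-first p q a , differ p q r a b , differ p q s a c ,
    sumOf4-swap₁₂ p q r s
  go (inj₁ a) (inj₂ b) (inj₁ c) = r , p , q , s , swap-first p r b , differ p r q b a , differ p r s b c ,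
    trans (sumOf4-swap₂₃ p q r s) (sumOf4-swap₁₂ p r q s)
  go (inj₁ a) (inj₁ b) (inj₂ c) = s , p , q , r , swap-first p s c , differ p s q c a , differ p s r c b ,
    trans (sumOf4-swap₃₄ p q r s) (trans (sumOf4-swap₂₃ p q s r) (sumOf4-swap₁₂ p s q r))
  go (inj₁ a) (inj₁ b) (inj₁ c) = ⊥-elim (e+e+e (p + q) (p + r) (p + s) a b c sums-odd)
  go (inj₂ a) (inj₂ b) (inj₁ c) = ⊥-elim (two-odd (p + q) (p + r) (p + s) a b c sums-odd)
  go (inj₂ a) (inj₁ b) (inj₂ c) = ⊥-elim (two-odd (p + q) (p + s) (p + r) a c b
    (subst Odd (swap₂₃ (p + q) (p + r) (p + s)) sums-odd))
  go (inj₁ a) (inj₂ b) (inj₂ c) = ⊥-elim (two-odd (p + r) (p + s) (p + q) b c a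
    (subst Odd (rotate (p + q) (p + r) (p + s)) sums-odd))

neg-≡± : ∀ x → x ≡± - x
neg-≡± x = inj₂ (sym (ℤ.neg-involutive x))

near : ∀ c x y → x + y ≡± c ⊎ x - y ≡± c → y ≡± (x + c) ⊎ y ≡± (x - c)
near c x y (inj₁ (inj₁ refl)) = inj₂ (inj₂ (lemma x y))
  where
  lemma : ∀ x y → y ≡ - (x - (x + y))
  lemma = solve-∀
near c x y (inj₁ (inj₂ e)) = inj₁ (inj₂ (trans (lemma₁ x y) (trans (cong (_- x) e) (lemma₂ x c))))
  where
  lemma₁ : ∀ x y → y ≡ x + y - x
  lemma₁ = solve-∀
  lemma₂ : ∀ x c → - c - x ≡ - (x + c)
  lemma₂ = solve-∀
near c x y (inj₂ (inj₁ refl)) = inj₂ (inj₁ (lemma x y))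
  where
  lemma : ∀ x y → y ≡ x - (x - y)
  lemma = solve-∀
near c x y (inj₂ (inj₂ e)) = inj₁ (inj₁ (trans (lemma₁ x y) (trans (cong (λ k → x - k) e) (lemma₂ x c))))
  where
  lemma₁ : ∀ x y → y ≡ x - (x - y)
  lemma₁ = solve-∀
  lemma₂ : ∀ x c → x - - c ≡ x + c
  lemma₂ = solve-∀

near? : ∀ c x y → (Avoids c (x + y) × Avoids c (x - y)) ⊎ (y ≡± (x + c) ⊎ y ≡± (x - c))
near? c x y = go (avoids? c (x + y)) (avoids? c (x - y))
  where
  go : x + y ≡± c ⊎ Avoids c (x + y) → x - y ≡± c ⊎ Avoids c (x - y) →
    (Avoids c (x + y) × Avoids c (x - y)) ⊎ (y ≡± (x + c) ⊎ y ≡± (x - c))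
  go (inj₂ a) (inj₂ b) = inj₁ (a , b)
  go (inj₁ a) _ = inj₂ (near c x y (inj₁ a))
  go _ (inj₁ b) = inj₂ (near c x y (inj₂ b))

odd+odd-even : ∀ p r s → Odd (p + r) → Odd (p + s) → Even (r + s)
odd+odd-even p r s a b = ∣-comb₃ (+ 1) (+ 1) (- (p + + 1)) a b (∣-refl {+ 2}) (lemma p r s)
  where
  lemma : ∀ p r s → r + s ≡ + 1 * (p + r + + 1) + + 1 * (p + s + + 1) + - (p + + 1) * + 2
  lemma = solve-∀

even-difference : ∀ x y → Even (x + y) → Even (x - y)
even-difference x y e = ∣-comb₂ (+ 1) (- y) e (∣-refl {+ 2}) (lemma x y)
  where
  lemma : ∀ x y → x - y ≡ + 1 * (x + y) + - y * + 2
  lemma = solve-∀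

odd-difference : ∀ x y → Odd (x + y) → Odd (x - y)
odd-difference x y o = ∣-comb₂ (+ 1) (- y) o (∣-refl {+ 2}) (lemma x y)
  where
  lemma : ∀ x y → x - y + + 1 ≡ + 1 * (x + y + + 1) + - y * + 2
  lemma = solve-∀

-- As p ± q is odd and r ± s even, only p ± q can be ± 1. If p fails with each of q, r and s, these
-- are p + 1 or p - 1 up to sign; replacing p by -p brings the majority to p + 1, which leaves
-- `family₁` and `family₂`.
good-or-exceptional₁ : ∀ {m} → Odd m → FourSquares m → Good (+ 1) (+ 2 * m) ⊎ Exceptional (+ 1) (+ 2 * m)
good-or-exceptional₁ {m} m-odd squares = start (odd-one-out m-odd squares)
  where
  Result : Set
  Result = Good (+ 1) (+ 2 * m) ⊎ Exceptional (+ 1) (+ 2 * m)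

  doubled : ∀ {p p′ q q′ r r′ s s′} → m ≡ sumOf4 p q r s → p ≡± p′ → q ≡± q′ → r ≡± r′ → s ≡± s′ →
    + 2 * m ≡ + 2 * sumOf4 p′ q′ r′ s′
  doubled m≡ a b c d = cong (+ 2 *_) (trans m≡ (sumOf4-± a b c d))

  mirror₊ : ∀ p → p + + 1 ≡± (- p - + 1)
  mirror₊ p = inj₂ (lemma p)
    where
    lemma : ∀ p → p + + 1 ≡ - (- p - + 1)
    lemma = solve-∀
  mirror₋ : ∀ p → p - + 1 ≡± (- p + + 1)
  mirror₋ p = inj₂ (lemma p)
    where
    lemma : ∀ p → p - + 1 ≡ - (- p + + 1)
    lemma = solve-∀
  ±-trans : ∀ {x y z} → x ≡± y → y ≡± z → x ≡± z
  ±-trans (inj₁ refl) q = q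
  ±-trans (inj₂ refl) (inj₁ refl) = inj₂ refl
  ±-trans {z = z} (inj₂ refl) (inj₂ refl) = inj₁ (ℤ.neg-involutive z)

  by-nearness : ∀ p q r s → m ≡ sumOf4 p q r s → q ≡± (p + + 1) ⊎ q ≡± (p - + 1) → r ≡± (p + + 1) ⊎ r ≡±
    (p - + 1) →
    s ≡± (p + + 1) ⊎ s ≡± (p - + 1) → Result
  by-nearness p q r s m≡ (inj₁ a) (inj₁ b) (inj₁ c) = family₁ p (doubled m≡ (±-refl p) a b c)
  by-nearness p q r s m≡ (inj₁ a) (inj₁ b) (inj₂ c) = family₂ p (doubled m≡ (±-refl p) a b c)
  by-nearness p q r s m≡ (inj₁ a) (inj₂ b) (inj₁ c) =
    family₂ p (doubled (trans m≡ (sumOf4-swap₃₄ p q r s)) (±-refl p) a c b)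
  by-nearness p q r s m≡ (inj₂ a) (inj₁ b) (inj₁ c) =
    family₂ p (doubled (trans m≡ (trans (sumOf4-swap₂₃ p q r s) (sumOf4-swap₃₄ p r q s))) (±-refl p) b c a)
  by-nearness p q r s m≡ (inj₂ a) (inj₂ b) (inj₁ c) = family₂ (- p)
    (doubled m≡ (neg-≡± p) (±-trans a (mirror₋ p)) (±-trans b (mirror₋ p)) (±-trans c (mirror₊ p)))
  by-nearness p q r s m≡ (inj₂ a) (inj₁ b) (inj₂ c) = family₂ (- p)
    (doubled (trans m≡ (sumOf4-swap₃₄ p q r s)) (neg-≡± p) (±-trans a (mirror₋ p)) (±-trans c (mirror₋ p))
      (±-trans b (mirror₊ p)))
  by-nearness p q r s m≡ (inj₁ a) (inj₂ b) (inj₂ c) = family₂ (- p)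
    (doubled (trans m≡ (trans (sumOf4-swap₂₃ p q r s) (sumOf4-swap₃₄ p r q s)))
      (neg-≡± p) (±-trans b (mirror₋ p)) (±-trans c (mirror₋ p)) (±-trans a (mirror₊ p)))
  by-nearness p q r s m≡ (inj₂ a) (inj₂ b) (inj₂ c) = family₁ (- p)
    (doubled m≡ (neg-≡± p) (±-trans a (mirror₋ p)) (±-trans b (mirror₋ p)) (±-trans c (mirror₋ p)))

  pair-good : ∀ p q r s → Odd (p + r) → Odd (p + s) → m ≡ sumOf4 p q r s → Avoids (+ 1) (p + q) × Avoids
    (+ 1) (p - q) → Result
  pair-good p q r s a b m≡ (c , d) = inj₁ (p + q , p - q , r + s , r - s ,
    (c , d , even⇒avoids-1 e , even⇒avoids-1 (even-difference r s e)) , pair-sums p q r s m≡)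
    where
    e : Even (r + s)
    e = odd+odd-even p r s a b

  start : OddOneOut m → Result
  start (p , q , r , s , a , b , c , m≡) = go (near? (+ 1) p q) (near? (+ 1) p r) (near? (+ 1) p s)
    where
    Near : ℤ → Set
    Near q = (Avoids (+ 1) (p + q) × Avoids (+ 1) (p - q)) ⊎ (q ≡± (p + + 1) ⊎ q ≡± (p - + 1))
    go : Near q → Near r → Near s → Result
    go (inj₁ ok) _ _ = pair-good p q r s b c m≡ ok
    go _ (inj₁ ok) _ = pair-good p r q s a c (trans m≡ (sumOf4-swap₂₃ p q r s)) ok
    go _ _ (inj₁ ok) = pair-good p s q r a b (trans m≡
      (trans (sumOf4-swap₃₄ p q r s) (sumOf4-swap₂₃ p q s r))) ok
    go (inj₂ x) (inj₂ y) (inj₂ z) = by-nearness p q r s m≡ x y z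

-- Now only r ± s can be ± 2. For p odd, two of the halves of q, r, s have equal parity, and that
-- pair has sum and difference divisible by 4. For p even, failure of all pairs from the odd q, r, s
-- forces their absolute values to be 1, 1, 1 or 3, 1, 1 in some order, with p free.
good-or-exceptional₂ : ∀ {m} → Odd m → FourSquares m → Good (+ 2) (+ 2 * m) ⊎ Exceptional (+ 2) (+ 2 * m)
good-or-exceptional₂ {m} m-odd squares = start (odd-one-out m-odd squares)
  where
  Result : Set
  Result = Good (+ 2) (+ 2 * m) ⊎ Exceptional (+ 2) (+ 2 * m)

  odd-even-good : ∀ p q r s → Odd (p + q) → Avoids (+ 2) (r + s) → Avoids (+ 2) (r - s) → m ≡ sumOf4 p q r s →
    Result
  odd-even-good p q r s o a b m≡ = inj₁ (p + q , p - q , r + s , r - s ,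
    (odd⇒avoids-2 o , odd⇒avoids-2 (odd-difference p q o) , a , b) , pair-sums p q r s m≡)

  one-odd : ∀ p f g h → Odd p → m ≡ sumOf4 p (f * + 2) (g * + 2) (h * + 2) → Result
  one-odd p f g h p-odd m≡ = go (parity (f + g)) (parity (f + h))
    where
    odd+ : ∀ f → Odd (p + f * + 2)
    odd+ f = ∣-comb₂ (+ 1) f p-odd (∣-refl {+ 2}) (lemma p f)
      where
      lemma : ∀ p f → p + f * + 2 + + 1 ≡ + 1 * (p + + 1) + f * + 2
      lemma = solve-∀
    pair : ∀ f g h → Even (g + h) → m ≡ sumOf4 p (f * + 2) (g * + 2) (h * + 2) → Result
    pair f g h (divides k eq) = odd-even-good p (f * + 2) (g * + 2) (h * + 2) (odd+ f)
      (4∣⇒avoids-2 (divides k sum)) (4∣⇒avoids-2 (divides (k - h) difference))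
      where
      sum : g * + 2 + h * + 2 ≡ k * + 4
      sum = trans (lemma₁ g h) (trans (cong (_* + 2) eq) (lemma₂ k))
        where
        lemma₁ : ∀ g h → g * + 2 + h * + 2 ≡ (g + h) * + 2
        lemma₁ = solve-∀
        lemma₂ : ∀ k → k * + 2 * + 2 ≡ k * + 4
        lemma₂ = solve-∀
      difference : g * + 2 - h * + 2 ≡ (k - h) * + 4
      difference = trans (lemma₁ g h) (trans (cong (_- h * + 4) sum) (lemma₂ k h))
        where
        lemma₁ : ∀ g h → g * + 2 - h * + 2 ≡ g * + 2 + h * + 2 - h * + 4
        lemma₁ = solve-∀
        lemma₂ : ∀ k h → k * + 4 - h * + 4 ≡ (k - h) * + 4
        lemma₂ = solve-∀
    go : Even (f + g) ⊎ Odd (f + g) → Even (f + h) ⊎ Odd (f + h) → Result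
    go (inj₁ e) _ = pair h f g e (trans m≡ (trans (sumOf4-swap₃₄ p (f * + 2) (g * + 2) (h * + 2))
      (sumOf4-swap₂₃ p (f * + 2) (h * + 2) (g * + 2))))
    go _ (inj₁ e) = pair g f h e (trans m≡ (sumOf4-swap₂₃ p (f * + 2) (g * + 2) (h * + 2)))
    go (inj₂ a) (inj₂ b) = pair f g h (odd+odd-even f g h a b) m≡

  module _ (h : ℤ) where

    p : ℤ
    p = + 2 * h

    odd+p : ∀ {x} → Odd x → Odd (x + p)
    odd+p {x} o = ∣-comb₂ (+ 1) h o (∣-refl {+ 2}) (lemma x h)
      where
      lemma : ∀ x h → x + + 2 * h + + 1 ≡ + 1 * (x + + 1) + h * + 2
      lemma = solve-∀

    pair-good : ∀ x y z → Odd z → Avoids (+ 2) (x + y) × Avoids (+ 2) (x - y) → m ≡ sumOf4 p x y z → Result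
    pair-good x y z o (a , b) m≡ = odd-even-good z p x y (odd+p {z} o) a b
      (trans m≡ (trans (sumOf4-swap₃₄ p x y z) (trans (sumOf4-swap₂₃ p x z y) (sumOf4-swap₁₂ p z x y))))

    same-side : ∀ q → Odd q → m ≡ sumOf4 p q (q + + 2) (q + + 2) → Result
    same-side q o m≡ = go (avoids? (+ 2) (q + + 2 + (q + + 2)))
      where
      lemma : ∀ q → q + + 2 + (q + + 2) - + 4 ≡ + 2 * q
      lemma = solve-∀
      cancel : ∀ q → q + + 2 - (q + + 2) ≡ + 0
      cancel = solve-∀
      difference-ok : Avoids (+ 2) (q + + 2 - (q + + 2))
      difference-ok = subst (Avoids (+ 2)) (sym (cancel q)) (from-no (≡±-dec (+ 0) (+ 2)))
      root : ∀ q₀ → q + + 2 + (q + + 2) - + 4 ≡ + 2 * q₀ → q ≡ q₀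
      root q₀ eq = *2-cancel {q} {q₀} (trans (sym (lemma q)) eq)
      small₁ : q ≡ - (+ 1) → Result
      small₁ refl = family₃ h (cong (+ 2 *_) m≡)
      small₃ : q ≡ - (+ 3) → Result
      small₃ refl = family₄ h (cong (+ 2 *_) m≡)
      go : q + + 2 + (q + + 2) ≡± + 2 ⊎ Avoids (+ 2) (q + + 2 + (q + + 2)) → Result
      go (inj₂ ok) = pair-good (q + + 2) (q + + 2) q o (ok , difference-ok)
        (trans m≡ (trans (sumOf4-swap₂₃ p q (q + + 2) (q + + 2)) (sumOf4-swap₃₄ p (q + + 2) q (q + + 2))))
      go (inj₁ (inj₁ eq)) = small₁ (root (- (+ 1)) (cong (_- + 4) eq))
      go (inj₁ (inj₂ eq)) = small₃ (root (- (+ 3)) (cong (_- + 4) eq))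

    both-sides : ∀ q → Odd q → m ≡ sumOf4 p q (q + + 2) (q - + 2) → Result
    both-sides q o m≡ = go (avoids? (+ 2) (q + + 2 + (q - + 2)))
      where
      lemma : ∀ q → q + + 2 + (q - + 2) ≡ + 2 * q
      lemma = solve-∀
      cancel : ∀ q → q + + 2 - (q - + 2) ≡ + 4
      cancel = solve-∀
      difference-ok : Avoids (+ 2) (q + + 2 - (q - + 2))
      difference-ok = subst (Avoids (+ 2)) (sym (cancel q)) (from-no (≡±-dec (+ 4) (+ 2)))
      root : ∀ q₀ → q + + 2 + (q - + 2) ≡ + 2 * q₀ → q ≡ q₀
      root q₀ eq = *2-cancel {q} {q₀} (trans (sym (lemma q)) eq)
      small₊ : q ≡ + 1 → Result
      small₊ refl = family₄ h (cong (+ 2 *_) (trans m≡ (sumOf4-swap₂₃ p (+ 1) (+ 3) (- (+ 1)))))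
      small₋ : q ≡ - (+ 1) → Result
      small₋ refl = family₄ h (cong (+ 2 *_) (trans m≡
        (trans (sumOf4-swap₃₄ p (- (+ 1)) (+ 1) (- (+ 3))) (sumOf4-swap₂₃ p (- (+ 1)) (- (+ 3)) (+ 1)))))
      go : q + + 2 + (q - + 2) ≡± + 2 ⊎ Avoids (+ 2) (q + + 2 + (q - + 2)) → Result
      go (inj₂ ok) = pair-good (q + + 2) (q - + 2) q o (ok , difference-ok)
        (trans m≡ (trans (sumOf4-swap₂₃ p q (q + + 2) (q - + 2)) (sumOf4-swap₃₄ p (q + + 2) q (q - + 2))))
      go (inj₁ (inj₁ eq)) = small₊ (root (+ 1) eq)
      go (inj₁ (inj₂ eq)) = small₋ (root (- (+ 1)) eq)

    three-odd : ∀ q r s → Odd q → Odd r → Odd s → m ≡ sumOf4 p q r s → Result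
    three-odd q r s q-odd r-odd s-odd m≡ = go (near? (+ 2) q r) (near? (+ 2) q s)
      where
      Near : ℤ → Set
      Near r = (Avoids (+ 2) (q + r) × Avoids (+ 2) (q - r)) ⊎ (r ≡± (q + + 2) ⊎ r ≡± (q - + 2))
      ±-flip : ∀ {r} → r ≡± (q - + 2) → r ≡± (- q + + 2)
      ±-flip (inj₁ refl) = inj₂ (lemma q)
        where
        lemma : ∀ q → q - + 2 ≡ - (- q + + 2)
        lemma = solve-∀
      ±-flip (inj₂ refl) = inj₁ (lemma q)
        where
        lemma : ∀ q → - (q - + 2) ≡ - q + + 2
        lemma = solve-∀
      go : Near r → Near s → Result
      go (inj₁ ok) _ = pair-good q r s s-odd ok m≡
      go _ (inj₁ ok) = pair-good q s r r-odd ok (trans m≡ (sumOf4-swap₃₄ p q r s))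
      go (inj₂ (inj₁ a)) (inj₂ (inj₁ b)) = same-side q q-odd (trans m≡ (sumOf4-± (±-refl p) (±-refl q) a b))
      go (inj₂ (inj₁ a)) (inj₂ (inj₂ b)) = both-sides q q-odd (trans m≡ (sumOf4-± (±-refl p) (±-refl q) a b))
      go (inj₂ (inj₂ a)) (inj₂ (inj₁ b)) = both-sides q q-odd
        (trans m≡ (trans (sumOf4-swap₃₄ p q r s) (sumOf4-± (±-refl p) (±-refl q) b a)))
      go (inj₂ (inj₂ a)) (inj₂ (inj₂ b)) = same-side (- q) (±-odd {x = - q} q-odd (inj₂ refl))
        (trans m≡ (sumOf4-± (±-refl p) (neg-≡± q) (±-flip a) (±-flip b)))

  start : OddOneOut m → Result
  start (p , q , r , s , a , b , c , m≡) = go (parity p)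
    where
    even-from : ∀ p q → Odd p → Odd (p + q) → Even q
    even-from p q o o+ = ∣-comb₂ (- (+ 1)) (+ 1) o o+ (lemma p q)
      where
      lemma : ∀ p q → q ≡ - (+ 1) * (p + + 1) + + 1 * (p + q + + 1)
      lemma = solve-∀
    odd-from : ∀ p q → Even p → Odd (p + q) → Odd q
    odd-from p q e o+ = ∣-comb₂ (- (+ 1)) (+ 1) e o+ (lemma p q)
      where
      lemma : ∀ p q → q + + 1 ≡ - (+ 1) * p + + 1 * (p + q + + 1)
      lemma = solve-∀
    evens : Odd p → Even q → Even r → Even s → Result
    evens p-odd (divides f refl) (divides g refl) (divides h refl) = one-odd p f g h p-odd m≡
    odds : Even p → Odd q → Odd r → Odd s → Result
    odds (divides h refl) q-odd r-odd s-odd = three-odd h q r s q-odd r-odd s-odd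
      (trans m≡ (cong (λ k → k * k + q * q + r * r + s * s) (ℤ.*-comm h (+ 2))))
    go : Even p ⊎ Odd p → Result
    go (inj₂ o) = evens o (even-from p q o a) (even-from p r o b) (even-from p s o c)
    go (inj₁ e) = odds e (odd-from p q e a) (odd-from p r e b) (odd-from p s e c)

-- Descent on powers of two

good-double : ∀ {ρ n} → Good ρ n → Good (+ 2 * ρ) (+ 4 * n)
good-double {ρ} (x , y , z , w , (a , b , c , d) , refl) = + 2 * x , + 2 * y , + 2 * z , + 2 * w ,
  (double x a , double y b , double z c , double w d) , identity x y z w
  where
  neg-double : ∀ ρ → - (+ 2 * ρ) ≡ + 2 * - ρ
  neg-double = solve-∀
  double : ∀ x → Avoids ρ x → Avoids (+ 2 * ρ) (+ 2 * x)
  double x ok (inj₁ eq) = ok (inj₁ (*2-cancel {x} {ρ} eq))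
  double x ok (inj₂ eq) = ok (inj₂ (*2-cancel {x} { - ρ} (trans eq (neg-double ρ))))
  identity : ∀ x y z w → + 4 * (x * x + y * y + z * z + w * w)
    ≡ + 2 * x * (+ 2 * x) + + 2 * y * (+ 2 * y) + + 2 * z * (+ 2 * z) + + 2 * w * (+ 2 * w)
  identity = solve-∀

exceptional-double : ∀ {ρ n} → Exceptional ρ n → Exceptional (+ 2 * ρ) (+ 4 * n)
exceptional-double {ρ} {n} = Any.map (λ {c} eq → trans (cong (+ 4 *_) eq) (lemma (+ c) ρ))
  where
  lemma : ∀ c ρ → + 4 * (c * (ρ * ρ)) ≡ c * (+ 2 * ρ * (+ 2 * ρ))
  lemma = solve-∀

-- The new entries are twice the reflection of (x, y, z, w) in the hyperplane orthogonal to (1, 1,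
-- 1, 1). All are congruent to s modulo 2, and s ≡ n is odd.
good-4*odd : ∀ {ρ n} → Even ρ → Odd n → FourSquares n → Good ρ (+ 4 * n)
good-4*odd {ρ} {n} ρ-even n-odd (x , y , z , w , refl) = + 2 * x - s , + 2 * y - s , + 2 * z - s , + 2 * w - s ,
  (ok x , ok y , ok z , ok w) , identity x y z w
  where
  s : ℤ
  s = x + y + z + w
  lemma₁ : ∀ n s → - s + + 1 ≡ + 1 * (n + + 1) + - (+ 1) * (n - s) + - s * + 2
  lemma₁ = solve-∀
  -s-odd : Odd (- s)
  -s-odd = ∣-comb₃ (+ 1) (- (+ 1)) (- s) n-odd (sumOf4-parity x y z w) (∣-refl {+ 2}) (lemma₁ n s)
  lemma₂ : ∀ x s → + 2 * x - s + + 1 ≡ + 1 * (- s + + 1) + x * + 2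
  lemma₂ = solve-∀
  ok : ∀ x → Avoids ρ (+ 2 * x - s)
  ok x p = odd⇒¬even (∣-comb₂ (+ 1) x -s-odd (∣-refl {+ 2}) (lemma₂ x s)) (±-∣ {+ 2} ρ-even p)
  identity : ∀ x y z w → + 4 * (x * x + y * y + z * z + w * w) ≡
    (+ 2 * x - (x + y + z + w)) * (+ 2 * x - (x + y + z + w)) + (+ 2 * y - (x + y + z + w)) *
      (+ 2 * y - (x + y + z + w))
    + (+ 2 * z - (x + y + z + w)) * (+ 2 * z - (x + y + z + w)) + (+ 2 * w - (x + y + z + w)) *
      (+ 2 * w - (x + y + z + w))
  identity = solve-∀

good-1-4* : ∀ {n} → FourSquares n → Good (+ 1) (+ 4 * n)
good-1-4* (x , y , z , w , refl) = + 2 * x , + 2 * y , + 2 * z , + 2 * w ,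
  (ok x , ok y , ok z , ok w) , identity x y z w
  where
  ok : ∀ x → Avoids (+ 1) (+ 2 * x)
  ok x = even⇒avoids-1 (even-double x)
  identity : ∀ x y z w → + 4 * (x * x + y * y + z * z + w * w)
    ≡ + 2 * x * (+ 2 * x) + + 2 * y * (+ 2 * y) + + 2 * z * (+ 2 * z) + + 2 * w * (+ 2 * w)
  identity = solve-∀

-- Defined over ℤ so that the power at `suc b` unfolds to the shape produced by `good-double` and
-- `exceptional-double`.
2^_ : ℕ → ℤ
2^ zero = + 1
2^ suc b = + 2 * 2^ b

+[2^n] : ∀ b → + (2 ^ b) ≡ 2^ b
+[2^n] zero = refl
+[2^n] (suc b) = trans (ℤ.pos-* 2 (2 ^ b)) (cong (+ 2 *_) (+[2^n] b))

3∤2^ : ∀ b → ¬ + 3 ∣ 2^ b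
3∤2^ zero = from-no (+ 3 ∣? + 1)
3∤2^ (suc b) d = 3∤2^ b (∣-comb₂ (- (+ 1)) (2^ b) d (∣-refl {+ 3}) (lemma (2^ b)))
  where
  lemma : ∀ x → x ≡ - (+ 1) * (+ 2 * x) + x * + 3
  lemma = solve-∀

4∣2^ : ∀ b → + 4 ∣ 2^ suc (suc b)
4∣2^ b = divides (2^ b) (lemma (2^ b))
  where
  lemma : ∀ x → + 2 * (+ 2 * x) ≡ x * + 4
  lemma = solve-∀

8∣2^ : ∀ b → + 8 ∣ 2^ suc (suc (suc b))
8∣2^ b = divides (2^ b) (lemma (2^ b))
  where
  lemma : ∀ x → + 2 * (+ 2 * (+ 2 * x)) ≡ x * + 8
  lemma = solve-∀

good-or-exceptional-odd : ∀ b {m} → Odd m → FourSquares m → FourSquares (+ 2 * m) →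
  Good (2^ b) (+ 2 * m) ⊎ Exceptional (2^ b) (+ 2 * m)
good-or-exceptional-odd 0 m-odd squares _ = good-or-exceptional₁ m-odd squares
good-or-exceptional-odd 1 m-odd squares _ = good-or-exceptional₂ m-odd squares
good-or-exceptional-odd (suc (suc b)) {m} m-odd _ squares = inj₁
  (Reflections.fourSquares⇒good (4∣2^ b) (3∤2^ (suc (suc b))) squares (double-odd {m} m-odd)
    (λ o → ⊥-elim (odd⇒¬even o (even-double m))))

+[h+h] : ∀ h → + (h ℕ.+ h) ≡ + 2 * + h
+[h+h] h = lemma (+ h)
  where
  lemma : ∀ x → x + x ≡ + 2 * x
  lemma = solve-∀

odd[1+h+h] : ∀ h → Odd (+ suc (h ℕ.+ h))
odd[1+h+h] h = divides (+ 1 + + h) (lemma (+ h))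
  where
  lemma : ∀ x → + 1 + (x + x) + + 1 ≡ (+ 1 + x) * + 2
  lemma = solve-∀

-- Even numbers 2k let the recursion keep its shape: 2k = 8j passes to 2j with half the ρ. The other
-- cases end at once: k odd, 2k = 4h with h odd, and, for ρ = 1, every multiple of 4.
good-or-exceptional : ∀ b k → Good (2^ b) (+ 2 * + k) ⊎ Exceptional (2^ b) (+ 2 * + k)
good-or-exceptional b k = by-half (halve k)
  where
  Result : ℤ → Set
  Result n = Good (2^ b) n ⊎ Exceptional (2^ b) n

  quadruple : ∀ h → + 4 * + h ≡ + 2 * + (h ℕ.+ h)
  quadruple h = trans (lemma (+ h)) (cong (+ 2 *_) (sym (+[h+h] h)))
    where
    lemma : ∀ x → + 4 * x ≡ + 2 * (+ 2 * x)
    lemma = solve-∀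

  multiple-of-4 : ∀ b h → (∃ λ j → h ≡ j ℕ.+ j ⊎ h ≡ suc (j ℕ.+ j)) →
    Good (2^ b) (+ 4 * + h) ⊎ Exceptional (2^ b) (+ 4 * + h)
  multiple-of-4 zero h _ = inj₁ (good-1-4* (fourSquares h))
  multiple-of-4 (suc b) h (j , inj₂ refl) = inj₁
    (good-4*odd (even-double (2^ b)) (odd[1+h+h] j) (fourSquares h))
  multiple-of-4 (suc b) h (j , inj₁ refl) =
    [ inj₁ ∘ transport-good , inj₂ ∘ transport-exceptional ]′ (good-or-exceptional b j)
    where
    transport-good : Good (2^ b) (+ 2 * + j) → Good (+ 2 * 2^ b) (+ 4 * + (j ℕ.+ j))
    transport-good g = subst (λ n → Good (+ 2 * 2^ b) (+ 4 * n)) (sym (+[h+h] j)) (good-double g)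
    transport-exceptional : Exceptional (2^ b) (+ 2 * + j) → Exceptional (+ 2 * 2^ b) (+ 4 * + (j ℕ.+ j))
    transport-exceptional e = subst (λ n → Exceptional (+ 2 * 2^ b) (+ 4 * n)) (sym (+[h+h] j))
      (exceptional-double {2^ b} {+ 2 * + j} e)

  by-half : (∃ λ h → k ≡ h ℕ.+ h ⊎ k ≡ suc (h ℕ.+ h)) → Result (+ 2 * + k)
  by-half (h , inj₁ refl) = subst Result (quadruple h) (multiple-of-4 b h (halve h))
  by-half (h , inj₂ refl) = good-or-exceptional-odd b (odd[1+h+h] h) (fourSquares k)
    (subst FourSquares (+[h+h] k) (fourSquares (k ℕ.+ k)))

-- Representations by natural numbers

good⇒rep : ∀ {ρ n} → Good (+ ρ) (+ n) → Rep ρ 4 n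
good⇒rep {ρ} {n} (x , y , z , w , (a , b , c , d) , n≡) =
  abs x ∷ abs y ∷ abs z ∷ abs w ∷ [] , ok x a ∷ ok y b ∷ ok z c ∷ ok w d ∷ [] ,
  ℤ.+-injective (trans (cong₂ _+_ (+∣x∣*∣x∣ x)
    (cong₂ _+_ (+∣x∣*∣x∣ y) (cong₂ _+_ (+∣x∣*∣x∣ z) (cong (_+ + 0) (+∣x∣*∣x∣ w)))))
    (trans (assoc (x * x) (y * y) (z * z) (w * w)) (sym n≡)))
  where
  ∣x∣≡ρ : ∀ x {k} → abs x ≡ k → x ≡± + k
  ∣x∣≡ρ (+ _) refl = inj₁ refl
  ∣x∣≡ρ -[1+ _ ] refl = inj₂ refl
  ok : ∀ x → Avoids (+ ρ) x → abs x ≢ ρ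
  ok x x-ok eq = x-ok (∣x∣≡ρ x eq)
  assoc : ∀ a b c d → a + (b + (c + (d + + 0))) ≡ a + b + c + d
  assoc = solve-∀

rep⇒good : ∀ {ρ n} → Rep ρ 4 n → Good (+ ρ) (+ n)
rep⇒good {ρ} (x ∷ y ∷ z ∷ w ∷ [] , a ∷ b ∷ c ∷ d ∷ [] , refl) = + x , + y , + z , + w ,
  (ok a , ok b , ok c , ok d) ,
  trans (cong₂ _+_ (ℤ.pos-* x x) (cong₂ _+_ (ℤ.pos-* y y)
    (cong₂ _+_ (ℤ.pos-* z z) (cong (_+ + 0) (ℤ.pos-* w w)))))
    (assoc (+ x * + x) (+ y * + y) (+ z * + z) (+ w * + w))
  where
  ok : ∀ {x} → x ≢ ρ → Avoids (+ ρ) (+ x)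
  ok x≢ρ (inj₁ eq) = x≢ρ (ℤ.+-injective eq)
  ok x≢ρ (inj₂ eq) = x≢ρ (trans (cong abs eq) (ℤ.∣-i∣≡∣i∣ (+ ρ)))
  assoc : ∀ a b c d → a + (b + (c + (d + + 0))) ≡ a + b + c + d
  assoc = solve-∀

-- Since 0 lies in S_ρ, short representations can be padded.
rep-suc : ∀ {ρ m n} → 0 ≢ ρ → Rep ρ m n → Rep ρ (suc m) n
rep-suc 0≢ρ (xs , xs≢ρ , eq) = 0 ∷ xs , 0≢ρ ∷ xs≢ρ , eq

rep-mono : ∀ {ρ m m′ n} → 0 ≢ ρ → m ℕ.≤′ m′ → Rep ρ m n → Rep ρ m′ n
rep-mono 0≢ρ (ℕ.≤′-reflexive refl) rep = rep
rep-mono 0≢ρ (ℕ.≤′-step m≤m′) rep = rep-suc 0≢ρ (rep-mono 0≢ρ m≤m′ rep)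

Nset≡ : ∀ a → Nset a ≡ map (λ c → c ℕ.* (2 ^ a ℕ.* 2 ^ a)) exceptions
Nset≡ a = cong₂ _∷_ (lemma₈ h) (cong₂ _∷_ (lemma₂₄ h) (cong₂ _∷_ (lemma₄₀ h)
  (cong₂ _∷_ (lemma₅₆ h) (cong₂ _∷_ (lemma₁₂₀ h) (cong₂ _∷_ (lemma₁₈₄ h) refl)))))
  where
  h : ℕ
  h = 2 ^ a
  lemma₈ : ∀ h → 2 ℕ.* (2 ℕ.* h ℕ.* (2 ℕ.* h)) ≡ 8 ℕ.* (h ℕ.* h)
  lemma₈ = ℕSolver.solve-∀
  lemma₂₄ : ∀ h → 6 ℕ.* (2 ℕ.* h ℕ.* (2 ℕ.* h)) ≡ 24 ℕ.* (h ℕ.* h)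
  lemma₂₄ = ℕSolver.solve-∀
  lemma₄₀ : ∀ h → 10 ℕ.* (2 ℕ.* h ℕ.* (2 ℕ.* h)) ≡ 40 ℕ.* (h ℕ.* h)
  lemma₄₀ = ℕSolver.solve-∀
  lemma₅₆ : ∀ h → 14 ℕ.* (2 ℕ.* h ℕ.* (2 ℕ.* h)) ≡ 56 ℕ.* (h ℕ.* h)
  lemma₅₆ = ℕSolver.solve-∀
  lemma₁₂₀ : ∀ h → 30 ℕ.* (2 ℕ.* h ℕ.* (2 ℕ.* h)) ≡ 120 ℕ.* (h ℕ.* h)
  lemma₁₂₀ = ℕSolver.solve-∀
  lemma₁₈₄ : ∀ h → 46 ℕ.* (2 ℕ.* h ℕ.* (2 ℕ.* h)) ≡ 184 ℕ.* (h ℕ.* h)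
  lemma₁₈₄ = ℕSolver.solve-∀

exceptional⇒∈Nset : ∀ a {n} → Exceptional (+ (2 ^ suc a)) (+ n) → n ∈ Nset a
exceptional⇒∈Nset a {n} exc = subst (n ∈_) (sym (Nset≡ a))
  (Any.map⁺ {f = λ c → c ℕ.* (2 ^ a ℕ.* 2 ^ a)} (Any.map (λ {c} → descale {c}) exc))
  where
  h : ℕ
  h = 2 ^ a
  lemma : ∀ c h → c * (+ 2 * h * (+ 2 * h)) ≡ + 4 * (c * (h * h))
  lemma = solve-∀
  descale : ∀ {c} → + 4 * + n ≡ + c * (+ (2 ^ suc a) * + (2 ^ suc a)) → n ≡ c ℕ.* (h ℕ.* h)
  descale {c} eq = ℤ.+-injective (ℤ.*-cancelˡ-≡ (+ 4) (+ n) (+ (c ℕ.* (h ℕ.* h))) (begin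
    + 4 * + n                                  ≡⟨ eq ⟩
    + c * (+ (2 ℕ.* h) * + (2 ℕ.* h))          ≡⟨ cong (λ k → + c * (k * k)) (ℤ.pos-* 2 h) ⟩
    + c * (+ 2 * + h * (+ 2 * + h))            ≡⟨ lemma (+ c) (+ h) ⟩
    + 4 * (+ c * (+ h * + h))                  ≡⟨ cong (λ k → + 4 * (+ c * k)) (ℤ.pos-* h h) ⟨
    + 4 * (+ c * + (h ℕ.* h))                  ≡⟨ cong (+ 4 *_) (ℤ.pos-* c (h ℕ.* h)) ⟨
    + 4 * + (c ℕ.* (h ℕ.* h))                  ∎))
    where open ≡-Reasoning

rep₄ : ∀ a → 2 ≤ a → ∀ n → ¬ n ∈ Nset a → Rep (2 ^ suc a) 4 n
rep₄ 1 (s≤s ())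
rep₄ a@(suc (suc b)) _ n n∉ = good⇒rep (by-half (halve n))
  where
  ρ≡ : + (2 ^ suc a) ≡ 2^ suc a
  ρ≡ = +[2^n] (suc a)
  not-exceptional : ∀ h → n ≡ h ℕ.+ h → ¬ Exceptional (2^ suc a) (+ 2 * + h)
  not-exceptional h n≡ exc = n∉ (exceptional⇒∈Nset a
    (subst₂ Exceptional (sym ρ≡) (sym (trans (cong +_ n≡) (+[h+h] h))) exc))
  odd⇒4∤ : ∀ {x} → Odd x → ¬ + 4 ∣ x
  odd⇒4∤ o d = odd⇒¬even o (∣-trans (divides (+ 2) refl) d)
  by-half : (∃ λ h → n ≡ h ℕ.+ h ⊎ n ≡ suc (h ℕ.+ h)) → Good (+ (2 ^ suc a)) (+ n)
  by-half (h , inj₁ n≡) = subst₂ Good (sym ρ≡) (sym (trans (cong +_ n≡) (+[h+h] h)))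
    ([ (λ good → good) , (λ exc → ⊥-elim (not-exceptional h n≡ exc)) ]′ (good-or-exceptional (suc a) h))
  -- No descent for odd n; 8 ∣ ρ comes from a = b + 2.
  by-half (h , inj₂ refl) = subst (λ ρ → Good ρ (+ n)) (sym ρ≡)
    (Reflections.fourSquares⇒good (4∣2^ (suc b)) (3∤2^ (suc a)) (fourSquares n) (odd⇒4∤ (odd[1+h+h] h))
      (λ _ → 8∣2^ b))

-- Five squares for the exceptional values

Rep5 : ℕ → Set
Rep5 c = ∃ λ (v : Vec ℕ 5) → VecAll.All (_≢ 4) v × sumSq v ≡ 4 ℕ.* c

-- For ρ = 4 the exceptional value belonging to c is 4c, and a larger ρ only scales it. A smaller ρ
-- would not do as a base: 2ρ² is 2 for ρ = 1 and 8 for ρ = 2, and neither is a sum of five squares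
-- from S_ρ.
exceptions-rep₅ : List.All Rep5 exceptions
exceptions-rep₅ =
    witness 8 (5 ∷ 2 ∷ 1 ∷ 1 ∷ 1 ∷ [])
  ∷ witness 24 (9 ∷ 3 ∷ 2 ∷ 1 ∷ 1 ∷ [])
  ∷ witness 40 (12 ∷ 2 ∷ 2 ∷ 2 ∷ 2 ∷ [])
  ∷ witness 56 (14 ∷ 5 ∷ 1 ∷ 1 ∷ 1 ∷ [])
  ∷ witness 120 (14 ∷ 13 ∷ 9 ∷ 5 ∷ 3 ∷ [])
  ∷ witness 184 (14 ∷ 14 ∷ 14 ∷ 12 ∷ 2 ∷ [])
  ∷ witness 6 (3 ∷ 3 ∷ 2 ∷ 1 ∷ 1 ∷ [])
  ∷ witness 14 (7 ∷ 2 ∷ 1 ∷ 1 ∷ 1 ∷ [])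
  ∷ witness 22 (9 ∷ 2 ∷ 1 ∷ 1 ∷ 1 ∷ [])
  ∷ witness 30 (10 ∷ 3 ∷ 3 ∷ 1 ∷ 1 ∷ [])
  ∷ []
  where
  ≢4? : ∀ x → Dec (x ≢ 4)
  ≢4? x = ¬? (x ℕ.≟ 4)
  witness : ∀ c (v : Vec ℕ 5) → {_ : True (VecAll.all? ≢4? v)} → {_ : True (sumSq v ℕ.≟ 4 ℕ.* c)} → Rep5 c
  witness _ v {p} {q} = v , toWitness p , toWitness q

sumSq-scale : ∀ {m} g (v : Vec ℕ m) → sumSq (Vec.map (ℕ._* g) v) ≡ sumSq v ℕ.* (g ℕ.* g)
sumSq-scale g [] = refl
sumSq-scale g (x ∷ v) = trans (cong (x ℕ.* g ℕ.* (x ℕ.* g) ℕ.+_) (sumSq-scale g v)) (lemma x g (sumSq v))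
  where
  lemma : ∀ x g s → x ℕ.* g ℕ.* (x ℕ.* g) ℕ.+ s ℕ.* (g ℕ.* g) ≡ (x ℕ.* x ℕ.+ s) ℕ.* (g ℕ.* g)
  lemma = ℕSolver.solve-∀

≢-scale : ∀ {m k} g .{{_ : ℕ.NonZero g}} {v : Vec ℕ m} → VecAll.All (_≢ k) v → VecAll.All (_≢ k ℕ.* g)
  (Vec.map (ℕ._* g) v)
≢-scale g [] = []
≢-scale {k = k} g {x ∷ v} (x≢k ∷ v≢k) = (λ eq → x≢k (ℕ.*-cancelʳ-≡ x k g eq)) ∷ ≢-scale g v≢k

rep₅-exceptional : ∀ a → 1 ≤ a → ∀ n → n ∈ Nset a → Rep (2 ^ suc a) 5 n
rep₅-exceptional a@(suc b) _ n n∈ = build (find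
  (Any.map⁻ {f = λ c → c ℕ.* (2 ^ a ℕ.* 2 ^ a)} (subst (n ∈_) (Nset≡ a) n∈)))
  where
  g : ℕ
  g = 2 ^ b
  lemma₁ : ∀ g → 4 ℕ.* g ≡ 2 ℕ.* (2 ℕ.* g)
  lemma₁ = ℕSolver.solve-∀
  lemma₂ : ∀ c g → 4 ℕ.* c ℕ.* (g ℕ.* g) ≡ c ℕ.* (2 ℕ.* g ℕ.* (2 ℕ.* g))
  lemma₂ = ℕSolver.solve-∀
  build : (∃ λ c → c ∈ exceptions × n ≡ c ℕ.* (2 ^ a ℕ.* 2 ^ a)) → Rep (2 ^ suc a) 5 n
  build (c , c∈ , n≡) = scale (List.lookup exceptions-rep₅ c∈)
    where
    scale : Rep5 c → Rep (2 ^ suc a) 5 n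
    scale (v , v≢4 , eq) = Vec.map (ℕ._* g) v ,
      subst (λ ρ → VecAll.All (_≢ ρ) (Vec.map (ℕ._* g) v)) (lemma₁ g) (≢-scale g {{ℕ.m^n≢0 2 b}} v≢4) ,
      trans (sumSq-scale g v) (trans (cong (ℕ._* (g ℕ.* g)) eq) (trans (lemma₂ c g) (sym n≡)))

0≢2^ : ∀ a → 0 ≢ 2 ^ a
0≢2^ a eq = ℕ.≢-nonZero⁻¹ (2 ^ a) {{ℕ.m^n≢0 2 a}} (sym eq)

rep₅ : ∀ a → 2 ≤ a → ∀ n → Rep (2 ^ suc a) 5 n
rep₅ a 2≤a n = by-membership (n ∈? Nset a)
  where
  open DecMembership using (_∈?_)
  by-membership : Dec (n ∈ Nset a) → Rep (2 ^ suc a) 5 n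
  by-membership (yes n∈) = rep₅-exceptional a (ℕ.≤-trans (s≤s z≤n) 2≤a) n n∈
  by-membership (no n∉) = rep-suc {m = 4} (0≢2^ (suc a)) (rep₄ a 2≤a n n∉)

-- The value 2ρ² needs five squares

even-square : ∀ {x} → Even x → + 4 ∣ x * x - + 0
even-square (divides q refl) = divides (q * q) (lemma q)
  where
  lemma : ∀ q → q * + 2 * (q * + 2) - + 0 ≡ q * q * + 4
  lemma = solve-∀

odd-square : ∀ {x} → Odd x → + 8 ∣ x * x - + 1
odd-square {x} (divides q x+1≡2q) = from-pronic (pronic q)
  where
  lemma₁ : ∀ x → x * x - + 1 ≡ (x + + 1) * (x + + 1 - + 2)
  lemma₁ = solve-∀
  lemma₂ : ∀ q → q * + 2 * (q * + 2 - + 2) ≡ q * (q - + 1) * + 4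
  lemma₂ = solve-∀
  lemma₃ : ∀ r → r * + 2 * + 4 ≡ r * + 8
  lemma₃ = solve-∀
  from-pronic : Even (q * (q - + 1)) → + 8 ∣ x * x - + 1
  from-pronic (divides r eq) = divides r (trans (lemma₁ x) (trans (cong (λ k → k * (k - + 2)) x+1≡2q)
    (trans (lemma₂ q) (trans (cong (_* + 4) eq) (lemma₃ r)))))

sumOf4-remainder : ∀ {d} a b c e {x y z w} → d ∣ x * x - a → d ∣ y * y - b → d ∣ z * z - c → d ∣ w * w - e →
  d ∣ sumOf4 x y z w → d ∣ a + b + c + e
sumOf4-remainder a b c e {x} {y} {z} {w} p q r s total = ∣-comb₂ (+ 1) (- (+ 1)) total
  (∣m∣n⇒∣m+n (∣m∣n⇒∣m+n (∣m∣n⇒∣m+n p q) r) s) (lemma a b c e (x * x) (y * y) (z * z) (w * w))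
  where
  lemma : ∀ a b c e x y z w → a + b + c + e ≡ + 1 * (x + y + z + w) + - (+ 1) *
    ((x - a) + (y - b) + (z - c) + (w - e))
  lemma = solve-∀

-- Squares are 0 or 1 modulo 4, so an odd x forces all four entries to be odd; but four odd squares
-- add up to 4 modulo 8. The other entries follow by symmetry.
8∣sumOf4⇒even : ∀ {x y z w} → + 8 ∣ sumOf4 x y z w → Even x
8∣sumOf4⇒even {x} {y} {z} {w} 8∣ = [ (λ e → e) , (λ o → ⊥-elim (go o (parity y) (parity z) (parity w))) ]′
  (parity x)
  where
  4∣8 : + 4 ∣ + 8
  4∣8 = divides (+ 2) refl
  total : + 4 ∣ sumOf4 x y z w
  total = ∣-trans 4∣8 8∣
  O : ∀ {x} → Odd x → + 4 ∣ x * x - + 1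
  O {x} o = ∣-trans 4∣8 (odd-square {x} o)
  rem : ∀ b c e → + 4 ∣ x * x - + 1 → + 4 ∣ y * y - b → + 4 ∣ z * z - c → + 4 ∣ w * w - e →
    + 4 ∣ + 1 + b + c + e
  rem b c e p q r s = sumOf4-remainder (+ 1) b c e {x} {y} {z} {w} p q r s total
  go : Odd x → Even y ⊎ Odd y → Even z ⊎ Odd z → Even w ⊎ Odd w → ⊥
  go o (inj₁ a) (inj₁ b) (inj₁ c) = from-no (+ 4 ∣? + 1)
    (rem (+ 0) (+ 0) (+ 0) (O {x} o) (even-square a) (even-square b) (even-square c))
  go o (inj₁ a) (inj₁ b) (inj₂ c) = from-no (+ 4 ∣? + 2)
    (rem (+ 0) (+ 0) (+ 1) (O {x} o) (even-square a) (even-square b) (O {w} c))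
  go o (inj₁ a) (inj₂ b) (inj₁ c) = from-no (+ 4 ∣? + 2)
    (rem (+ 0) (+ 1) (+ 0) (O {x} o) (even-square a) (O {z} b) (even-square c))
  go o (inj₁ a) (inj₂ b) (inj₂ c) = from-no (+ 4 ∣? + 3)
    (rem (+ 0) (+ 1) (+ 1) (O {x} o) (even-square a) (O {z} b) (O {w} c))
  go o (inj₂ a) (inj₁ b) (inj₁ c) = from-no (+ 4 ∣? + 2)
    (rem (+ 1) (+ 0) (+ 0) (O {x} o) (O {y} a) (even-square b) (even-square c))
  go o (inj₂ a) (inj₁ b) (inj₂ c) = from-no (+ 4 ∣? + 3)
    (rem (+ 1) (+ 0) (+ 1) (O {x} o) (O {y} a) (even-square b) (O {w} c))
  go o (inj₂ a) (inj₂ b) (inj₁ c) = from-no (+ 4 ∣? + 3)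
    (rem (+ 1) (+ 1) (+ 0) (O {x} o) (O {y} a) (O {z} b) (even-square c))
  go o (inj₂ a) (inj₂ b) (inj₂ c) = from-no (+ 8 ∣? + 4)
    (sumOf4-remainder (+ 1) (+ 1) (+ 1) (+ 1) {x} {y} {z} {w}
    (odd-square {x} o) (odd-square {y} a) (odd-square {z} b) (odd-square {w} c) 8∣)

¬good-2 : ¬ Good (+ 1) (+ 2)
¬good-2 (x , y , z , w , (a , b , c , d) , eq) =
  sum≢2 (abs x) (abs y) (abs z) (abs w) (ok x a) (ok y b) (ok z c) (ok w d)
    (ℤ.+-injective (trans (cong₂ _+_ (cong₂ _+_ (cong₂ _+_ (+∣x∣*∣x∣ x) (+∣x∣*∣x∣ y)) (+∣x∣*∣x∣ z))
      (+∣x∣*∣x∣ w)) (sym eq)))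
  where
  ok : ∀ x → Avoids (+ 1) x → abs x ≢ 1
  ok (+ _) x-ok refl = x-ok (inj₁ refl)
  ok -[1+ _ ] x-ok refl = x-ok (inj₂ refl)
  vanishes : ∀ k → k ≢ 1 → k ℕ.* k ≤ 2 → k ≡ 0
  vanishes 0 _ _ = refl
  vanishes 1 k≢1 _ = contradiction refl k≢1
  vanishes k@(suc (suc _)) _ k²≤2 = contradiction
    (ℕ.≤-trans (ℕ.*-mono-≤ {2} {k} {2} {k} (s≤s (s≤s z≤n)) (s≤s (s≤s z≤n))) k²≤2) λ { (s≤s (s≤s ())) }
  sum≢2 : ∀ p q r s → p ≢ 1 → q ≢ 1 → r ≢ 1 → s ≢ 1 → p ℕ.* p ℕ.+ q ℕ.* q ℕ.+ r ℕ.* r ℕ.+ s ℕ.* s ≢ 2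
  sum≢2 p q r s p≢1 q≢1 r≢1 s≢1 eq
    with refl ← vanishes s s≢1 (ℕ.m+n≤o⇒n≤o _ (ℕ.≤-reflexive eq))
       | p+q+r≤2 ← ℕ.m+n≤o⇒m≤o (p ℕ.* p ℕ.+ q ℕ.* q ℕ.+ r ℕ.* r) (ℕ.≤-reflexive eq)
    with refl ← vanishes r r≢1 (ℕ.m+n≤o⇒n≤o _ p+q+r≤2)
       | p+q≤2 ← ℕ.m+n≤o⇒m≤o (p ℕ.* p ℕ.+ q ℕ.* q) p+q+r≤2
    with refl ← vanishes q q≢1 (ℕ.m+n≤o⇒n≤o _ p+q≤2)
       | refl ← vanishes p p≢1 (ℕ.m+n≤o⇒m≤o (p ℕ.* p) p+q≤2)
    with () ← eq

-- For even ρ, 8 ∣ 2ρ² makes all entries even. Halving them and ρ leads down to ρ = 1, where 2 can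
-- only be 1 + 1 + 0 + 0.
¬good-2ρ² : ∀ b → ¬ Good (2^ b) (+ 2 * (2^ b * 2^ b))
¬good-2ρ² zero = ¬good-2
¬good-2ρ² (suc b) (x , y , z , w , oks , eq) = go
  (8∣sumOf4⇒even {x} {y} {z} {w} 8∣)
  (8∣sumOf4⇒even {y} {x} {z} {w} (subst (+ 8 ∣_) (sumOf4-swap₁₂ x y z w) 8∣))
  (8∣sumOf4⇒even {z} {x} {y} {w} (subst (+ 8 ∣_) (trans (sumOf4-swap₂₃ x y z w) (sumOf4-swap₁₂ x z y w)) 8∣))
  (8∣sumOf4⇒even {w} {x} {y} {z} (subst (+ 8 ∣_)
    (trans (sumOf4-swap₃₄ x y z w) (trans (sumOf4-swap₂₃ x y w z) (sumOf4-swap₁₂ x w y z))) 8∣)) oks eq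
  where
  ρ : ℤ
  ρ = 2^ b
  multiple : ∀ ρ → + 2 * (+ 2 * ρ * (+ 2 * ρ)) ≡ ρ * ρ * + 8
  multiple = solve-∀
  8∣ : + 8 ∣ sumOf4 x y z w
  8∣ = divides (ρ * ρ) (trans (sym eq) (multiple ρ))
  lemma₁ : ∀ ρ → + 4 * (+ 2 * (ρ * ρ)) ≡ + 2 * (+ 2 * ρ * (+ 2 * ρ))
  lemma₁ = solve-∀
  lemma₂ : ∀ x y z w → x * + 2 * (x * + 2) + y * + 2 * (y * + 2) + z * + 2 * (z * + 2) + w * + 2 * (w * + 2)
    ≡ + 4 * (x * x + y * y + z * z + w * w)
  lemma₂ = solve-∀
  neg-double : ∀ ρ → - ρ * + 2 ≡ - (+ 2 * ρ)
  neg-double = solve-∀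
  halve-ok : ∀ x → Avoids (+ 2 * ρ) (x * + 2) → Avoids ρ x
  halve-ok x ok (inj₁ refl) = ok (inj₁ (ℤ.*-comm ρ (+ 2)))
  halve-ok x ok (inj₂ refl) = ok (inj₂ (neg-double ρ))
  go : Even x → Even y → Even z → Even w → Avoids (+ 2 * ρ) x × Avoids (+ 2 * ρ) y × Avoids
    (+ 2 * ρ) z × Avoids (+ 2 * ρ) w →
    + 2 * (+ 2 * ρ * (+ 2 * ρ)) ≡ sumOf4 x y z w → ⊥
  go (divides x′ refl) (divides y′ refl) (divides z′ refl) (divides w′ refl) (a , b′ , c , d) eq =
    ¬good-2ρ² b (x′ , y′ , z′ , w′ , (halve-ok x′ a , halve-ok y′ b′ , halve-ok z′ c , halve-ok w′ d) ,
      ℤ.*-cancelˡ-≡ (+ 4) (+ 2 * (ρ * ρ)) (sumOf4 x′ y′ z′ w′)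
        (trans (lemma₁ ρ) (trans eq (lemma₂ x′ y′ z′ w′))))

¬rep₄-2ρ² : ∀ a → ¬ Rep (2 ^ a) 4 (2 ℕ.* (2 ^ a ℕ.* 2 ^ a))
¬rep₄-2ρ² a rep = ¬good-2ρ² a (subst₂ Good (+[2^n] a) 2ρ² (rep⇒good rep))
  where
  2ρ² : + (2 ℕ.* (2 ^ a ℕ.* 2 ^ a)) ≡ + 2 * (2^ a * 2^ a)
  2ρ² = trans (ℤ.pos-* 2 (2 ^ a ℕ.* 2 ^ a)) (cong (+ 2 *_) (trans (ℤ.pos-* (2 ^ a) (2 ^ a))
    (cong₂ _*_ (+[2^n] a) (+[2^n] a))))

-- The value 5 is attained at 2ρ², because fewer squares could be padded with 0 to four. Since
-- `rep₅` holds for every n, no minimum exceeds 5.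
maximum-5 : ∀ a → 2 ≤ a → MIs (2 ^ suc a) 5
maximum-5 a 2≤a = (n , n>0 , s≤s z≤n , rep₅ a 2≤a n , not-fewer) , at-most
  where
  n : ℕ
  n = 2 ℕ.* (2 ^ suc a ℕ.* 2 ^ suc a)
  n>0 : 1 ≤ n
  n>0 = ℕ.*-mono-≤ {1} {2} (s≤s z≤n) (ℕ.*-mono-≤ (ℕ.m^n>0 2 (suc a)) (ℕ.m^n>0 2 (suc a)))
  not-fewer : ∀ m → 1 ≤ m → m ℕ.< 5 → ¬ Rep (2 ^ suc a) m n
  not-fewer m _ (s≤s m≤4) rep = ¬rep₄-2ρ² (suc a) (rep-mono (0≢2^ (suc a)) (ℕ.≤⇒≤′ m≤4) rep)
  at-most : ∀ n k → 1 ≤ n → KIs (2 ^ suc a) n k → k ≤ 5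
  at-most n k _ (_ , _ , minimal) = ℕ.≮⇒≥ λ 5<k → minimal 5 (s≤s z≤n) 5<k (rep₅ a 2≤a n)

theorem3p2 : (a : ℕ) → 2 ≤ a →
    ((n : ℕ) → 1 ≤ n → ¬ (n ∈ Nset a) → Rep (2 ^ suc a) 4 n)
    × ((n : ℕ) → n ∈ Nset a → Rep (2 ^ suc a) 5 n)
    × MIs (2 ^ suc a) 5
theorem3p2 a 2≤a = (λ n _ → rep₄ a 2≤a n) , (λ n _ → rep₅ a 2≤a n) , maximum-5 a 2≤a
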